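{- There is a hybrid dynamic programming algorithm (\textsc{algorithm TwoLevel}) on the uniform-cost RAM which, given any instance of the optimum-BST problem on the two-level memory model HMM$_2$ with $n$ keys and memory levels of sizes $m_1$ and $m_2$, $m_1+m_2=n$, constructs an optimum solution $\langle T^*,\phi^*\rangle$ in time $$O\bigl(n(n-m)+m\,n^2(n-m)^2\bigr)=O\bigl(m\,n^2(n-m)^2\bigr),\qquad m=\min\{m_1,m_2\}.$$
   Context: Binary search trees. Given $n\ge 1$ keys $x_1\prec x_2\prec\cdots\prec x_n$ from a totally ordered universe, a binary search tree (BST) $T$ over the keys is an ordered rooted binary tree with $n$ internal nodes, identified with the keys so that an inorder traversal visits $x_1,\dots,x_n$ in order, and $n+1$ external nodes (leaves) $z_0,\dots,z_n$ from left to right, where $z_j$ represents the search arguments $y$ with $x_j\prec y\prec x_{j+1}$ (with the convention that $z_0$ means $y\prec x_1$ and $z_n$ means $y\succ x_n$). Also given are $p_i\ge 0$ ($1\le i\le n$), the probability that $y=x_i$, and $q_j\ge 0$ ($0\le j\le n$), the probability that $y$ falls in the interval of $z_j$; $\sum_i p_i+\sum_j q_j=1$. For a node $v$ of $T$, let $T_v$ be the subtree rooted at $v$ and let $w(T_v)$ be the sum of all $p_i$ and $q_j$ over the internal nodes $x_i$ and external nodes $z_j$ in $T_v$; in particular $w(T_{z_j})=q_j$. Two-level memory (HMM$_2$). There are $n=m_1+m_2$ memory locations with addresses $1,\dots,n$. A single access to address $a$ costs $\mu(a)=c_1$ for $1\le a\le m_1$ and $\mu(a)=c_2$ for $m_1<a\le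 n$, where $c_1<c_2$ are natural numbers. The problem. A solution is a pair $\langle T,\phi\rangle$ of a BST $T$ over the keys and a one-to-one memory assignment $\phi$ of the internal nodes of $T$ to the addresses $\{1,\dots,n\}$. External nodes are not stored; for an external node $z_j$, $\phi(z_j)$ denotes the address at which the parent of $z_j$ is stored. The cost of a solution (called the expected cost of a search) is $$\mathrm{cost}(\langle T,\phi\rangle)=\sum_{i=1}^n w(T_{x_i})\,\mu(\phi(x_i))+\sum_{j=0}^n w(T_{z_j})\,\mu(\phi(z_j)).$$ A solution is optimum if its cost is minimum over all pairs $\langle T,\phi\rangle$. The algorithm is given the $p_i$, $q_j$, $m_1,m_2$ and $c_1,c_2$. Uniform-cost RAM: each memory access, arithmetic operation and comparison on numbers takes unit time. -}

module Defs where

open import Level using (0ℓ) renaming (suc to lsuc)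
open import Algebra.Bundles using (CommutativeRing)
import Algebra.Properties.Monoid.Sum as MonoidSum
import Algebra.Definitions.RawMonoid as RawMonoidDefs
open import Data.Bool.Base using (if_then_else_)
open import Data.Fin.Base using (Fin; zero; suc; toℕ; fromℕ; inject₁)
open import Data.Fin.Properties using (toℕ-inject₁; toℕ-fromℕ)
open import Data.List.Base using (List; []; _∷_; [_]; _++_; map; upTo; head; drop)
open import Data.List.Properties using (++-assoc; ++-identityʳ; map-++; upTo-∷ʳ)
open import Data.Maybe.Base as Maybe using (Maybe; just; nothing)
open import Data.Nat.Base as ℕ using (ℕ; suc)
import Data.Nat.Properties as ℕ
open import Data.Product.Base using (Σ; _×_)
open import Function.Bundles using (_↣_; module Injection)
open import Relation.Binary.Core using (Rel)
open import Relation.Binary.PropositionalEquality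
  using (_≡_; trans; cong; module ≡-Reasoning)
open import Relation.Binary.Structures using (IsDecTotalOrder)
open import Relation.Nullary.Decidable.Core using (does)

-- The numbers in which probabilities and costs live.  ℚ is an instance; so,
-- classically, is ℝ (the order is decidable because the machine below can
-- compare two numbers).

record OrderedRing : Set (lsuc 0ℓ) where
  infix 4 _≤_
  field
    commutativeRing : CommutativeRing 0ℓ 0ℓ
  open CommutativeRing commutativeRing public hiding (refl; sym; trans)
  field
    _≤_             : Rel Carrier 0ℓ
    isDecTotalOrder : IsDecTotalOrder _≈_ _≤_
    +-monoʳ-≤       : ∀ x {y z} → y ≤ z → x + y ≤ x + z
    *-nonNegative   : ∀ {x y} → 0# ≤ x → 0# ≤ y → 0# ≤ x * y
  open IsDecTotalOrder isDecTotalOrder public using (_≤?_)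

  sum : ∀ {n} → (Fin n → Carrier) → Carrier
  sum = MonoidSum.sum +-monoid

  -- the natural number k as an element of the ring, 1# + ⋯ + 1#
  fromNat : ℕ → Carrier
  fromNat k = RawMonoidDefs._×_ +-rawMonoid k 1#

-- The keys x₁ ≺ ⋯ ≺ xₙ are represented by their ranks k : Fin n (so k stands
-- for x₍ₖ₊₁₎), the external nodes z₀ … zₙ by Fin (suc n).  Key k lies between
-- the external nodes inject₁ k and suc k.  BST i j is the type of search trees
-- whose leftmost leaf is zᵢ and whose rightmost leaf is zⱼ, hence whose
-- internal nodes are exactly the keys between zᵢ and zⱼ in inorder (see
-- inorder-keys).

data BST {n : ℕ} : Fin (suc n) → Fin (suc n) → Set where
  leaf : ∀ {j} → BST j j
  node : ∀ {i j} (k : Fin n) → BST i (inject₁ k) → BST (suc k) j → BST i j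

FullBST : ℕ → Set
FullBST n = BST {n} zero (fromℕ n)

inorder : ∀ {n} {i j : Fin (suc n)} → BST i j → List (Fin n)
inorder leaf         = []
inorder (node k l r) = inorder l ++ k ∷ inorder r

upTo-inorder : ∀ {n} {i j : Fin (suc n)} (t : BST i j) →
               upTo (toℕ i) ++ map toℕ (inorder t) ≡ upTo (toℕ j)
upTo-inorder leaf = ++-identityʳ _
upTo-inorder {i = i} {j} (node k l r) = begin
  upTo (toℕ i) ++ map toℕ (inorder l ++ k ∷ inorder r)
    ≡⟨ cong (upTo (toℕ i) ++_) (map-++ toℕ (inorder l) _) ⟩
  upTo (toℕ i) ++ (map toℕ (inorder l) ++ toℕ k ∷ map toℕ (inorder r))
    ≡⟨ ++-assoc (upTo (toℕ i)) _ _ ⟨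
  (upTo (toℕ i) ++ map toℕ (inorder l)) ++ toℕ k ∷ map toℕ (inorder r)
    ≡⟨ cong (_++ toℕ k ∷ map toℕ (inorder r)) (trans (upTo-inorder l) (cong upTo (toℕ-inject₁ k))) ⟩
  upTo (toℕ k) ++ toℕ k ∷ map toℕ (inorder r)
    ≡⟨ ++-assoc (upTo (toℕ k)) [ toℕ k ] _ ⟨
  (upTo (toℕ k) ++ [ toℕ k ]) ++ map toℕ (inorder r)
    ≡⟨ cong (_++ map toℕ (inorder r)) (upTo-∷ʳ (toℕ k)) ⟩
  upTo (suc (toℕ k)) ++ map toℕ (inorder r)
    ≡⟨ upTo-inorder r ⟩
  upTo (toℕ j) ∎
  where open ≡-Reasoning

inorder-keys : ∀ {n} (t : FullBST n) → map toℕ (inorder t) ≡ upTo n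
inorder-keys {n} t = trans (upTo-inorder t) (cong upTo (toℕ-fromℕ n))

record Instance (R : OrderedRing) : Set where
  open OrderedRing R
  field
    n m₁ m₂ : ℕ
    1≤n     : 1 ℕ.≤ n
    m₁+m₂≡n : m₁ ℕ.+ m₂ ≡ n
    c₁ c₂   : ℕ
    c₁<c₂   : c₁ ℕ.< c₂
    p       : Fin n → Carrier
    q       : Fin (suc n) → Carrier
    p≥0     : ∀ i → 0# ≤ p i
    q≥0     : ∀ j → 0# ≤ q j
    total≈1 : sum p + sum q ≈ 1#

  m : ℕ
  m = m₁ ℕ.⊓ m₂

  -- a : Fin n stands for the address toℕ a + 1.
  μ : Fin n → ℕ
  μ a = if does (toℕ a ℕ.<? m₁) then c₁ else c₂

  record Solution : Set where
    field
      tree       : FullBST n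
      assignment : Fin n ↣ Fin n

    φ : Fin n → Fin n
    φ = Injection.to assignment

  w : ∀ {i j} → BST i j → Carrier
  w (leaf {j})   = q j
  w (node k l r) = w l + p k + w r

  -- Σ w(T_x) μ(φ(x)) over the internal nodes x of the tree
  internalCost : (Fin n → Fin n) → ∀ {i j} → BST i j → Carrier
  internalCost φ leaf           = 0#
  internalCost φ t@(node k l r) =
    internalCost φ l + w t * fromNat (μ (φ k)) + internalCost φ r

  -- Σ w(T_z) μ(φ(z)) over the external nodes z of the tree; the first argument
  -- is the access cost of the parent of the root.
  externalCost : ℕ → (Fin n → Fin n) → ∀ {i j} → BST i j → Carrier
  externalCost c φ t@leaf       = w t * fromNat c
  externalCost c φ (node k l r) =
    externalCost (μ (φ k)) φ l + externalCost (μ (φ k)) φ r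

  -- The 0 is never used: as n ≥ 1, the root of a full tree is a node.
  cost : Solution → Carrier
  cost S = internalCost φ tree + externalCost 0 φ tree
    where open Solution S

  Optimum : Solution → Set
  Optimum S = ∀ S′ → cost S ≤ cost S′

-- A uniform-cost random access machine.  It has index registers and index
-- memory holding natural numbers, and number registers and number memory
-- holding elements of the ring.  Programs are ring-independent syntax.  Both
-- memories are addressed indirectly, through index registers.

data Instr : Set where
  setI               : (d k : ℕ) → Instr
  addI subI mulI     : (d a b : ℕ) → Instr
  loadI              : (d a : ℕ) → Instr
  storeI             : (a b : ℕ) → Instr
  castR              : (d a : ℕ) → Instr
  addR subR mulR     : (d a b : ℕ) → Instr
  loadR              : (d a : ℕ) → Instr
  storeR             : (a b : ℕ) → Instr
  jump               : (target : ℕ) → Instr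
  jumpIf≤I jumpIf≤R  : (a b target : ℕ) → Instr

Program : Set
Program = List Instr

_[_↦_] : {A : Set} → (ℕ → A) → ℕ → A → (ℕ → A)
(f [ a ↦ x ]) b = if does (b ℕ.≟ a) then x else f b

module RAM (R : OrderedRing) where
  open OrderedRing R

  record State : Set where
    field
      pc   : ℕ
      ireg : ℕ → ℕ
      imem : ℕ → ℕ
      rreg : ℕ → Carrier
      rmem : ℕ → Carrier

  exec : Instr → State → State
  exec ins s = go ins
    where
    open State s
    next : State
    next = record s { pc = suc pc }
    goto : ℕ → State
    goto l = record s { pc = l }
    go : Instr → State
    go (setI d k)   = record next { ireg = ireg [ d ↦ k ] }
    go (addI d a b) = record next { ireg = ireg [ d ↦ ireg a ℕ.+ ireg b ] }
    go (subI d a b) = record next { ireg = ireg [ d ↦ ireg a ℕ.∸ ireg b ] }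
    go (mulI d a b) = record next { ireg = ireg [ d ↦ ireg a ℕ.* ireg b ] }
    go (loadI d a)  = record next { ireg = ireg [ d ↦ imem (ireg a) ] }
    go (storeI a b) = record next { imem = imem [ ireg a ↦ ireg b ] }
    go (castR d a)  = record next { rreg = rreg [ d ↦ fromNat (ireg a) ] }
    go (addR d a b) = record next { rreg = rreg [ d ↦ rreg a + rreg b ] }
    go (subR d a b) = record next { rreg = rreg [ d ↦ rreg a - rreg b ] }
    go (mulR d a b) = record next { rreg = rreg [ d ↦ rreg a * rreg b ] }
    go (loadR d a)  = record next { rreg = rreg [ d ↦ rmem (ireg a) ] }
    go (storeR a b) = record next { rmem = rmem [ ireg a ↦ rreg b ] }
    go (jump l)     = goto l
    go (jumpIf≤I a b l) = if does (ireg a ℕ.≤? ireg b) then goto l else next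
    go (jumpIf≤R a b l) = if does (rreg a ≤? rreg b) then goto l else next

  -- nothing when the program counter is past the end of the program: the
  -- machine has halted.
  step : Program → State → Maybe State
  step P s = Maybe.map (λ ins → exec ins s) (head (drop (State.pc s) P))

  infix 4 _⊢_⇓[_]_

  -- P ⊢ s ⇓[ t ] s′: started in s, the machine halts in s′ after t instructions.
  data _⊢_⇓[_]_ (P : Program) : State → ℕ → State → Set where
    halted : ∀ {s} → step P s ≡ nothing → P ⊢ s ⇓[ 0 ] s
    run    : ∀ {s s′ s″ t} → step P s ≡ just s′ →
             P ⊢ s′ ⇓[ t ] s″ → P ⊢ s ⇓[ suc t ] s″

  -- The input convention: m₁, m₂, c₁, c₂ in index registers 0 … 3 and
  -- q₀, p₁, q₁, …, pₙ, qₙ in number memory from address 0 on.  All other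
  -- registers and memory cells may hold garbage.
  record Loaded (I : Instance R) (s : State) : Set where
    open Instance I
    open State s
    field
      pc≡0 : pc ≡ 0
      m₁-in : ireg 0 ≡ m₁
      m₂-in : ireg 1 ≡ m₂
      c₁-in : ireg 2 ≡ c₁
      c₂-in : ireg 3 ≡ c₂
      q-in : ∀ j → rmem (2 ℕ.* toℕ j) ≡ q j
      p-in : ∀ k → rmem (suc (2 ℕ.* toℕ k)) ≡ p k

  -- The output convention, in index memory: a pointer to the node of key xᵢ is
  -- the number i ≥ 1, and 0 is a pointer to an external node.  Cell 0 points to
  -- the root; cells 3i-2, 3i-1, 3i hold the pointers from xᵢ to its left and
  -- right child, and the address φ(xᵢ) ∈ {1, …, n}.
  PointsTo : (ℕ → ℕ) → ℕ → ∀ {n} {i j : Fin (suc n)} → BST i j → Set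
  PointsTo mem v leaf         = v ≡ 0
  PointsTo mem v (node k l r) =
    v ≡ suc (toℕ k) ×
    PointsTo mem (mem (1 ℕ.+ 3 ℕ.* toℕ k)) l ×
    PointsTo mem (mem (2 ℕ.+ 3 ℕ.* toℕ k)) r

  record Outputs (I : Instance R) (s : State) (S : Instance.Solution I) : Set where
    open Instance.Solution S
    open State s
    field
      tree-out : PointsTo imem (imem 0) tree
      φ-out    : ∀ k → imem (3 ℕ.+ 3 ℕ.* toℕ k) ≡ suc (toℕ (φ k))

  -- Started in s, the program P halts after t instructions and outputs an
  -- optimum solution of I.
  ConstructsOptimum : Program → (I : Instance R) → State → ℕ → Set
  ConstructsOptimum P I s t =
    Σ State λ s′ → Σ (Instance.Solution I) λ S →
      (P ⊢ s ⇓[ t ] s′) × Outputs I s′ S × Instance.Optimum I S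

{-# OPTIONS --safe #-}
module Submission where

-- Colour the keys by the memory level that stores them.  What matters about an
-- assignment is the set of keys in the smaller level, so the best coloured
-- tree on the leaves zᵢ … zⱼ with exactly k keys in that level is found by
-- dynamic programming over (i, j, k): try every root, its colour, and every way
-- to share the remaining count between the subtrees.  This costs O(n³m²),
-- which is O(m n² (n - m)²) because n ≤ 2 (n - m).
--
-- For m = 0 only O(n²) is allowed.  There the quadrangle inequality confines
-- the root of (i, j) to the interval between the roots of (i, j - 1) and
-- (i + 1, j); the search ranges then telescope along the diagonals.  The
-- inequality comes from exchanging subtrees between two trees.  As the ranges
-- are nested by construction, ties need no special treatment.

open import Defs
open import Algebra.Properties.Group using (⁻¹-involutive)
open import Algebra.Properties.Ring using (-1*x≈-x)
import Algebra.Solver.CommutativeMonoid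
open import Data.Bool.Base using (Bool; true; false; T; not; _∧_; if_then_else_)
open import Data.Bool.ListAction using (all)
open import Data.Bool.Properties using (not-involutive)
open import Data.Empty using (⊥; ⊥-elim)
open import Data.Fin.Base using (Fin; toℕ; fromℕ<; fromℕ; inject₁) renaming (suc to fsuc)
open import Data.Fin.Properties using (toℕ-injective; toℕ-inject₁; toℕ-fromℕ<; toℕ-fromℕ; toℕ<n; fromℕ<-toℕ)
open import Data.List.Base using (List; []; _∷_; _++_; map; length; head; drop)
open import Data.List.Properties using (++-assoc; ++-identityʳ; length-++; length-map; drop-drop)
open import Data.Maybe.Base as Maybe using (just; nothing)
open import Data.Nat.Base
  using (ℕ; zero; suc; _+_; _*_; _∸_; _^_; _⊓_; _≤_; _<_; z≤n; s≤s; _≡ᵇ_; _≤′_; ≤′-reflexive; ≤′-step; NonZero; >-nonZero)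
open import Data.Nat.Properties
open import Data.Nat.Solver using (module +-*-Solver)
open import Data.Product.Base using (Σ; _×_; _,_; proj₁; proj₂)
open import Data.Sum.Base using (_⊎_; inj₁; inj₂)
open import Data.Unit.Base using (⊤; tt)
open import Function.Base using (_∘_)
open import Function.Bundles using (mk↣; module Injection)
open import Relation.Binary.Bundles using (Poset)
open import Relation.Binary.Definitions using (tri<; tri≈; tri>)
open import Relation.Binary.PropositionalEquality
  using (_≡_; _≢_; refl; sym; trans; cong; cong₂; subst; subst₂; module ≡-Reasoning)
import Relation.Binary.Reasoning.PartialOrder
open import Relation.Binary.Structures using (module IsDecTotalOrder)
open import Relation.Nullary using (¬_; Dec; yes; no; does)
open import Relation.Nullary.Decidable using (dec-true; dec-false)

-- Structured programs and their compilation

-- There are exactly `m₁ + m₂` keys and addresses, so every one-to-one assignment puts exactly `m`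
-- keys into the smaller level. This is why an entry fixes its count instead of bounding it, and why
-- the best tree with `m` marked nodes is an optimum over all solutions. A leaf is charged at the
-- cost of its parent, so only nonempty intervals are tabulated, and a leaf is priced when its
-- parent is tried. The memories start with garbage and the ring has no infinity. Hence infeasible
-- counts are rejected by arithmetic on interval lengths, and a flag tells whether a candidate has
-- been found. The table is filled row by row with `i` decreasing, whereas the search ranges
-- telescope between neighbouring rows. The time invariant therefore carries the sum of the stored
-- roots of a row as a potential. The program is written in a structured language with an exact cost
-- semantics and compiled to jumps. Inputs, table and output occupy disjoint cells, so each phase
-- leaves intact what the later ones read.

data Op : Set where
  setI           : (d k : ℕ) → Op
  addI subI mulI : (d a b : ℕ) → Op
  loadI          : (d a : ℕ) → Op
  storeI         : (a b : ℕ) → Op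
  castR          : (d a : ℕ) → Op
  addR mulR      : (d a b : ℕ) → Op
  loadR          : (d a : ℕ) → Op
  storeR         : (a b : ℕ) → Op

instr : Op → Instr
instr (setI d k)   = setI d k
instr (addI d a b) = addI d a b
instr (subI d a b) = subI d a b
instr (mulI d a b) = mulI d a b
instr (loadI d a)  = loadI d a
instr (storeI a b) = storeI a b
instr (castR d a)  = castR d a
instr (addR d a b) = addR d a b
instr (mulR d a b) = mulR d a b
instr (loadR d a)  = loadR d a
instr (storeR a b) = storeR a b

data Test : Set where
  _≤ᴵ_ _≤ᴿ_ : (a b : ℕ) → Test

jumpIf : Test → ℕ → Instr
jumpIf (a ≤ᴵ b) = jumpIf≤I a b
jumpIf (a ≤ᴿ b) = jumpIf≤R a b

infixr 5 _︔_

data Cmd : Set where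
  ops   : List Op → Cmd
  _︔_   : Cmd → Cmd → Cmd
  when  : Test → Cmd → Cmd → Cmd
  while : Test → Cmd → Cmd

size : Cmd → ℕ
size (ops os)        = length os
size (c ︔ d)         = size c + size d
size (when b c d)    = 2 + size d + size c
size (while b c)     = 3 + size c

-- Jumps are absolute, so the code depends on the address `o` at which it is placed. The failure
-- branch of a conditional comes first: success costs only the test, failure also the jump over the
-- other branch. This is the origin of the 1 and the 2 in `holds` and `fails`.
compile : ℕ → Cmd → Program
compile o (ops os)        = map instr os
compile o (c ︔ d)         = compile o c ++ compile (o + size c) d
compile o (when b c d)    =
  jumpIf b (o + (2 + size d)) ∷ compile (suc o) d ++
  jump (o + (2 + size d + size c)) ∷ compile (o + (2 + size d)) c
compile o (while b c)     =
  jumpIf b (2 + o) ∷ jump (o + (3 + size c)) ∷ compile (2 + o) c ++ jump o ∷ []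

length-compile : ∀ o c → length (compile o c) ≡ size c
length-compile o (ops os) = length-map instr os
length-compile o (c ︔ d) = trans (length-++ (compile o c))
  (cong₂ _+_ (length-compile o c) (length-compile _ d))
length-compile o (when b c d) = cong suc (trans (length-++ (compile _ d))
  (trans (cong₂ _+_ (length-compile _ d) (cong suc (length-compile _ c))) (+-suc _ _)))
length-compile o (while b c) = cong (2 +_) (trans (length-++ (compile _ c))
  (trans (cong (_+ 1) (length-compile _ c)) (+-comm _ 1)))

record Sits (P : Program) (o : ℕ) (code : Program) : Set where
  constructor _,_
  field
    rest  : Program
    split : drop o P ≡ code ++ rest

sits-++ˡ : ∀ {P o} xs {ys} → Sits P o (xs ++ ys) → Sits P o xs
sits-++ˡ xs {ys} (rest , eq) = ys ++ rest , trans eq (++-assoc xs ys rest)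

drop-++-exact : ∀ {A : Set} (xs {ys} : List A) → drop (length xs) (xs ++ ys) ≡ ys
drop-++-exact []       = refl
drop-++-exact (x ∷ xs) = drop-++-exact xs

sits-++ʳ : ∀ {P o} xs {ys} → Sits P o (xs ++ ys) → Sits P (o + length xs) ys
sits-++ʳ {P} {o} xs {ys} (rest , eq) = rest ,
  trans (sym (drop-drop o (length xs) P))
  (trans (cong (drop (length xs)) (trans eq (++-assoc xs ys rest))) (drop-++-exact xs))

sits-tail : ∀ {P o x ys} → Sits P o (x ∷ ys) → Sits P (suc o) ys
sits-tail {P} {o} {x} {ys} S = subst (λ o → Sits P o ys) (+-comm o 1) (sits-++ʳ (x ∷ []) S)

sits-head : ∀ {P o x ys} → Sits P o (x ∷ ys) → head (drop o P) ≡ just x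
sits-head (rest , eq) = cong head eq

-- What a command leaves alone is decided on its syntax. For concrete programs these Booleans
-- evaluate to `true`, so the frame lemmas take them as implicit arguments of type `T …` that are
-- solved by computation.
keepsIReg keepsRReg : Op → ℕ → Bool
keepsIReg (setI d _)   r = not (r ≡ᵇ d)
keepsIReg (addI d _ _) r = not (r ≡ᵇ d)
keepsIReg (subI d _ _) r = not (r ≡ᵇ d)
keepsIReg (mulI d _ _) r = not (r ≡ᵇ d)
keepsIReg (loadI d _)  r = not (r ≡ᵇ d)
keepsIReg _            r = true
keepsRReg (castR d _)  r = not (r ≡ᵇ d)
keepsRReg (addR d _ _) r = not (r ≡ᵇ d)
keepsRReg (mulR d _ _) r = not (r ≡ᵇ d)
keepsRReg (loadR d _)  r = not (r ≡ᵇ d)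
keepsRReg _            r = true

keepsIMem keepsRMem : Op → Bool
keepsIMem (storeI _ _) = false
keepsIMem _            = true
keepsRMem (storeR _ _) = false
keepsRMem _            = true

everywhere : (Op → Bool) → Cmd → Bool
everywhere f (ops os)     = all f os
everywhere f (c ︔ d)      = everywhere f c ∧ everywhere f d
everywhere f (when b c d) = everywhere f c ∧ everywhere f d
everywhere f (while b c)  = everywhere f c

T-∧ˡ : ∀ {x y} → T (x ∧ y) → T x
T-∧ˡ {true} _ = tt

T-∧ʳ : ∀ {x y} → T (x ∧ y) → T y
T-∧ʳ {true} t = t

loopFree : Cmd → Bool
loopFree (ops os)     = true
loopFree (c ︔ d)      = loopFree c ∧ loopFree d
loopFree (when b c d) = loopFree c ∧ loopFree d
loopFree (while b c)  = false

-- Meaningful for loop-free programs only: a loop counts for nothing.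
worst : Cmd → ℕ
worst (ops os)     = length os
worst (c ︔ d)      = worst c + worst d
worst (when b c d) = 2 + (worst c + worst d)
worst (while b c)  = 0

-- Timed semantics, frame conditions and rules for loops

module Semantics (R : OrderedRing) where
  open OrderedRing R using (Carrier; fromNat)
    renaming (_+_ to _+R_; _*_ to _*R_; _≤_ to _≤R_; _≤?_ to _≤R?_)
  open RAM R using (State; step; exec; _⊢_⇓[_]_; halted; run)

  record Store : Set where
    field
      ireg : ℕ → ℕ
      imem : ℕ → ℕ
      rreg : ℕ → Carrier
      rmem : ℕ → Carrier
  open Store

  _at_ : Store → ℕ → State
  σ at o = record { pc = o ; ireg = ireg σ ; imem = imem σ ; rreg = rreg σ ; rmem = rmem σ }

  execOp : Op → Store → Store
  execOp (setI d k) σ   = record σ { ireg = ireg σ [ d ↦ k ] }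
  execOp (addI d a b) σ = record σ { ireg = ireg σ [ d ↦ ireg σ a + ireg σ b ] }
  execOp (subI d a b) σ = record σ { ireg = ireg σ [ d ↦ ireg σ a ∸ ireg σ b ] }
  execOp (mulI d a b) σ = record σ { ireg = ireg σ [ d ↦ ireg σ a * ireg σ b ] }
  execOp (loadI d a) σ  = record σ { ireg = ireg σ [ d ↦ imem σ (ireg σ a) ] }
  execOp (storeI a b) σ = record σ { imem = imem σ [ ireg σ a ↦ ireg σ b ] }
  execOp (castR d a) σ  = record σ { rreg = rreg σ [ d ↦ fromNat (ireg σ a) ] }
  execOp (addR d a b) σ = record σ { rreg = rreg σ [ d ↦ rreg σ a +R rreg σ b ] }
  execOp (mulR d a b) σ = record σ { rreg = rreg σ [ d ↦ rreg σ a *R rreg σ b ] }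
  execOp (loadR d a) σ  = record σ { rreg = rreg σ [ d ↦ rmem σ (ireg σ a) ] }
  execOp (storeR a b) σ = record σ { rmem = rmem σ [ ireg σ a ↦ rreg σ b ] }

  execOps : List Op → Store → Store
  execOps []       σ = σ
  execOps (o ∷ os) σ = execOps os (execOp o σ)

  Holds : Test → Store → Set
  Holds (a ≤ᴵ b) σ = ireg σ a ≤ ireg σ b
  Holds (a ≤ᴿ b) σ = rreg σ a ≤R rreg σ b

  holds? : ∀ b σ → Dec (Holds b σ)
  holds? (a ≤ᴵ b) σ = ireg σ a ≤? ireg σ b
  holds? (a ≤ᴿ b) σ = rreg σ a ≤R? rreg σ b

  infixr 5 _︔_

  data Exec : Cmd → Store → ℕ → Store → Set where
    ops   : ∀ {os σ} → Exec (ops os) σ (length os) (execOps os σ)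
    _︔_   : ∀ {c d σ t σ′ u σ″} → Exec c σ t σ′ → Exec d σ′ u σ″ → Exec (c ︔ d) σ (t + u) σ″
    holds : ∀ {b c d σ t σ′} → Holds b σ → Exec c σ t σ′ → Exec (when b c d) σ (1 + t) σ′
    fails : ∀ {b c d σ t σ′} → ¬ Holds b σ → Exec d σ t σ′ → Exec (when b c d) σ (2 + t) σ′
    done  : ∀ {b c σ} → ¬ Holds b σ → Exec (while b c) σ 2 σ
    again : ∀ {b c σ t σ′ u σ″} → Holds b σ → Exec c σ t σ′ →
            Exec (while b c) σ′ u σ″ → Exec (while b c) σ (2 + t + u) σ″

  -- `⇓` describes complete runs only. A partial run is therefore represented by its effect on every
  -- complete continuation, and sequencing becomes composition of functions.
  Reach : Program → State → ℕ → State → Set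
  Reach P s t s′ = ∀ {u s″} → P ⊢ s′ ⇓[ u ] s″ → P ⊢ s ⇓[ t + u ] s″

  reach-trans : ∀ {P s t s′ u s″} → Reach P s t s′ → Reach P s′ u s″ → Reach P s (t + u) s″
  reach-trans {P} {s} {t} {u = u} f g {v} {s‴} h = subst (λ t → P ⊢ s ⇓[ t ] s‴) (sym (+-assoc t u v)) (f (g h))

  reach-cast : ∀ {P s t t′ s′} → t ≡ t′ → Reach P s t s′ → Reach P s t′ s′
  reach-cast refl f = f

  reach-pc : ∀ {P s t σ o o′} → o ≡ o′ → Reach P s t (σ at o) → Reach P s t (σ at o′)
  reach-pc refl f = f

  reach-step : ∀ {P σ o ins ys s′} → Sits P o (ins ∷ ys) → exec ins (σ at o) ≡ s′ → Reach P (σ at o) 1 s′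
  reach-step {σ = σ} {o} {ins} S eq h =
    run (trans (cong (Maybe.map (λ ins → exec ins (σ at o))) (sits-head S)) (cong just eq)) h

  exec-instr : ∀ op σ o → exec (instr op) (σ at o) ≡ execOp op σ at suc o
  exec-instr (setI d k) σ o   = refl
  exec-instr (addI d a b) σ o = refl
  exec-instr (subI d a b) σ o = refl
  exec-instr (mulI d a b) σ o = refl
  exec-instr (loadI d a) σ o  = refl
  exec-instr (storeI a b) σ o = refl
  exec-instr (castR d a) σ o  = refl
  exec-instr (addR d a b) σ o = refl
  exec-instr (mulR d a b) σ o = refl
  exec-instr (loadR d a) σ o  = refl
  exec-instr (storeR a b) σ o = refl

  exec-jumpIf : ∀ b l σ o → exec (jumpIf b l) (σ at o) ≡ (if does (holds? b σ) then σ at l else (σ at suc o))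
  exec-jumpIf (a ≤ᴵ b) l σ o = refl
  exec-jumpIf (a ≤ᴿ b) l σ o = refl

  exec-yes : ∀ {b l σ o} → Holds b σ → exec (jumpIf b l) (σ at o) ≡ σ at l
  exec-yes {b} {l} {σ} {o} p = trans (exec-jumpIf b l σ o)
    (cong (λ x → if x then σ at l else (σ at suc o)) (dec-true (holds? b σ) p))

  exec-no : ∀ {b l σ o} → ¬ Holds b σ → exec (jumpIf b l) (σ at o) ≡ σ at suc o
  exec-no {b} {l} {σ} {o} p = trans (exec-jumpIf b l σ o)
    (cong (λ x → if x then σ at l else (σ at suc o)) (dec-false (holds? b σ) p))

  reach-ops : ∀ {P} os {σ o} → Sits P o (map instr os) →
              Reach P (σ at o) (length os) (execOps os σ at (o + length os))
  reach-ops [] {σ} {o} S = reach-pc {t = 0} {σ} (sym (+-identityʳ o)) (λ h → h)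
  reach-ops (op ∷ os) {σ} {o} S =
    reach-trans (reach-step S (exec-instr op σ o))
      (reach-pc {t = length os} {execOps (op ∷ os) σ} (sym (+-suc o (length os))) (reach-ops os (sits-tail S)))

  sits-then : ∀ {P x y} o d {zs} → Sits P o (x ∷ compile (suc o) d ++ y ∷ zs) → Sits P (o + (2 + size d)) zs
  sits-then {P} o d {zs} S = subst (λ o → Sits P o zs)
    (trans (cong (λ l → suc (suc o + l)) (length-compile (suc o) d))
           (trans (cong suc (sym (+-suc o (size d)))) (sym (+-suc o (suc (size d))))))
    (sits-tail (sits-++ʳ (compile (suc o) d) (sits-tail S)))

  reach : ∀ {P c σ t σ′} → Exec c σ t σ′ → ∀ o → Sits P o (compile o c) →
          Reach P (σ at o) t (σ′ at (o + size c))

  reach {P} {c} {σ} (ops {os}) o S = reach-ops os S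
  reach {P} {c ︔ d} (_︔_ {u = u} {σ″} e f) o S = reach-trans
    (reach e o (sits-++ˡ (compile o c) S))
    (reach-pc {t = u} {σ″} (+-assoc o (size c) (size d))
      (reach f (o + size c) (subst (λ l → Sits P (o + l) (compile (o + size c) d))
        (length-compile o c) (sits-++ʳ (compile o c) S))))
  reach (holds {b} {c} {d} {σ} {t} {σ′} p e) o S = reach-trans (reach-step S (exec-yes {b} {σ = σ} p))
    (reach-pc {t = t} {σ′} (+-assoc o (2 + size d) (size c)) (reach e _ (sits-then o d S)))
  reach (fails {b} {c} {d} {σ} {t} {σ′} p e) o S = reach-cast (cong suc (+-comm t 1))
    (reach-trans (reach-step S (exec-no {b} {o + (2 + size d)} {σ} p)) (reach-trans
      (reach-pc {t = t} {σ′} (cong (suc o +_) (sym (length-compile (suc o) d)))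
        (reach e (suc o) (sits-++ˡ (compile (suc o) d) (sits-tail S))))
      (reach-step (sits-++ʳ (compile (suc o) d) (sits-tail S)) refl)))
  reach (done {b} {c} {σ} p) o S =
    reach-trans (reach-step S (exec-no {b} {2 + o} {σ} p)) (reach-step (sits-tail S) refl)
  reach (again {b} {c} {σ} {t} {σ′} {u} p e f) o S = reach-cast eq
    (reach-trans (reach-trans
      (reach-step S (exec-yes {b} {σ = σ} p))
      (reach-trans (reach e (2 + o) (sits-++ˡ (compile (2 + o) c) (sits-tail (sits-tail S))))
        (reach-step (subst (λ l → Sits _ (2 + o + l) (jump o ∷ [])) (length-compile (2 + o) c)
          (sits-++ʳ (compile (2 + o) c) (sits-tail (sits-tail S)))) refl)))
      (reach f o S))
    where
    eq : 1 + (t + 1) + u ≡ 2 + t + u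
    eq = cong (_+ u) (cong suc (+-comm t 1))

  halts : ∀ {c σ t σ′} → Exec c σ t σ′ → compile 0 c ⊢ (σ at 0) ⇓[ t ] (σ′ at size c)
  halts {c} {σ} {t} {σ′} e = subst (λ t → compile 0 c ⊢ (σ at 0) ⇓[ t ] (σ′ at size c)) (+-identityʳ t)
    (reach e 0 ([] , sym (++-identityʳ _)) (halted (cong (Maybe.map (λ ins → exec ins (σ′ at size c))) at-end)))
    where
    at-end : head (drop (size c) (compile 0 c)) ≡ nothing
    at-end = trans (cong (λ l → head (drop l (compile 0 c))) (sym (length-compile 0 c)))
      (cong head (trans (cong (drop (length (compile 0 c))) (sym (++-identityʳ (compile 0 c))))
        (drop-++-exact (compile 0 c))))

  execOps-preserves : ∀ {A : Set} (f : Op → Bool) (obs : Store → A) →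
    (∀ op σ → T (f op) → obs (execOp op σ) ≡ obs σ) →
    ∀ os σ → T (all f os) → obs (execOps os σ) ≡ obs σ
  execOps-preserves f obs h []        σ ok = refl
  execOps-preserves f obs h (op ∷ os) σ ok =
    trans (execOps-preserves f obs h os _ (T-∧ʳ {f op} ok)) (h op σ (T-∧ˡ ok))

  preserves : ∀ {A : Set} (f : Op → Bool) (obs : Store → A) →
    (∀ op σ → T (f op) → obs (execOp op σ) ≡ obs σ) →
    ∀ {c σ t σ′} → Exec c σ t σ′ → T (everywhere f c) → obs σ′ ≡ obs σ
  preserves f obs h (ops {os} {σ}) ok = execOps-preserves f obs h os σ ok
  preserves f obs h (_︔_ {c} e e′) ok =
    trans (preserves f obs h e′ (T-∧ʳ {everywhere f c} ok)) (preserves f obs h e (T-∧ˡ ok))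
  preserves f obs h (holds _ e) ok = preserves f obs h e (T-∧ˡ ok)
  preserves f obs h (fails {c = c} _ e) ok = preserves f obs h e (T-∧ʳ {everywhere f c} ok)
  preserves f obs h (done _) ok = refl
  preserves f obs h (again _ e e′) ok = trans (preserves f obs h e′ ok) (preserves f obs h e ok)

  update-other : ∀ {A : Set} (f : ℕ → A) d x r → T (not (r ≡ᵇ d)) → (f [ d ↦ x ]) r ≡ f r
  update-other f d x r ok with r ≡ᵇ d
  ... | false = refl

  op-preserves : ∀ op σ → let σ′ = execOp op σ in
    (∀ r → T (keepsIReg op r) → ireg σ′ r ≡ ireg σ r) × (∀ r → T (keepsRReg op r) → rreg σ′ r ≡ rreg σ r) ×
    (T (keepsIMem op) → imem σ′ ≡ imem σ) × (T (keepsRMem op) → rmem σ′ ≡ rmem σ)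
  op-preserves (setI d k) σ = update-other (ireg σ) d _ , (λ _ _ → refl) , (λ _ → refl) , λ _ → refl
  op-preserves (addI d a b) σ = update-other (ireg σ) d _ , (λ _ _ → refl) , (λ _ → refl) , λ _ → refl
  op-preserves (subI d a b) σ = update-other (ireg σ) d _ , (λ _ _ → refl) , (λ _ → refl) , λ _ → refl
  op-preserves (mulI d a b) σ = update-other (ireg σ) d _ , (λ _ _ → refl) , (λ _ → refl) , λ _ → refl
  op-preserves (loadI d a) σ = update-other (ireg σ) d _ , (λ _ _ → refl) , (λ _ → refl) , λ _ → refl
  op-preserves (storeI a b) σ = (λ _ _ → refl) , (λ _ _ → refl) , (λ ()) , λ _ → refl
  op-preserves (castR d a) σ = (λ _ _ → refl) , update-other (rreg σ) d _ , (λ _ → refl) , λ _ → refl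
  op-preserves (addR d a b) σ = (λ _ _ → refl) , update-other (rreg σ) d _ , (λ _ → refl) , λ _ → refl
  op-preserves (mulR d a b) σ = (λ _ _ → refl) , update-other (rreg σ) d _ , (λ _ → refl) , λ _ → refl
  op-preserves (loadR d a) σ = (λ _ _ → refl) , update-other (rreg σ) d _ , (λ _ → refl) , λ _ → refl
  op-preserves (storeR a b) σ = (λ _ _ → refl) , (λ _ _ → refl) , (λ _ → refl) , λ ()

  keepI : ∀ {c σ t σ′} → Exec c σ t σ′ → ∀ r {_ : T (everywhere (λ op → keepsIReg op r) c)} → ireg σ′ r ≡ ireg σ r
  keepI e r {ok} = preserves _ (λ σ → ireg σ r) (λ op σ → proj₁ (op-preserves op σ) r) e ok

  keepR : ∀ {c σ t σ′} → Exec c σ t σ′ → ∀ r {_ : T (everywhere (λ op → keepsRReg op r) c)} → rreg σ′ r ≡ rreg σ r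
  keepR e r {ok} = preserves _ (λ σ → rreg σ r) (λ op σ → proj₁ (proj₂ (op-preserves op σ)) r) e ok

  keepIM : ∀ {c σ t σ′} → Exec c σ t σ′ → {_ : T (everywhere keepsIMem c)} → imem σ′ ≡ imem σ
  keepIM e {ok} = preserves _ imem (λ op σ → proj₁ (proj₂ (proj₂ (op-preserves op σ)))) e ok

  keepRM : ∀ {c σ t σ′} → Exec c σ t σ′ → {_ : T (everywhere keepsRMem c)} → rmem σ′ ≡ rmem σ
  keepRM e {ok} = preserves _ rmem (λ op σ → proj₂ (proj₂ (proj₂ (op-preserves op σ)))) e ok

  time : ∀ {c σ t σ′} → Exec c σ t σ′ → {_ : T (loopFree c)} → t ≤ worst c
  time ops = ≤-refl
  time (_︔_ {c} e f) {ok} = +-mono-≤ (time e {T-∧ˡ ok}) (time f {T-∧ʳ {loopFree c} ok})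
  time (holds p e) {ok} = s≤s (m≤n⇒m≤1+n (≤-trans (time e {T-∧ˡ ok}) (m≤m+n _ _)))
  time (fails {c = c} p e) {ok} = s≤s (s≤s (≤-trans (time e {T-∧ʳ {loopFree c} ok}) (m≤n+m _ (worst c))))

  -- Total correctness in the style of a weakest precondition. The postcondition sees the time,
  -- because bounds on it are part of what is proved.
  Run : Cmd → Store → (ℕ → Store → Set) → Set
  Run c σ Q = Σ Store λ σ′ → Σ ℕ λ t → Exec c σ t σ′ × Q t σ′

  -- The continuation receives the derivation for `c` as well as its postcondition. Frame lemmas can
  -- then be applied to it, and postconditions need only mention what changes.
  run-seq : ∀ {c d σ Q Q′} → Run c σ Q →
            (∀ {σ′ t} → Exec c σ t σ′ → Q t σ′ → Run d σ′ (λ u → Q′ (t + u))) → Run (c ︔ d) σ Q′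
  run-seq (σ′ , t , e , q) f with f e q
  ... | σ″ , u , e′ , q′ = σ″ , t + u , e ︔ e′ , q′

  run-ops : ∀ {os d σ Q} → Run d (execOps os σ) (λ u → Q (length os + u)) → Run (ops os ︔ d) σ Q
  run-ops (σ″ , u , e′ , q′) = σ″ , _ , ops ︔ e′ , q′

  run-map : ∀ {c σ Q Q′} → Run c σ Q → (∀ {σ′ t} → Exec c σ t σ′ → Q t σ′ → Q′ t σ′) → Run c σ Q′
  run-map (σ′ , t , e , q) f = σ′ , t , e , f e q

  run-if : ∀ {b c d σ Q} → (Holds b σ → Run c σ (λ t → Q (1 + t))) →
           (¬ Holds b σ → Run d σ (λ t → Q (2 + t))) → Run (when b c d) σ Q
  run-if {b} {σ = σ} f g with holds? b σ
  ... | yes p = let σ′ , t , e , q = f p in σ′ , _ , holds p e , q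
  ... | no p  = let σ′ , t , e , q = g p in σ′ , _ , fails p e , q

  run-skip : ∀ {os σ Q} → Q (length os) (execOps os σ) → Run (ops os) σ Q
  run-skip q = _ , _ , ops , q

  -- The second argument of Inv is the time spent so far, so that invariants can
  -- express amortised bounds.
  run-count : ∀ {a b c} (Inv : ℕ → ℕ → Store → Set) {h} →
    (∀ {x t σ} → Inv x t σ → ireg σ a ≡ x × ireg σ b ≡ h) →
    (∀ {x t σ} → x ≤ h → Inv x t σ → Run c σ (λ u σ′ → Inv (suc x) (t + (2 + u)) σ′)) →
    ∀ f {x t σ} → x + f ≡ suc h → Inv x t σ →
    Run (while (a ≤ᴵ b) c) σ (λ u σ′ → Σ ℕ λ v → u ≡ v + 2 × Inv (suc h) (t + v) σ′)
  run-count {a} {b} Inv regs body zero {x} {t} {σ} x+0≡h inv =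
    σ , 2 , done (λ a≤b → <⇒≱ (≤-reflexive (trans (sym x+0≡h) (+-identityʳ x)))
                             (subst₂ _≤_ (proj₁ (regs inv)) (proj₂ (regs inv)) a≤b)) ,
    0 , refl , subst₂ (λ x t → Inv x t σ) (trans (sym (+-identityʳ x)) x+0≡h) (sym (+-identityʳ t)) inv
  run-count {a} {b} Inv {h} regs body (suc f) {x} {t} {σ} x+f≡h inv
    with body x≤h inv
    where
    x≤h : x ≤ h
    x≤h = ≤-pred (≤-trans (≤-trans (s≤s (m≤m+n x f)) (≤-reflexive (sym (+-suc x f)))) (≤-reflexive x+f≡h))
  ... | σ₁ , u , e , inv₁ with run-count Inv regs body f (trans (sym (+-suc x f)) x+f≡h) inv₁
  ...   | σ₂ , u′ , e₂ , v , u′≡v+2 , inv₂ =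
    σ₂ , 2 + u + u′ , again a≤b e e₂ , 2 + u + v ,
    trans (cong (2 + u +_) u′≡v+2) (sym (+-assoc (2 + u) v 2)) ,
    subst (λ t → Inv (suc h) t σ₂) (+-assoc t (2 + u) v) inv₂
    where
    a≤b : ireg σ a ≤ ireg σ b
    a≤b = subst₂ _≤_ (sym (proj₁ (regs inv))) (sym (proj₂ (regs inv)))
      (≤-pred (≤-trans (≤-trans (s≤s (m≤m+n x f)) (≤-reflexive (sym (+-suc x f)))) (≤-reflexive x+f≡h)))

  -- The amortised rule with `t ≤ (x ∸ x₀) * (2 + B)` added to the invariant; the final 2 pays for
  -- the failing test and the exit jump.
  run-for : ∀ {a b c} (Inv : ℕ → Store → Set) {h} B →
    (∀ {x σ} → Inv x σ → ireg σ a ≡ x × ireg σ b ≡ h) →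
    (∀ {x σ} → x ≤ h → Inv x σ → Run c σ (λ u σ′ → u ≤ B × Inv (suc x) σ′)) →
    ∀ f {x σ} → x + f ≡ suc h → Inv x σ →
    Run (while (a ≤ᴵ b) c) σ (λ u σ′ → u ≤ f * (2 + B) + 2 × Inv (suc h) σ′)
  run-for {c = c} Inv {h} B regs body f {x₀} x₀+f≡ inv₀
    with run-count (λ x t σ → Inv x σ × x₀ ≤ x × t ≤ (x ∸ x₀) * (2 + B)) (λ (i , _) → regs i) body′ f x₀+f≡
           (inv₀ , ≤-refl , z≤n)
    where
    body′ : ∀ {x t σ} → x ≤ h → Inv x σ × x₀ ≤ x × t ≤ (x ∸ x₀) * (2 + B) →
            Run c σ (λ u σ′ → Inv (suc x) σ′ × x₀ ≤ suc x × t + (2 + u) ≤ (suc x ∸ x₀) * (2 + B))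
    body′ {x} {t} x≤h (inv , x₀≤x , t≤) with body x≤h inv
    ... | σ₁ , u , e , u≤B , inv₁ = σ₁ , u , e , inv₁ , m≤n⇒m≤1+n x₀≤x , (begin
      t + (2 + u)                       ≤⟨ +-mono-≤ t≤ (+-monoʳ-≤ 2 u≤B) ⟩
      (x ∸ x₀) * (2 + B) + (2 + B)      ≡⟨ +-comm ((x ∸ x₀) * (2 + B)) _ ⟩
      suc (x ∸ x₀) * (2 + B)            ≡⟨ cong (_* (2 + B)) (+-∸-assoc 1 x₀≤x) ⟨
      (suc x ∸ x₀) * (2 + B)            ∎)
      where
      open ≤-Reasoning
  ... | σ₁ , u , e , v , u≡ , inv₁ , _ , v≤ = σ₁ , u , e ,
    ≤-trans (≤-reflexive u≡) (+-monoˡ-≤ 2 (≤-trans v≤ (≤-reflexive (cong (_* (2 + B)) (trans (cong (_∸ x₀) (sym x₀+f≡)) (m+n∸m≡n x₀ f)))))) ,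
    inv₁

  Regs : List (ℕ × ℕ) → Store → Set
  Regs []             σ = ⊤
  Regs ((r , v) ∷ rs) σ = ireg σ r ≡ v × Regs rs σ

  keptBy : Cmd → List (ℕ × ℕ) → Bool
  keptBy c []             = true
  keptBy c ((r , _) ∷ rs) = everywhere (λ op → keepsIReg op r) c ∧ keptBy c rs

  keepRegs : ∀ {c σ t σ′} → Exec c σ t σ′ → ∀ rs → Regs rs σ → {_ : T (keptBy c rs)} → Regs rs σ′
  keepRegs e [] tt = tt
  keepRegs {c} e ((r , _) ∷ rs) (eq , eqs) {ok} =
    trans (keepI e r {T-∧ˡ ok}) eq , keepRegs e rs eqs {T-∧ʳ {everywhere (λ op → keepsIReg op r) c} ok}

-- Ordered rings

module Order (R : OrderedRing) where
  open OrderedRing R public using (Carrier; _≈_; 0#; 1#; fromNat; isDecTotalOrder; *-nonNegative)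
    renaming (_+_ to _+R_; _*_ to _*R_; _≤_ to _≤R_; -_ to -R_; _-_ to _-R_; +-monoʳ-≤ to +R-monoʳ-≤)
  module O = OrderedRing R
  private module Ord = IsDecTotalOrder isDecTotalOrder

  ≈-refl : ∀ {x} → x ≈ x
  ≈-refl = Ord.Eq.refl

  ≈-sym : ∀ {x y} → x ≈ y → y ≈ x
  ≈-sym = Ord.Eq.sym

  ≈-trans : ∀ {x y z} → x ≈ y → y ≈ z → x ≈ z
  ≈-trans = Ord.Eq.trans

  ≡⇒≈ : ∀ {x y} → x ≡ y → x ≈ y
  ≡⇒≈ refl = ≈-refl

  poset : Poset _ _ _
  poset = record { isPartialOrder = Ord.isPartialOrder }

  module R-Reasoning = Relation.Binary.Reasoning.PartialOrder poset
  module R-Solver = Algebra.Solver.CommutativeMonoid O.+-commutativeMonoid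

  ≤R-refl : ∀ {x} → x ≤R x
  ≤R-refl = Ord.refl

  ≈⇒≤R : ∀ {x y} → x ≈ y → x ≤R y
  ≈⇒≤R = Ord.reflexive

  ≤R-trans : ∀ {x y z} → x ≤R y → y ≤R z → x ≤R z
  ≤R-trans = Ord.trans

  ≰R⇒≥ : ∀ {x y} → ¬ x ≤R y → y ≤R x
  ≰R⇒≥ {x} {y} x≰y with Ord.total x y
  ... | inj₁ x≤y = ⊥-elim (x≰y x≤y)
  ... | inj₂ y≤x = y≤x

  +R-mono-≤ : ∀ {x y u v} → x ≤R y → u ≤R v → x +R u ≤R y +R v
  +R-mono-≤ {x} {y} {u} {v} x≤y u≤v = begin
    x +R u ≤⟨ +R-monoʳ-≤ x u≤v ⟩
    x +R v ≈⟨ O.+-comm x v ⟩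
    v +R x ≤⟨ +R-monoʳ-≤ v x≤y ⟩
    v +R y ≈⟨ O.+-comm v y ⟩
    y +R v ∎
    where
    open R-Reasoning

  +R-cancelʳ-≤ : ∀ z {x y} → x +R z ≤R y +R z → x ≤R y
  +R-cancelʳ-≤ z {x} {y} h = begin
    x                 ≈⟨ x+z-z x ⟨
    (x +R z) +R -R z  ≤⟨ +R-mono-≤ h ≤R-refl ⟩
    (y +R z) +R -R z  ≈⟨ x+z-z y ⟩
    y                 ∎
    where
    open R-Reasoning
    x+z-z : ∀ x → (x +R z) +R -R z ≈ x
    x+z-z x = ≈-trans (O.+-assoc x z (-R z)) (≈-trans (O.+-cong ≈-refl (O.-‿inverseʳ z)) (O.+-identityʳ x))

  +R-nonNegative : ∀ {x y} → 0# ≤R x → 0# ≤R y → 0# ≤R x +R y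
  +R-nonNegative 0≤x 0≤y = ≤R-trans (≈⇒≤R (≈-sym (O.+-identityʳ 0#))) (+R-mono-≤ 0≤x 0≤y)

  ≤-+R : ∀ x {y} → 0# ≤R y → x ≤R x +R y
  ≤-+R x 0≤y = ≤R-trans (≈⇒≤R (≈-sym (O.+-identityʳ x))) (+R-monoʳ-≤ x 0≤y)

  -- By totality only `1# ≤ 0#` needs an argument: then `- 1#` is nonnegative, and so is its square,
  -- which is `1#`.
  0≤1 : 0# ≤R 1#
  0≤1 with Ord.total 0# 1#
  ... | inj₁ 0≤1 = 0≤1
  ... | inj₂ 1≤0 = ≤R-trans (*-nonNegative 0≤-1 0≤-1)
        (≈⇒≤R (≈-trans (-1*x≈-x O.ring (-R 1#))
                               (⁻¹-involutive O.+-group 1#)))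
    where
    0≤-1 : 0# ≤R -R 1#
    0≤-1 = +R-cancelʳ-≤ 1# (≤R-trans (≈⇒≤R (O.+-identityˡ 1#))
             (≤R-trans 1≤0 (≈⇒≤R (≈-sym (O.-‿inverseˡ 1#)))))

  fromNat-nonNegative : ∀ k → 0# ≤R fromNat k
  fromNat-nonNegative zero    = ≤R-refl
  fromNat-nonNegative (suc k) = +R-nonNegative 0≤1 (fromNat-nonNegative k)

  *R-monoˡ-≤ : ∀ {x y z} → 0# ≤R z → x ≤R y → x *R z ≤R y *R z
  *R-monoˡ-≤ {x} {y} {z} 0≤z x≤y = begin
    x *R z                     ≤⟨ ≤-+R _ (*-nonNegative 0≤y-x 0≤z) ⟩
    x *R z +R (y -R x) *R z    ≈⟨ O.distribʳ z x (y -R x) ⟨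
    (x +R (y -R x)) *R z       ≈⟨ O.*-cong (≈-trans (O.+-comm x _) (≈-trans (O.+-assoc y (-R x) x)
                                   (≈-trans (O.+-cong ≈-refl (O.-‿inverseˡ x)) (O.+-identityʳ y)))) ≈-refl ⟩
    y *R z                     ∎
    where
    open R-Reasoning
    0≤y-x : 0# ≤R y -R x
    0≤y-x = ≤R-trans (≈⇒≤R (≈-sym (O.-‿inverseʳ x))) (+R-mono-≤ x≤y ≤R-refl)

-- Trees on the leaves i … j with coloured nodes; true marks the nodes stored in
-- the smaller of the two memory levels.
data Tree : ℕ → ℕ → Set where
  leaf : ∀ {i} → Tree i i
  node : ∀ {i j} r (t : Bool) → Tree i r → Tree (suc r) j → Tree i j

bit : Bool → ℕ
bit true  = 1
bit false = 0

minors : ∀ {i j} → Tree i j → ℕ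
minors leaf           = 0
minors (node r t L R) = bit t + (minors L + minors R)

tree-≤ : ∀ {i j} → Tree i j → i ≤ j
tree-≤ leaf           = ≤-refl
tree-≤ (node r t L R) = ≤-trans (tree-≤ L) (≤-trans (n≤1+n r) (tree-≤ R))

bit≤1 : ∀ t → bit t ≤ 1
bit≤1 true  = ≤-refl
bit≤1 false = z≤n

minors-bound : ∀ {i j} (T : Tree i j) → minors T + i ≤ j
minors-bound leaf = ≤-refl
minors-bound {i} {j} (node r t L R) = begin
  bit t + (minors L + minors R) + i ≤⟨ +-monoˡ-≤ i (+-monoˡ-≤ (minors L + minors R) (bit≤1 t)) ⟩
  suc (minors L + minors R + i)     ≡⟨ cong (λ x → suc (x + i)) (+-comm (minors L) (minors R)) ⟩
  suc (minors R + minors L + i)     ≡⟨ cong suc (+-assoc (minors R) (minors L) i) ⟩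
  suc (minors R + (minors L + i))   ≤⟨ s≤s (+-monoʳ-≤ (minors R) (minors-bound L)) ⟩
  suc (minors R + r)                ≡⟨ +-suc (minors R) r ⟨
  minors R + suc r                  ≤⟨ minors-bound R ⟩
  j                                 ∎
  where
  open ≤-Reasoning

Plain : ∀ {i j} → Tree i j → Set
Plain leaf               = ⊤
Plain (node r false L R) = Plain L × Plain R
Plain (node r true L R)  = ⊥

minors⇒plain : ∀ {i j} (T : Tree i j) → minors T ≡ 0 → Plain T
minors⇒plain leaf               eq = tt
minors⇒plain (node r false L R) eq =
  minors⇒plain L (m+n≡0⇒m≡0 (minors L) eq) , minors⇒plain R (m+n≡0⇒n≡0 (minors L) eq)

plain⇒minors : ∀ {i j} (T : Tree i j) → Plain T → minors T ≡ 0
plain⇒minors leaf               _         = refl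
plain⇒minors (node r false L R) (pL , pR) = cong₂ _+_ (plain⇒minors L pL) (plain⇒minors R pR)

-- Costs of coloured trees and the quadrangle inequality

module Costs (R : OrderedRing) (inp : ℕ → OrderedRing.Carrier R) (C : Bool → OrderedRing.Carrier R) where
  open Order R

  -- The inputs lie in memory as q₀, p₁, q₁, ..., which is the inorder of leaves and keys, so every
  -- weight is a difference of prefix sums. Only the proof subtracts; the program accumulates
  -- weights by addition.
  prefix : ℕ → Carrier
  prefix zero    = 0#
  prefix (suc a) = prefix a +R inp a

  -- The weight w(T) of every tree T on the leaves i … j.
  W : ℕ → ℕ → Carrier
  W i j = prefix (suc (2 * j)) -R prefix (2 * i)

  -- `c` is the access cost of the parent. It matters only for a leaf, since below a node the colour
  -- of that node takes over.
  cost : ∀ {i j} → Carrier → Tree i j → Carrier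
  cost c (leaf {i})             = inp (2 * i) *R c
  cost c (node {i} {j} r t L R) = W i j *R C t +R cost (C t) L +R cost (C t) R

  Optimal : ∀ {i j} → Carrier → Tree i j → Set
  Optimal {i} {j} c T = ∀ (T′ : Tree i j) → minors T′ ≡ minors T → cost c T ≤R cost c T′

  module Exchange (n : ℕ) (inp≥0 : ∀ {a} → a ≤ 2 * n → 0# ≤R inp a) (C≥0 : 0# ≤R C false) where

    prefix-mono : ∀ {a b} → a ≤ b → b ≤ suc (2 * n) → prefix a ≤R prefix b
    prefix-mono {a} {b} a≤b b≤ = go (≤⇒≤′ a≤b) b≤
      where
      go : ∀ {a b} → a ≤′ b → b ≤ suc (2 * n) → prefix a ≤R prefix b
      go (≤′-reflexive refl) b≤ = ≤R-refl
      go (≤′-step a≤b)                     b≤ =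
        ≤R-trans (go a≤b (≤-trans (n≤1+n _) b≤)) (≤-+R _ (inp≥0 (≤-pred b≤)))

    d : Carrier
    d = C false

    W-mono : ∀ {i i′ j′ j} → i ≤ i′ → i′ ≤ j′ → j′ ≤ j → j ≤ n → W i′ j′ *R d ≤R W i j *R d
    W-mono {i} {i′} {j′} {j} i≤i′ i′≤j′ j′≤j j≤n = *R-monoˡ-≤ C≥0 (+R-cancelʳ-≤ (b +R a) (begin
      (c -R b) +R (b +R a)   ≈⟨ cancel c b a ⟩
      c +R a                 ≤⟨ +R-mono-≤ (prefix-mono (s≤s (*-monoʳ-≤ 2 j′≤j)) (s≤s (*-monoʳ-≤ 2 j≤n)))
                                          (prefix-mono (*-monoʳ-≤ 2 i≤i′)
                                            (m≤n⇒m≤1+n (*-monoʳ-≤ 2 (≤-trans i′≤j′ (≤-trans j′≤j j≤n))))) ⟩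
      e +R b                 ≈⟨ cancel e a b ⟨
      (e -R a) +R (a +R b)   ≈⟨ O.+-cong ≈-refl (O.+-comm a b) ⟩
      (e -R a) +R (b +R a)   ∎))
      where
      open R-Reasoning
      a = prefix (2 * i)
      b = prefix (2 * i′)
      c = prefix (suc (2 * j′))
      e = prefix (suc (2 * j))
      cancel : ∀ c b a → (c -R b) +R (b +R a) ≈ c +R a
      cancel c b a = ≈-trans (R-Solver.solve 4 (λ c b nb a → ((c ⊕ nb) ⊕ (b ⊕ a)) ⊜ ((c ⊕ a) ⊕ (b ⊕ nb))) ≈-refl c b (O.- b) a)
        (≈-trans (O.+-cong ≈-refl (O.-‿inverseʳ b)) (O.+-identityʳ _))
        where
        open R-Solver

    -- The quadrangle condition on weights holds with equality, because `W i j` is a function of `j`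
    -- minus a function of `i`.
    W-swap : ∀ i i′ j j′ → W i j *R d +R W i′ j′ *R d ≈ W i j′ *R d +R W i′ j *R d
    W-swap i i′ j j′ = ≈-trans (≈-sym (O.distribʳ d _ _)) (≈-trans (O.*-cong
      (R-Solver.solve 4 (λ c b e a → ((c ⊕ b) ⊕ (e ⊕ a)) ⊜ ((e ⊕ b) ⊕ (c ⊕ a))) ≈-refl
        (prefix (suc (2 * j))) (O.- prefix (2 * i)) (prefix (suc (2 * j′))) (O.- prefix (2 * i′)))
      ≈-refl) (O.distribʳ d _ _))
      where
      open R-Solver

    E : ∀ {i j} → Tree i j → Carrier
    E = cost d

    V : ℕ → ℕ → Carrier
    V i j = W i j *R d

    record Exchanged (i i′ j j′ : ℕ) (bound : Carrier) : Set where
      constructor exchanged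
      field
        {inner} : Tree i j
        {outer} : Tree i′ j′
        inner-plain : Plain inner
        outer-plain : Plain outer
        total-≤ : E inner +R E outer ≤R bound

    -- The quadrangle inequality, as a recombination of two given trees.
    exchange : ∀ {i i′ j j′} (A : Tree i j′) (B : Tree i′ j) → Plain A → Plain B →
               i ≤ i′ → j ≤ j′ → j′ ≤ n → Exchanged i i′ j j′ (E A +R E B)
    -- Here `i ≤ i′ ≤ j ≤ i`, so all four ends coincide.
    exchange leaf B pA pB i≤i′ j≤i i≤n with ≤-antisym i≤i′ (≤-trans (tree-≤ B) j≤i)
    ... | refl with ≤-antisym j≤i (tree-≤ B)
    ...   | refl = exchanged {inner = leaf} {B} tt pB ≤R-refl
    -- Against a leaf at `j` the tree is cut at `j` along the search path. Each root on the path
    -- goes to one side with an interval contained in its old one, so `W-mono` suffices.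
    exchange {i} {j′ = j′} (node z false Al Ar) (leaf {j}) (pAl , pAr) pB i≤j j≤j′ j′≤n with <-≤-connex z j
    ... | inj₁ z<j with exchange Ar (leaf {j}) pAr tt z<j j≤j′ j′≤n
    ...   | exchanged {X} {Y} pX pY h = exchanged {inner = node z false Al X} {Y} (pAl , pX) pY (begin
      V i j +R E Al +R E X +R E Y
        ≈⟨ O.+-assoc _ _ _ ⟩
      V i j +R E Al +R (E X +R E Y)
        ≤⟨ +R-mono-≤ (+R-mono-≤ (W-mono ≤-refl i≤j j≤j′ j′≤n) ≤R-refl) h ⟩
      V i j′ +R E Al +R (E Ar +R E (leaf {j}))
        ≈⟨ O.+-assoc _ _ _ ⟨
      V i j′ +R E Al +R E Ar +R E (leaf {j}) ∎)
      where
      open R-Reasoning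
    exchange {i} {j′ = j′} (node z false Al Ar) (leaf {j}) (pAl , pAr) pB i≤j j≤j′ j′≤n | inj₂ j≤z
      with exchange Al (leaf {j}) pAl tt i≤j j≤z (≤-trans (≤-trans (n≤1+n z) (tree-≤ Ar)) j′≤n)
    ... | exchanged {X} {Y} pX pY h = exchanged {inner = X} {node z false Y Ar} pX (pY , pAr) (begin
      E X +R (V j j′ +R E Y +R E Ar)
        ≈⟨ solve 4 (λ x w y r → (x ⊕ ((w ⊕ y) ⊕ r)) ⊜ ((w ⊕ r) ⊕ (x ⊕ y))) ≈-refl _ _ _ _ ⟩
      V j j′ +R E Ar +R (E X +R E Y)
        ≤⟨ +R-mono-≤ (+R-mono-≤ (W-mono i≤j j≤j′ ≤-refl j′≤n) ≤R-refl) h ⟩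
      V i j′ +R E Ar +R (E Al +R E (leaf {j}))
        ≈⟨ solve 4 (λ w r l f → ((w ⊕ r) ⊕ (l ⊕ f)) ⊜ (((w ⊕ l) ⊕ r) ⊕ f)) ≈-refl _ _ _ _ ⟩
      V i j′ +R E Al +R E Ar +R E (leaf {j}) ∎)
      where
      open R-Reasoning
      open R-Solver
    -- The smaller root becomes the root of the tree on `i … j`, the other one that of the tree on
    -- `i′ … j′`; the weights of the two roots balance by `W-swap`. If `z ≤ y`, both roots keep
    -- their left subtrees and the right ones are exchanged recursively; otherwise the sides are
    -- reversed.
    exchange {i} {i′} {j} {j′} (node z false Al Ar) (node y false Bl Br) (pAl , pAr) (pBl , pBr) i≤i′ j≤j′ j′≤n
      with ≤-<-connex z y
    ... | inj₁ z≤y with exchange Ar Br pAr pBr (s≤s z≤y) j≤j′ j′≤n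
    ...   | exchanged {X} {Y} pX pY h = exchanged {inner = node z false Al X} {node y false Bl Y} (pAl , pX) (pBl , pY) (begin
      V i j +R E Al +R E X +R (V i′ j′ +R E Bl +R E Y)
        ≈⟨ solve 6 (λ w l x v b y → (((w ⊕ l) ⊕ x) ⊕ ((v ⊕ b) ⊕ y)) ⊜ ((w ⊕ v) ⊕ ((l ⊕ b) ⊕ (x ⊕ y)))) ≈-refl _ _ _ _ _ _ ⟩
      V i j +R V i′ j′ +R (E Al +R E Bl +R (E X +R E Y))
        ≤⟨ +R-mono-≤ (≈⇒≤R (W-swap i i′ j j′)) (+R-mono-≤ ≤R-refl h) ⟩
      V i j′ +R V i′ j +R (E Al +R E Bl +R (E Ar +R E Br))
        ≈⟨ solve 6 (λ w l x v b y → (((w ⊕ l) ⊕ x) ⊕ ((v ⊕ b) ⊕ y)) ⊜ ((w ⊕ v) ⊕ ((l ⊕ b) ⊕ (x ⊕ y)))) ≈-refl _ _ _ _ _ _ ⟨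
      V i j′ +R E Al +R E Ar +R (V i′ j +R E Bl +R E Br) ∎)
      where
      open R-Reasoning
      open R-Solver
    exchange {i} {i′} {j} {j′} (node z false Al Ar) (node y false Bl Br) (pAl , pAr) (pBl , pBr) i≤i′ j≤j′ j′≤n
      | inj₂ y<z with exchange Al Bl pAl pBl i≤i′ (<⇒≤ y<z) (≤-trans (≤-trans (n≤1+n z) (tree-≤ Ar)) j′≤n)
    ... | exchanged {X} {Y} pX pY h = exchanged {inner = node y false X Br} {node z false Y Ar} (pX , pBr) (pY , pAr) (begin
      V i j +R E X +R E Br +R (V i′ j′ +R E Y +R E Ar)
        ≈⟨ solve 6 (λ w x b v y a → (((w ⊕ x) ⊕ b) ⊕ ((v ⊕ y) ⊕ a)) ⊜ ((w ⊕ v) ⊕ ((a ⊕ b) ⊕ (x ⊕ y)))) ≈-refl _ _ _ _ _ _ ⟩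
      V i j +R V i′ j′ +R (E Ar +R E Br +R (E X +R E Y))
        ≤⟨ +R-mono-≤ (≈⇒≤R (W-swap i i′ j j′)) (+R-mono-≤ ≤R-refl h) ⟩
      V i j′ +R V i′ j +R (E Ar +R E Br +R (E Al +R E Bl))
        ≈⟨ solve 6 (λ w x a v y b → (((w ⊕ x) ⊕ a) ⊕ ((v ⊕ y) ⊕ b)) ⊜ ((w ⊕ v) ⊕ ((a ⊕ b) ⊕ (x ⊕ y)))) ≈-refl _ _ _ _ _ _ ⟨
      V i j′ +R E Al +R E Ar +R (V i′ j +R E Bl +R E Br) ∎)
      where
      open R-Reasoning
      open R-Solver

    record RootedAt (a : ℕ) {i j : ℕ} (bound : Carrier) : Set where
      constructor rooted
      field
        {left}  : Tree i a
        {right} : Tree (suc a) j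
        left-plain  : Plain left
        right-plain : Plain right
        cost-≤ : E (node {i} {j} a false left right) ≤R bound

    -- If a is the root of an optimal tree on i … j, no tree on i … j + 1 needs a
    -- root to the left of a.
    root-≥ : ∀ {i j a r} (Al : Tree i a) (Ar : Tree (suc a) j) (Xl : Tree i r) (Xr : Tree (suc r) (suc j)) →
             Plain Al → Plain Ar → Plain Xl → Plain Xr → Optimal d (node a false Al Ar) →
             r ≤ a → suc j ≤ n → RootedAt a {i} {suc j} (E (node {i} r false Xl Xr))
    root-≥ {i} {j} {a} {r} Al Ar Xl Xr pAl pAr pXl pXr opt r≤a j<n with exchange Xr Ar pXr pAr (s≤s r≤a) (n≤1+n j) j<n
    ... | exchanged {C₁} {D} pC pD h = rooted {left = Al} {D} pAl pD
      (≤R-trans (≈⇒≤R (O.+-assoc _ _ _)) (≤R-trans (O.+-monoʳ-≤ _ main) (≈⇒≤R (≈-sym (O.+-assoc _ _ _)))))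
      where
      open R-Solver
      open R-Reasoning
      k₁ : V i j +R E Al +R E Ar ≤R V i j +R E Xl +R E C₁
      k₁ = opt (node r false Xl C₁) (trans (plain⇒minors (node {i} {j} r false Xl C₁) (pXl , pC)) (sym (plain⇒minors (node {i} {j} a false Al Ar) (pAl , pAr))))
      w = V i j
      main : E Al +R E D ≤R E Xl +R E Xr
      main = +R-cancelʳ-≤ (w +R E Ar +R E C₁) (begin
        (E Al +R E D) +R (w +R E Ar +R E C₁)
          ≈⟨ solve 5 (λ l x w r c → ((l ⊕ x) ⊕ ((w ⊕ r) ⊕ c)) ⊜ (((w ⊕ l) ⊕ r) ⊕ (c ⊕ x))) ≈-refl _ _ _ _ _ ⟩
        (w +R E Al +R E Ar) +R (E C₁ +R E D)
          ≤⟨ +R-mono-≤ k₁ h ⟩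
        (w +R E Xl +R E C₁) +R (E Xr +R E Ar)
          ≈⟨ solve 5 (λ w l c x r → (((w ⊕ l) ⊕ c) ⊕ (x ⊕ r)) ⊜ ((l ⊕ x) ⊕ ((w ⊕ r) ⊕ c))) ≈-refl _ _ _ _ _ ⟩
        (E Xl +R E Xr) +R (w +R E Ar +R E C₁) ∎)

    -- Mirror image of `root-≥`. Exchanging `Xl` with `Bl` gives `C₁` on `i … b` and `D` on
    -- `suc i … r`. With `Xr`, the tree `D` forms a competitor of the optimal tree on `suc i … j`;
    -- adding that comparison to the exchange inequality and cancelling leaves the claim for root
    -- `b` over `C₁` and `Br`.
    root-≤ : ∀ {i j b r} (Bl : Tree (suc i) b) (Br : Tree (suc b) j) (Xl : Tree i r) (Xr : Tree (suc r) j) →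
             Plain Bl → Plain Br → Plain Xl → Plain Xr → Optimal d (node b false Bl Br) →
             b ≤ r → j ≤ n → RootedAt b {i} {j} (E (node {i} r false Xl Xr))
    root-≤ {i} {j} {b} {r} Bl Br Xl Xr pBl pBr pXl pXr opt b≤r j≤n
      with exchange Xl Bl pXl pBl (n≤1+n i) b≤r (≤-trans (n≤1+n r) (≤-trans (tree-≤ Xr) j≤n))
    ... | exchanged {C₁} {D} pC pD h = rooted {left = C₁} {Br} pC pBr
      (≤R-trans (≈⇒≤R (O.+-assoc _ _ _)) (≤R-trans (O.+-monoʳ-≤ _ main) (≈⇒≤R (≈-sym (O.+-assoc _ _ _)))))
      where
      open R-Solver
      open R-Reasoning
      w = V (suc i) j
      k₁ : w +R E Bl +R E Br ≤R w +R E D +R E Xr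
      k₁ = opt (node r false D Xr) (trans (plain⇒minors (node {suc i} {j} r false D Xr) (pD , pXr)) (sym (plain⇒minors (node {suc i} {j} b false Bl Br) (pBl , pBr))))
      main : E C₁ +R E Br ≤R E Xl +R E Xr
      main = +R-cancelʳ-≤ (w +R E Bl +R E D) (begin
        (E C₁ +R E Br) +R (w +R E Bl +R E D)
          ≈⟨ solve 5 (λ c r w l x → ((c ⊕ r) ⊕ ((w ⊕ l) ⊕ x)) ⊜ (((w ⊕ l) ⊕ r) ⊕ (c ⊕ x))) ≈-refl _ _ _ _ _ ⟩
        (w +R E Bl +R E Br) +R (E C₁ +R E D)
          ≤⟨ +R-mono-≤ k₁ h ⟩
        (w +R E D +R E Xr) +R (E Xl +R E Bl)
          ≈⟨ solve 5 (λ w x r l b → (((w ⊕ x) ⊕ r) ⊕ (l ⊕ b)) ⊜ ((l ⊕ r) ⊕ ((w ⊕ b) ⊕ x))) ≈-refl _ _ _ _ _ ⟩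
        (E Xl +R E Xr) +R (w +R E Bl +R E D) ∎)

-- The program

-- Index registers are named %…, number registers $….

%m₁ %m₂ %c₁ %c₂ %n %N %m %i %j %k %r %t %a %b %kk %lo %hi %has %br %bt %ba %kmax : ℕ
%x %cmin %cmaj %fmin %fmaj %A %F %u %I %J %K %l %s %p %go : ℕ
%m₁ = 0
%m₂ = 1
%c₁ = 2
%c₂ = 3
%n = 4
%N = 5
%m = 6
%i = 7
%j = 8
%k = 9
%r = 10
%t = 11
%a = 12
%b = 13
%kk = 14
%lo = 15
%hi = 16
%has = 17
%br = 18
%bt = 19
%ba = 20
%kmax = 21
%x = 22
%cmin = 23
%cmaj = 24
%fmin = 25
%fmaj = 26
%A = 27
%F = 28
%u = 29
%I = 30
%J = 31
%K = 32
%l = 33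
%s = 34
%p = 35
%go = 36

$w $c $v $cand $best $z : ℕ
$w = 0
$c = 1
$v = 2
$cand = 3
$best = 4
$z = 5

mov : ℕ → ℕ → List Op
mov d s = setI %u 0 ∷ addI d %u s ∷ []

inc : ℕ → List Op
inc d = setI %u 1 ∷ addI d %u d ∷ []

next : ℕ → ℕ → List Op
next d s = setI %u 1 ∷ addI d %u s ∷ []

skip : Cmd
skip = ops []

-- %A becomes the number of the table record of (I , J , K).
record-of : ℕ → ℕ → ℕ → List Op
record-of I J K =
  subI %A %n I ∷ setI %u 1 ∷ addI %A %u %A ∷ mulI %A %A %N ∷ addI %A %A J ∷ mulI %A %A %N ∷ addI %A %A K ∷ []

field-of : ℕ → List Op
field-of f = setI %u 3 ∷ mulI %F %u %A ∷ setI %u (suc f) ∷ addI %F %u %F ∷ []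

get : ℕ → ℕ → List Op
get f d = field-of f ++ loadI d %F ∷ []

put : ℕ → ℕ → List Op
put f s = field-of f ++ storeI %F s ∷ []

-- A leaf has no record, because its cost depends on the colour of the parent being tried; it is
-- computed from the input and `$c`.
value : Cmd
value = when (%J ≤ᴵ %I)
  (ops (setI %u 2 ∷ mulI %F %u %I ∷ loadR $v %F ∷ mulR $v $v $c ∷ []))
  (ops (record-of %I %J %K ++ loadR $v %A ∷ []))

-- Number registers have no move, so `$best` becomes `0# + $cand`. This is one reason why stored
-- values equal costs only up to `≈`.
take : Cmd
take = ops (setI %has 1 ∷ mov %br %r ++ mov %bt %t ++ mov %ba %a ++
            setI %u 0 ∷ castR $z %u ∷ addR $best $z $cand ∷ [])

-- `%has` replaces an infinite initial value: until the first candidate is taken, `$best` is not to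
-- be compared.
decide : Cmd
decide = ops (setI %u 0 ∷ []) ︔ when (%has ≤ᴵ %u) take (when ($best ≤ᴿ $cand) skip take)

left-child : List Op
left-child = mov %I %i ++ mov %J %r ++ mov %K %a

left-args : List Op
left-args = left-child ++ mulR $cand $w $c ∷ []

right-args : List Op
right-args = addR $cand $cand $v ∷ next %I %r ++ mov %J %j ++ mov %K %b

try : Cmd
try = ops left-args ︔ value ︔ ops right-args ︔ value ︔ ops (addR $cand $cand $v ∷ []) ︔ decide

-- A tree on `i … r` with `a` marked nodes exists exactly if `i + a ≤ r`, and one on `suc r … j`
-- with `b` exactly if `suc r + b ≤ j`. Only such entries are filled, so the two tests prevent
-- garbage from being read.
feasibility : List Op
feasibility = subI %b %kk %a ∷ addI %l %i %a ∷ next %s %r ++ addI %s %s %b ∷ []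

split : Cmd
split = ops feasibility ︔ when (%l ≤ᴵ %r) (when (%s ≤ᴵ %j) try skip) skip ︔ ops (inc %a)

splits : Cmd
splits = ops (subI %kk %k %t ∷ setI %a 0 ∷ []) ︔ while (%a ≤ᴵ %kk) split

major-root : List Op
major-root = setI %t 0 ∷ castR $c %cmaj ∷ []

minor-root : List Op
minor-root = setI %t 1 ∷ castR $c %cmin ∷ []

root : Cmd
root = ops major-root ︔ splits ︔ ops minor-root ︔ when (%t ≤ᴵ %k) splits skip ︔ ops (inc %r)

roots : Cmd
roots = ops (setI %has 0 ∷ mov %r %lo) ︔ while (%r ≤ᴵ %hi) root

store : List Op
store = record-of %i %j %k ++ storeR %A $best ∷ put 0 %br ++ put 1 %bt ++ put 2 %ba ++ inc %k

entry : Cmd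
entry = roots ︔ ops store

entries : Cmd
entries = ops (setI %k 0 ∷ []) ︔ while (%k ≤ᴵ %kmax) entry

-- One more key adds two input cells to the weight, so no table of weights is needed. An interval
-- with `j ∸ i` keys has entries for no larger counts, whence the minimum in `%kmax`.
weigh : Cmd
weigh = ops (setI %u 2 ∷ mulI %F %u %j ∷ loadR $v %F ∷ setI %u 1 ∷ subI %F %F %u ∷ loadR $z %F ∷
             addR $w $w $z ∷ addR $w $w $v ∷ subI %kmax %j %i ∷ []) ︔
        when (%m ≤ᴵ %kmax) (ops (mov %kmax %m)) skip

-- Without minor nodes, the roots are searched only between those of the two
-- intervals that are shorter by one key.
range : Cmd
range = ops (setI %u 0 ∷ []) ︔
        when (%m ≤ᴵ %u)
          (ops (next %I %i ++ setI %K 0 ∷ record-of %I %j %K ++ get 0 %hi))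
          (ops (mov %lo %i ++ setI %u 1 ∷ subI %hi %j %u ∷ []))

-- After `entries`, `%br` is the root of the last entry, which is the only one when `m ≡ 0`. Moved
-- to `%lo`, it is the lower end of the next range, and the one-level branch of `range` leaves it
-- there.
interval : Cmd
interval = weigh ︔ range ︔ entries ︔ ops (mov %lo %br ++ inc %j)

-- The empty interval `(i , i)` receives the fictitious root `i ∸ 1`. The next row, `i ∸ 1`, reads
-- it as the upper end of the range of its first interval, whose only key is `i ∸ 1`.
start : List Op
start =
  subI %i %n %x ∷ setI %u 2 ∷ mulI %F %u %i ∷ loadR $w %F ∷ setI %u 1 ∷ subI %s %i %u ∷ setI %k 0 ∷
  record-of %i %i %k ++ put 0 %s ++ mov %lo %i ++ next %j %i

row : Cmd
row = ops start ︔ while (%j ≤ᴵ %n) interval ︔ ops (inc %x)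

table : Cmd
table = ops (setI %x 0 ∷ []) ︔ while (%x ≤ᴵ %n) row

-- `%fmin` and `%fmaj` are the next free addresses of the smaller and the larger level, counted from
-- 1 as the output demands.
initialise : Cmd
initialise =
  ops (addI %n %m₁ %m₂ ∷ next %N %n) ︔
  when (%m₁ ≤ᴵ %m₂)
    (ops (mov %m %m₁ ++ mov %cmin %c₁ ++ mov %cmaj %c₂ ++ setI %fmin 1 ∷ next %fmaj %m₁))
    (ops (mov %m %m₂ ++ mov %cmin %c₂ ++ mov %cmaj %c₁ ++ next %fmin %m₁ ++ setI %fmaj 1 ∷ []))

pointer : Cmd
pointer = when (%J ≤ᴵ %I)
  (ops (setI %p 0 ∷ []))
  (ops (record-of %I %J %K ++ get 0 %p ++ inc %p))

place : Cmd
place = ops (setI %u 1 ∷ []) ︔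
  when (%u ≤ᴵ %t) (ops (put 2 %fmin ++ inc %fmin)) (ops (put 2 %fmaj ++ inc %fmaj))

right-child : List Op
right-child = mov %A %x ++ put 0 %p ++ next %I %r ++ mov %J %j ++ mov %K %b

emit : Cmd
emit = ops left-child ︔ pointer ︔
       ops right-child ︔ pointer ︔
       ops (mov %A %x ++ put 1 %p) ︔ place ︔
       ops (next %go %x)

load : List Op
load = record-of %i %j %k ++ get 0 %r ++ get 1 %t ++ get 2 %a ++ subI %b %k %t ∷ subI %b %b %a ∷ []

descend : Cmd
descend = ops load ︔
  when (%r ≤ᴵ %x)
    (when (%x ≤ᴵ %r) emit (ops (next %i %r ++ mov %k %b)))
    (ops (mov %j %r ++ mov %k %a))

seek : Cmd
seek = while (%go ≤ᴵ %x) descend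

-- Every key is searched for from the root, which avoids a stack: `n` descents of at most `n` steps
-- fit the quadratic bound. The search goes on while `%go ≤ %x`, and `emit` ends it by setting `%go`
-- to `x + 1`.
key : Cmd
key = ops (setI %i 0 ∷ mov %j %n ++ mov %k %m ++ setI %go 0 ∷ []) ︔ seek ︔ ops (inc %x)

setup : List Op
setup = setI %u 0 ∷ storeI %u %p ∷ setI %x 0 ∷ setI %u 1 ∷ subI %l %n %u ∷ []

whole : List Op
whole = setI %I 0 ∷ mov %J %n ++ mov %K %m

output : Cmd
output = ops whole ︔ pointer ︔ ops setup ︔ while (%x ≤ᴵ %l) key

twoLevel : Cmd
twoLevel = initialise ︔ table ︔ output

-- The dynamic program

update-≡ : ∀ {A : Set} (f : ℕ → A) a {b} x → b ≡ a → (f [ a ↦ x ]) b ≡ x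
update-≡ f a {b} x b≡a = cong (λ c → if c then x else f b) (dec-true (b ≟ a) b≡a)

update-≢ : ∀ {A : Set} (f : ℕ → A) a {b} x → b ≢ a → (f [ a ↦ x ]) b ≡ f b
update-≢ f a {b} x b≢a = cong (λ c → if c then x else f b) (dec-false (b ≟ a) b≢a)

radix-< : ∀ {q q′ r r′ N} → q < q′ → r < N → q * N + r < q′ * N + r′
radix-< {q} {q′} {r} {r′} {N} q<q′ r<N = begin-strict
  q * N + r    <⟨ +-monoʳ-< (q * N) r<N ⟩
  q * N + N    ≡⟨ +-comm (q * N) N ⟩
  suc q * N    ≤⟨ *-monoˡ-≤ N q<q′ ⟩
  q′ * N       ≤⟨ m≤m+n _ r′ ⟩
  q′ * N + r′  ∎
  where
  open ≤-Reasoning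

1<3 : 1 < 3
1<3 = s≤s (s≤s z≤n)

2<3 : 2 < 3
2<3 = ≤-refl

-- Memory layout of the table

module Tables (n : ℕ) where

  -- The records are numbered in the order in which they are computed.
  idx : ℕ → ℕ → ℕ → ℕ
  idx i j k = (suc (n ∸ i) * suc n + j) * suc n + k

  idx-cong : ∀ {x y z u v i j k} → x ≡ n → y ≡ i → z ≡ suc n → u ≡ j → v ≡ k →
             (suc (x ∸ y) * z + u) * z + v ≡ idx i j k
  idx-cong refl refl refl refl refl = refl

  -- For a key `x` these are the three output cells of `x`. The output thus consists of records
  -- numbered below `n`, in the same format as the table.
  cell : ℕ → ℕ → ℕ
  cell f a = suc f + 3 * a

  -- The count of the right subtree is not stored: it is the total count less the colour bit and the
  -- left count.
  Encodes : (ℕ → ℕ) → ∀ {i j} → Tree i j → Set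
  Encodes mem leaf = ⊤
  Encodes mem {i} {j} (node r t L R) =
    mem (cell 0 a) ≡ r × mem (cell 1 a) ≡ bit t × mem (cell 2 a) ≡ minors L ×
    Encodes mem L × Encodes mem R
    where a = idx i j (bit t + (minors L + minors R))

  idx-row : ∀ {i i′ j j′ k k′} → i < i′ → i′ ≤ n → j′ ≤ n → k′ ≤ n → idx i′ j′ k′ < idx i j k
  idx-row {i} {i′} {j} i<i′ i′≤n j′≤n k′≤n =
    radix-< (radix-< {r′ = j} (s≤s (∸-monoʳ-< i<i′ i′≤n)) (s≤s j′≤n)) (s≤s k′≤n)

  idx-col : ∀ {i j j′ k k′} → j′ < j → k′ ≤ n → idx i j′ k′ < idx i j k
  idx-col {i} j′<j k′≤n = radix-< (+-monoʳ-< (suc (n ∸ i) * suc n) j′<j) (s≤s k′≤n)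

  idx-sub : ∀ {i i′ j j′ k k′} → i ≤ i′ → j′ ≤ j → i < i′ ⊎ j′ < j → i′ ≤ n → j′ ≤ n → k′ ≤ n → idx i′ j′ k′ < idx i j k
  idx-sub i≤i′ j′≤j (inj₁ i<i′) i′≤n j′≤n k′≤n = idx-row i<i′ i′≤n j′≤n k′≤n
  idx-sub {i} {j = j} {j′} {k} {k′} i≤i′ j′≤j (inj₂ j′<j) i′≤n j′≤n k′≤n with m≤n⇒m<n∨m≡n i≤i′
  ... | inj₁ i<i′ = idx-row i<i′ i′≤n j′≤n k′≤n
  ... | inj₂ refl = idx-col {i} {j} {j′} {k} {k′} j′<j k′≤n

  -- The leading digit `suc (n ∸ i)` is positive. Records of the table therefore lie above the
  -- inputs, at addresses up to `2 * n`, and above the output records, numbered below `n`.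
  N*N≤idx : ∀ i j k → suc n * suc n ≤ idx i j k
  N*N≤idx i j k = ≤-trans (*-monoˡ-≤ (suc n) (≤-trans (m≤m+n (suc n) ((n ∸ i) * suc n)) (m≤m+n _ j))) (m≤m+n _ k)

  2n<N*N : 2 * n < suc n * suc n
  2n<N*N = s≤s (+-monoʳ-≤ n (≤-trans (≤-reflexive (+-identityʳ n)) (m≤m*n n (suc n))))

  cell-< : ∀ {f g a b} → f < 3 → a < b → cell f a < cell g b
  cell-< {f} {g} {a} {b} f<3 a<b = s≤s (begin
    suc f + 3 * a ≤⟨ +-monoˡ-≤ (3 * a) f<3 ⟩
    3 + 3 * a    ≡⟨ *-suc 3 a ⟨
    3 * suc a    ≤⟨ *-monoʳ-≤ 3 a<b ⟩
    3 * b        ≤⟨ m≤n+m (3 * b) g ⟩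
    g + 3 * b    ∎)
    where
    open ≤-Reasoning

  cell-≢ : ∀ {f g a b} → f < 3 → g < 3 → a ≢ b → cell f a ≢ cell g b
  cell-≢ {f} {g} {a} {b} f<3 g<3 a≢b eq with <-cmp a b
  ... | tri< a<b _ _ = <⇒≢ (cell-< {f} {g} f<3 a<b) eq
  ... | tri≈ _ a≡b _ = a≢b a≡b
  ... | tri> _ _ b<a = <⇒≢ (cell-< {g} {f} g<3 b<a) (sym eq)

  cell-≢ᶠ : ∀ f g a → f ≢ g → cell f a ≢ cell g a
  cell-≢ᶠ f g a f≢g eq = f≢g (suc-injective (+-cancelʳ-≡ (3 * a) (suc f) (suc g) eq))

  written : (ℕ → ℕ) → ℕ → ℕ → ℕ → ℕ → ℕ → ℕ
  written mem a x y z = ((mem [ cell 0 a ↦ x ]) [ cell 1 a ↦ y ]) [ cell 2 a ↦ z ]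

  written-0 : ∀ mem a x y z → written mem a x y z (cell 0 a) ≡ x
  written-0 mem a x y z = trans (update-≢ ((mem [ cell 0 a ↦ x ]) [ cell 1 a ↦ y ]) (cell 2 a) z (cell-≢ᶠ 0 2 a λ ()))
    (trans (update-≢ (mem [ cell 0 a ↦ x ]) (cell 1 a) y (cell-≢ᶠ 0 1 a λ ())) (update-≡ mem (cell 0 a) x refl))

  written-1 : ∀ mem a x y z → written mem a x y z (cell 1 a) ≡ y
  written-1 mem a x y z = trans (update-≢ ((mem [ cell 0 a ↦ x ]) [ cell 1 a ↦ y ]) (cell 2 a) z (cell-≢ᶠ 1 2 a λ ()))
    (update-≡ (mem [ cell 0 a ↦ x ]) (cell 1 a) y refl)

  written-2 : ∀ mem a x y z → written mem a x y z (cell 2 a) ≡ z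
  written-2 mem a x y z = update-≡ ((mem [ cell 0 a ↦ x ]) [ cell 1 a ↦ y ]) (cell 2 a) z refl

  written-≢ : ∀ mem a x y z {f b} → f < 3 → b ≢ a → written mem a x y z (cell f b) ≡ mem (cell f b)
  written-≢ mem a x y z {f} {b} f<3 b≢a =
    trans (update-≢ ((mem [ cell 0 a ↦ x ]) [ cell 1 a ↦ y ]) (cell 2 a) z (cell-≢ {f} {2} f<3 2<3 b≢a))
    (trans (update-≢ (mem [ cell 0 a ↦ x ]) (cell 1 a) y (cell-≢ {f} {1} f<3 1<3 b≢a))
      (update-≢ mem (cell 0 a) x (cell-≢ {f} {0} f<3 (s≤s z≤n) b≢a)))

  -- As records are written in the order of their numbers, agreement below the current number is
  -- enough to carry all finished entries along.
  record Agree {A : Set} (X : ℕ) (mem : ℕ → ℕ) (rm : ℕ → A) (mem′ : ℕ → ℕ) (rm′ : ℕ → A) : Set where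
    constructor agree
    field
      records : ∀ {f a} → f < 3 → a < X → mem′ (cell f a) ≡ mem (cell f a)
      numbers : ∀ {a} → a < X → rm′ a ≡ rm a
  open Agree

  agree-refl : ∀ {A X mem} {rm : ℕ → A} → Agree X mem rm mem rm
  agree-refl = agree (λ _ _ → refl) (λ _ → refl)

  agree-trans : ∀ {A X mem mem′ mem″} {rm rm′ rm″ : ℕ → A} →
    Agree X mem rm mem′ rm′ → Agree X mem′ rm′ mem″ rm″ → Agree X mem rm mem″ rm″
  agree-trans A₁ A₂ = agree (λ f<3 a<X → trans (records A₂ f<3 a<X) (records A₁ f<3 a<X))
                            (λ a<X → trans (numbers A₂ a<X) (numbers A₁ a<X))

  agree-≤ : ∀ {A X Y mem mem′} {rm rm′ : ℕ → A} → X ≤ Y → Agree Y mem rm mem′ rm′ → Agree X mem rm mem′ rm′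
  agree-≤ X≤Y A = agree (λ f<3 a<X → records A f<3 (<-≤-trans a<X X≤Y)) (λ a<X → numbers A (<-≤-trans a<X X≤Y))

  minors-≤ : ∀ {i j} (T : Tree i j) → j ≤ n → minors T ≤ n
  minors-≤ T j≤n = ≤-trans (≤-trans (m≤m+n _ _) (minors-bound T)) j≤n

  -- The records of a tree are numbered from `suc n * suc n` up to that of its root. The upper limit
  -- serves while the table grows above them, the lower one while the output is written beneath.
  encodes-agree : ∀ {lower upper mem mem′} →
    (∀ {f a} → f < 3 → lower ≤ a → a < upper → mem′ (cell f a) ≡ mem (cell f a)) → lower ≤ suc n * suc n →
    ∀ {i j} (T : Tree i j) → j ≤ n → idx i j (minors T) < upper → Encodes mem T → Encodes mem′ T
  encodes-agree same low leaf j≤n i<X _ = tt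
  encodes-agree same low {i} {j} (node r t L R) j≤n i<X (er , et , ea , eL , eR) =
    trans (same (s≤s z≤n) l≤ i<X) er ,
    trans (same 1<3 l≤ i<X) et ,
    trans (same 2<3 l≤ i<X) ea ,
    encodes-agree same low L r≤n
      (<-trans (idx-sub {i} {i} {j} {r} ≤-refl (<⇒≤ r<j) (inj₂ r<j) (≤-trans (tree-≤ L) r≤n) r≤n (minors-≤ L r≤n)) i<X) eL ,
    encodes-agree same low R j≤n
      (<-trans (idx-sub {i} {suc r} {j} {j} (m≤n⇒m≤1+n (tree-≤ L)) ≤-refl (inj₁ (s≤s (tree-≤ L))) (≤-trans r<j j≤n) j≤n (minors-≤ R j≤n)) i<X) eR
    where
    r<j = tree-≤ R
    r≤n = ≤-trans (<⇒≤ r<j) j≤n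
    l≤ = ≤-trans low (N*N≤idx i j (minors (node {i} {j} r t L R)))

chain : ∀ {i} d k → k ≤ d → Σ (Tree i (d + i)) λ T → minors T ≡ k
chain zero    zero    z≤n       = leaf , refl
chain (suc d) zero    z≤n       with chain d 0 z≤n
... | T , eq = node _ false T leaf , trans (+-identityʳ _) eq
chain (suc d) (suc k) (s≤s k≤d) with chain d k k≤d
... | T , eq = node _ true T leaf , cong suc (trans (+-identityʳ _) eq)

-- A path realises every feasible count; this guarantees that the search for an entry finds a
-- candidate.
tree-with : ∀ {i j k} → k + i ≤ j → Σ (Tree i j) λ T → minors T ≡ k
tree-with {i} {j} {k} k+i≤j = subst (λ j → Σ (Tree i j) λ T → minors T ≡ k) (m∸n+n≡m i≤j)
  (chain (j ∸ i) k (m+n≤o⇒m≤o∸n k k+i≤j))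
  where
  i≤j : i ≤ j
  i≤j = ≤-trans (m≤n+m i k) k+i≤j

-- Here `e` is the number of roots tried and `s` the time of one split. The polynomial added on the
-- left is the difference of the two sides, so the solver has only an identity to check.
interval-time-≤ : ∀ A s m e → let x = 4 + suc m * (2 + s) in
  A + (3 + suc m * (2 + ((5 + e * (2 + (8 + (x + x)))) + 25))) + 2 ≤ suc m * suc m * (A + 59 + 2 * s) * (1 + e)
interval-time-≤ A s m e = ≤-trans (m≤m+n _ _) (≤-reflexive (solve 4 (λ A s m e →
  (A :+ (con 3 :+ (con 1 :+ m) :* (con 2 :+ ((con 5 :+ e :* (con 2 :+ (con 8 :+ ((con 4 :+ (con 1 :+ m) :* (con 2 :+ s)) :+ (con 4 :+ (con 1 :+ m) :* (con 2 :+ s)))))) :+ con 25))) :+ con 2)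
  :+ ((con 2 :* m :+ m :* m) :* A :+ (con 22 :+ con 86 :* m :+ con 59 :* (m :* m)) :+ con 2 :* s :* ((con 1 :+ m) :* (con 1 :+ m))
      :+ (con 1 :+ m) :* (con 1 :+ m) :* A :* e :+ (con 37 :+ con 92 :* m :+ con 55 :* (m :* m)) :* e)
  := (con 1 :+ m) :* (con 1 :+ m) :* (A :+ con 59 :+ con 2 :* s) :* (con 1 :+ e)) refl A s m e))
  where
  open +-*-Solver

-- The 4 is the length of the last block of `interval`; `Z` is the coefficient in `interval-time-≤`
-- with `A` and `s` filled in.
overhead Z : ℕ
overhead = worst weigh + (worst range + 4)
Z        = overhead + 59 + 2 * worst split

-- The search for the best tree of one entry

module Algorithm (𝓡 : OrderedRing) (n m : ℕ) (m≤n : m ≤ n) (cmin cmaj : ℕ) (inp : ℕ → OrderedRing.Carrier 𝓡)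
  (inp≥0 : ∀ {a} → a ≤ 2 * n → OrderedRing._≤_ 𝓡 (OrderedRing.0# 𝓡) (inp a)) where

  open Order 𝓡
  open Semantics 𝓡
  open Store
  open Tables n

  C : Bool → Carrier
  C t = fromNat (if t then cmin else cmaj)

  open Costs 𝓡 inp C

  baseRegs : List (ℕ × ℕ)
  baseRegs = (%n , n) ∷ (%N , suc n) ∷ (%m , m) ∷ (%cmin , cmin) ∷ (%cmaj , cmaj) ∷ []

  Inputs : (ℕ → Carrier) → Set
  Inputs rm = ∀ {a} → a ≤ 2 * n → rm a ≡ inp a

  record Solved (mem : ℕ → ℕ) (i j k : ℕ) (c v : Carrier) : Set where
    field
      tree    : Tree i j
      count   : minors tree ≡ k
      encoded : Encodes mem tree
      value≈  : v ≈ cost c tree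
      optimal : ∀ (T : Tree i j) → minors T ≡ k → cost c tree ≤R cost c T

  -- Entries belong to nonempty intervals. They can be stated for the placeholder `0#` and reused
  -- below a parent of either colour.
  cost-parent : ∀ {i j} c c′ (T : Tree i j) → i < j → cost c T ≡ cost c′ T
  cost-parent c c′ leaf           i<i = ⊥-elim (<-irrefl refl i<i)
  cost-parent c c′ (node r t L R) i<j = refl

  Entry : (ℕ → ℕ) → (ℕ → Carrier) → ℕ → ℕ → ℕ → Set
  Entry mem rm i j k = Solved mem i j k 0# (rm (idx i j k))

  solved-parent : ∀ {mem i j k c v} c′ → i < j → Solved mem i j k c v → Solved mem i j k c′ v
  solved-parent {c = c} c′ i<j S = record
    { tree    = tree
    ; count   = count
    ; encoded = encoded
    ; value≈  = ≈-trans value≈ (≡⇒≈ (cost-parent c c′ tree i<j))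
    ; optimal = λ T eq → subst₂ _≤R_ (cost-parent c c′ tree i<j) (cost-parent c c′ T i<j) (optimal T eq)
    }
    where
    open Solved S

  run-value : ∀ {mem rm i j k σ} → Regs ((%I , i) ∷ (%J , j) ∷ (%K , k) ∷ baseRegs) σ →
    imem σ ≡ mem → rmem σ ≡ rm → Inputs rm → i ≤ j → j ≤ n → k + i ≤ j →
    (i < j → Entry mem rm i j k) →
    Run value σ (λ _ σ′ → Solved mem i j k (rreg σ $c) (rreg σ′ $v))
  run-value {mem} {i = i} {j} {k} {σ} (eI , eJ , eK , en , eN , _) refl refl inputs i≤j j≤n k+i≤j entry with <-≤-connex i j
  ... | inj₁ i<j = _ , _ , fails (λ J≤I → <⇒≱ i<j (subst₂ _≤_ eJ eI J≤I)) ops ,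
    subst (λ a → Solved mem i j k (rreg σ $c) (rmem σ a)) (sym (idx-cong en eI eN eJ eK))
      (solved-parent (rreg σ $c) i<j (entry i<j))
  ... | inj₂ j≤i with ≤-antisym i≤j j≤i
  ...   | refl = _ , _ , holds (≤-reflexive (trans eJ (sym eI))) ops , record
    { tree    = leaf
    ; count   = sym k≡0
    ; encoded = tt
    ; value≈  = O.*-cong (≡⇒≈ (trans (cong (λ a → rmem σ (2 * a)) eI) (inputs (*-monoʳ-≤ 2 j≤n)))) ≈-refl
    ; optimal = λ where
        leaf _             → ≤R-refl
        (node r t L R) _   → ⊥-elim (<-irrefl refl (≤-trans (s≤s (tree-≤ L)) (tree-≤ R)))
    }
    where
    k≡0 : k ≡ 0
    k≡0 = n≤0⇒n≡0 (+-cancelʳ-≤ j k 0 k+i≤j)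

  HasRoot : ∀ {i j} → ℕ → Bool → ℕ → Tree i j → Set
  HasRoot r t a leaf             = ⊥
  HasRoot r t a (node r′ t′ L R) = r′ ≡ r × t′ ≡ t × minors L ≡ a

  splitsTime rootTime : ℕ
  splitsTime = 4 + suc m * (2 + worst split)
  rootTime   = 8 + (splitsTime + splitsTime)

  rootsTime : ℕ → ℕ → ℕ
  rootsTime lo hi = 5 + (suc hi ∸ lo) * (2 + rootTime)

  Shorter : (ℕ → ℕ) → (ℕ → Carrier) → ℕ → ℕ → Set
  Shorter mem rm i j = ∀ {i′ j′ k′} → i ≤ i′ → j′ ≤ j → i < i′ ⊎ j′ < j → i′ < j′ → k′ ≤ m → k′ + i′ ≤ j′ → Entry mem rm i′ j′ k′

  module Interval (mem : ℕ → ℕ) (rm : ℕ → Carrier) (inputs : Inputs rm) (i j k lo hi : ℕ) (i<j : i < j) (j≤n : j ≤ n) (k≤m : k ≤ m)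
    (sub : Shorter mem rm i j) where

    record Candidate (r : ℕ) (t : Bool) (a : ℕ) (v : Carrier) : Set where
      field
        lo≤r     : lo ≤ r
        r≤hi     : r ≤ hi
        L        : Tree i r
        R        : Tree (suc r) j
        minorsˡ  : minors L ≡ a
        count    : bit t + (minors L + minors R) ≡ k
        encodedˡ : Encodes mem L
        encodedʳ : Encodes mem R
        value≈   : v ≈ cost 0# (node {i} {j} r t L R)

    candidate-≈ : ∀ {r t a v v′} → v′ ≈ v → Candidate r t a v → Candidate r t a v′
    candidate-≈ v′≈v cand = record
      { lo≤r = lo≤r ; r≤hi = r≤hi ; L = L ; R = R ; minorsˡ = minorsˡ ; count = count
      ; encodedˡ = encodedˡ ; encodedʳ = encodedʳ ; value≈ = ≈-trans v′≈v value≈ }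
      where
      open Candidate cand

    Bounds : (Tree i j → Set) → Carrier → Set
    Bounds P v = ∀ T → minors T ≡ k → P T → v ≤R cost 0# T

    record Champion (P : Tree i j → Set) (σ : Store) : Set where
      field
        {r}       : ℕ
        {t}       : Bool
        {a}       : ℕ
        best-r    : ireg σ %br ≡ r
        best-t    : ireg σ %bt ≡ bit t
        best-a    : ireg σ %ba ≡ a
        candidate : Candidate r t a (rreg σ $best)
        best      : Bounds P (rreg σ $best)

    -- `P` is the part of the search space examined so far, and the loops over colours, counts and
    -- roots only enlarge it. Without a champion, `P` must contain no tree with `k` marked nodes at
    -- all.
    Best : (Tree i j → Set) → Store → Set
    Best P σ = (ireg σ %has ≡ 0 × (∀ (T : Tree i j) → minors T ≡ k → ¬ P T)) ⊎ (ireg σ %has ≡ 1 × Champion P σ)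

    best-⊆ : ∀ {P Q : Tree i j → Set} {σ} → (∀ (T : Tree i j) → minors T ≡ k → Q T → P T) → Best P σ → Best Q σ
    best-⊆ Q⊆P (inj₁ (eq , none)) = inj₁ (eq , λ T mT q → none T mT (Q⊆P T mT q))
    best-⊆ Q⊆P (inj₂ (eq , ch))   = inj₂ (eq , record
      { best-r = best-r ; best-t = best-t ; best-a = best-a ; candidate = candidate
      ; best = λ T mT q → best T mT (Q⊆P T mT q) })
      where
      open Champion ch

    best-keep : ∀ {P : Tree i j → Set} {c σ t σ′} → Exec c σ t σ′ →
      {_ : T (keptBy c ((%has , 0) ∷ (%br , 0) ∷ (%bt , 0) ∷ (%ba , 0) ∷ []))} →
      {_ : T (everywhere (λ op → keepsRReg op $best) c)} →
      Best P σ → Best P σ′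
    best-keep {P} {c} {σ} {σ′ = σ′} e {ok} {okR} b
      with keepRegs e ((%has , ireg σ %has) ∷ (%br , ireg σ %br) ∷ (%bt , ireg σ %bt) ∷ (%ba , ireg σ %ba) ∷ [])
                      (refl , refl , refl , refl , tt) {ok}
         | keepR e $best {okR} | b
    ... | h , _ | _ | inj₁ (eq , none) = inj₁ (trans h eq , none)
    ... | h , hr , ht , ha , _ | hb | inj₂ (eq , ch) = inj₂ (trans h eq , record
      { best-r = trans hr best-r ; best-t = trans ht best-t ; best-a = trans ha best-a
      ; candidate = candidate-≈ (≡⇒≈ hb) candidate ; best = λ T mT p → subst (_≤R cost 0# T) (sym hb) (best T mT p) })
      where
      open Champion ch

    run-take : ∀ {P r t a σ} → Regs ((%r , r) ∷ (%t , bit t) ∷ (%a , a) ∷ []) σ →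
      Candidate r t a (rreg σ $cand) → Bounds (HasRoot r t a) (rreg σ $cand) → Bounds P (rreg σ $cand) →
      Run take σ (λ _ σ′ → Best (λ T → P T ⊎ HasRoot r t a T) σ′)
    run-take {σ = σ} (er , et , ea , _) cand least beats = _ , _ , ops , inj₂ (refl , record
      { best-r = er ; best-t = et ; best-a = ea ; candidate = candidate-≈ v≈ cand
      ; best = λ where
          T mT (inj₁ p) → ≤R-trans (≈⇒≤R v≈) (beats T mT p)
          T mT (inj₂ h) → ≤R-trans (≈⇒≤R v≈) (least T mT h) })
      where
      v≈ : 0# +R rreg σ $cand ≈ rreg σ $cand
      v≈ = O.+-identityˡ _

    run-decide : ∀ {P r t a σ} → Regs ((%r , r) ∷ (%t , bit t) ∷ (%a , a) ∷ []) σ →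
      Candidate r t a (rreg σ $cand) → Bounds (HasRoot r t a) (rreg σ $cand) → Best P σ →
      Run decide σ (λ _ σ′ → Best (λ T → P T ⊎ HasRoot r t a T) σ′)
    run-decide {P} regs cand least (inj₁ (has≡0 , none)) = run-ops (run-if
      (λ _ → run-take {P} regs cand least (λ T mT p → ⊥-elim (none T mT p)))
      (λ has≰0 → ⊥-elim (has≰0 (≤-reflexive has≡0))))
    run-decide {P} regs cand least (inj₂ (has≡1 , ch)) = run-ops (run-if
      (λ has≤0 → ⊥-elim (1+n≰n (subst (_≤ 0) has≡1 has≤0)))
      (λ _ → run-if
        (λ b≤c → run-skip (inj₂ (has≡1 , record
          { best-r = best-r ; best-t = best-t ; best-a = best-a ; candidate = candidate
          ; best = λ where
              T mT (inj₁ p) → best T mT p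
              T mT (inj₂ h) → ≤R-trans b≤c (least T mT h) })))
        (λ b≰c → run-take {P} regs cand least (λ T mT p → ≤R-trans (≰R⇒≥ b≰c) (best T mT p)))))
      where
      open Champion ch

    candRegs : ℕ → Bool → List (ℕ × ℕ)
    candRegs r t = (%r , r) ∷ (%t , bit t) ∷ (%i , i) ∷ (%j , j) ∷ (%k , k) ∷ baseRegs

    record Here (σ : Store) : Set where
      field
        imem≡ : imem σ ≡ mem
        rmem≡ : rmem σ ≡ rm
        w≈    : rreg σ $w ≈ W i j

    here-keep : ∀ {c σ u σ′} → Exec c σ u σ′ → {_ : T (everywhere keepsIMem c)} {_ : T (everywhere keepsRMem c)}
      {_ : T (everywhere (λ op → keepsRReg op $w) c)} →
      Here σ → Here σ′
    here-keep e {o₁} {o₂} {o₃} h = record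
      { imem≡ = trans (keepIM e {o₁}) imem≡ ; rmem≡ = trans (keepRM e {o₂}) rmem≡
      ; w≈ = ≈-trans (≡⇒≈ (keepR e $w {o₃})) w≈ }
      where
      open Here h

    -- The principle of optimality. With root, colour and left count fixed, the total `k` forces the
    -- right count, so the subtrees can be optimised separately. Both are solved for parent cost
    -- `C t`, which matters if one is a leaf.
    solved-candidate : ∀ {r t a b c vˡ vʳ v} → lo ≤ r → r ≤ hi → c ≡ C t → bit t + (a + b) ≡ k →
      Solved mem i r a c vˡ → Solved mem (suc r) j b c vʳ →
      v ≈ W i j *R C t +R vˡ +R vʳ → Candidate r t a v × Bounds (HasRoot r t a) v
    solved-candidate {r} {t} {a} {b} lo≤r r≤hi refl eq Sˡ Sʳ v≈ = record
      { lo≤r = lo≤r ; r≤hi = r≤hi ; L = L.tree ; R = R′.tree ; minorsˡ = L.count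
      ; count = trans (cong₂ (λ a b → bit t + (a + b)) L.count R′.count) eq
      ; encodedˡ = L.encoded ; encodedʳ = R′.encoded ; value≈ = v≈′ } , λ where
          (node r t L′ R″) mT (refl , refl , refl) → ≤R-trans (≈⇒≤R v≈′)
            (+R-mono-≤ (+R-mono-≤ ≤R-refl (L.optimal L′ refl))
              (R′.optimal R″ (+-cancelˡ-≡ (minors L′) _ _ (+-cancelˡ-≡ (bit t) _ _ (trans mT (sym eq))))))
      where
      module L = Solved Sˡ
      module R′ = Solved Sʳ
      v≈′ = ≈-trans v≈ (O.+-cong (O.+-cong ≈-refl L.value≈) R′.value≈)

    run-try : ∀ {P : Tree i j → Set} {r t a b σ} → Regs ((%a , a) ∷ (%b , b) ∷ candRegs r t) σ → Here σ → rreg σ $c ≡ C t → lo ≤ r → r ≤ hi →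
      i + a ≤ r → suc r + b ≤ j → bit t + (a + b) ≡ k → Best P σ →
      Run try σ (λ _ σ′ → Best (λ T → P T ⊎ HasRoot r t a T) σ′)
    run-try {P} {r} {t} {a} {b} {σ} regs@(ea , eb , er , et , ei , ej , ek , base) here c≡ lo≤r r≤hi i+a≤r r+b≤j eq best₀ =
      run-ops (run-seq (run-value (ei , er , ea , base) imem≡ rmem≡ inputs
                         i≤r (≤-trans (<⇒≤ r<j) j≤n) (subst (_≤ r) (+-comm i a) i+a≤r)
                         (λ i<r → sub ≤-refl (<⇒≤ r<j) (inj₂ r<j) i<r a≤m (subst (_≤ r) (+-comm i a) i+a≤r)))
      λ {σ₂} e₂ Sˡ → after-left σ₂ (ops ︔ e₂) (keepR e₂ $cand) Sˡ)
      where
      open Here here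
      tryRegs : List (ℕ × ℕ)
      tryRegs = (%a , a) ∷ (%b , b) ∷ candRegs r t
      i≤r : i ≤ r
      i≤r = ≤-trans (m≤m+n i a) i+a≤r
      r<j : r < j
      r<j = ≤-trans (m≤m+n (suc r) b) r+b≤j
      a≤m : a ≤ m
      a≤m = ≤-trans (≤-trans (≤-trans (m≤m+n a b) (m≤n+m (a + b) (bit t))) (≤-reflexive eq)) k≤m
      b≤m : b ≤ m
      b≤m = ≤-trans (≤-trans (≤-trans (m≤n+m b a) (m≤n+m (a + b) (bit t))) (≤-reflexive eq)) k≤m

      after-right : ∀ σ₄ {u vˡ} → Exec (ops left-args ︔ value ︔
          ops right-args ︔ value) σ u σ₄ →
        rreg σ₄ $cand ≡ (rreg σ $w *R rreg σ $c) +R vˡ → Solved mem i r a (rreg σ $c) vˡ →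
        Solved mem (suc r) j b (rreg σ₄ $c) (rreg σ₄ $v) →
        Run (ops (addR $cand $cand $v ∷ []) ︔ decide) σ₄ (λ _ σ′ → Best (λ T → P T ⊎ HasRoot r t a T) σ′)
      after-right σ₄ {vˡ = vˡ} e cand≡ Sˡ Sʳ with keepRegs e tryRegs regs
      ... | ea , eb , er , et , _ =
        let cand , least = solved-candidate lo≤r r≤hi c≡ eq Sˡ (subst (λ c → Solved mem (suc r) j b c (rreg σ₄ $v)) (keepR e $c) Sʳ)
              (O.+-cong (≈-trans (≡⇒≈ cand≡) (O.+-cong (O.*-cong w≈ (≡⇒≈ c≡)) ≈-refl)) ≈-refl)
        in run-ops (run-decide (er , et , ea , tt) cand least (best-keep (e ︔ ops {addR $cand $cand $v ∷ []}) best₀))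

      after-left : ∀ σ₂ {u} → Exec (ops left-args ︔ value) σ u σ₂ →
        rreg σ₂ $cand ≡ rreg σ $w *R rreg σ $c → Solved mem i r a (rreg σ $c) (rreg σ₂ $v) →
        Run (ops right-args ︔ value ︔ ops (addR $cand $cand $v ∷ []) ︔ decide)
          σ₂ (λ _ σ′ → Best (λ T → P T ⊎ HasRoot r t a T) σ′)
      after-left σ₂ (ops ︔ e₂) cand≡ Sˡ with keepRegs (ops {left-args} ︔ e₂) tryRegs regs
      ... | ea , eb , er , et , ei , ej , ek , base =
        run-ops (run-seq (run-value (cong suc er , ej , eb , base)
                            (trans (keepIM e₂) imem≡) (trans (keepRM e₂) rmem≡) inputs
                            r<j j≤n (subst (_≤ j) (+-comm (suc r) b) r+b≤j)
                            (λ r+1<j → sub (m≤n⇒m≤1+n i≤r) ≤-refl (inj₁ (s≤s i≤r)) r+1<j b≤m (subst (_≤ j) (+-comm (suc r) b) r+b≤j)))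
        λ {σ₄} e₄ Sʳ → after-right σ₄ (ops ︔ e₂ ︔ ops ︔ e₄)
          (trans (keepR e₄ $cand) (cong (_+R rreg σ₂ $v) cand≡)) Sˡ
          (subst (λ c → Solved mem (suc r) j b c (rreg σ₄ $v)) (sym (keepR e₄ $c)) Sʳ))

    RootBelow : ℕ → Bool → ℕ → Tree i j → Set
    RootBelow r t x leaf             = ⊥
    RootBelow r t x (node r′ t′ L R) = r′ ≡ r × t′ ≡ t × minors L < x

    RootColour : ℕ → Bool → Tree i j → Set
    RootColour r t leaf             = ⊥
    RootColour r t (node r′ t′ L R) = r′ ≡ r × t′ ≡ t

    RootIn : ℕ → Tree i j → Set
    RootIn x leaf           = ⊥
    RootIn x (node r t L R) = lo ≤ r × r < x

    module Split (B : Tree i j → Set) {r : ℕ} {t : Bool} (lo≤r : lo ≤ r) (r≤hi : r ≤ hi) (t≤k : bit t ≤ k) where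

      kk : ℕ
      kk = k ∸ bit t

      Below : ℕ → Tree i j → Set
      Below a T = B T ⊎ RootBelow r t a T

      count-right : ∀ {a b} → bit t + (a + b) ≡ k → b ≡ kk ∸ a
      count-right {a} {b} eq = sym (trans (cong (_∸ a) (trans (cong (_∸ bit t) (sym eq)) (m+n∸m≡n (bit t) (a + b)))) (m+n∸m≡n a b))

      extend-try : ∀ {a σ} → Best (λ T → Below a T ⊎ HasRoot r t a T) σ → Best (Below (suc a)) σ
      extend-try {a} = best-⊆ λ where
          T mT (inj₁ b) → inj₁ (inj₁ b)
          (node r t L R) mT (inj₂ (refl , refl , s≤s L≤a)) → case L R L≤a
        where
        case : ∀ (L : Tree i r) (R : Tree (suc r) j) → minors L ≤ a → Below a (node r t L R) ⊎ HasRoot r t a (node {i} {j} r t L R)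
        case L R L≤a with m≤n⇒m<n∨m≡n L≤a
        ... | inj₁ L<a = inj₁ (inj₂ (refl , refl , L<a))
        ... | inj₂ L≡a = inj₂ (refl , refl , L≡a)

      extend : ∀ {a σ} → (∀ (T : Tree i j) → minors T ≡ k → HasRoot r t a T → ⊥) → Best (Below a) σ → Best (Below (suc a)) σ
      extend impossible best = extend-try (best-⊆ (λ where
        T mT (inj₁ b) → b
        T mT (inj₂ h) → ⊥-elim (impossible T mT h)) best)

      Inv : ℕ → Store → Set
      Inv a σ = Regs ((%a , a) ∷ (%kk , kk) ∷ candRegs r t) σ × Here σ × rreg σ $c ≡ C t × Best (Below a) σ

      -- A failing test means, by `minors-bound`, that no tree has this root, colour and left count,
      -- so skipping the class loses nothing.
      run-guarded : ∀ {a σ} → a ≤ kk →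
        Regs ((%l , i + a) ∷ (%s , suc r + (kk ∸ a)) ∷ (%b , kk ∸ a) ∷ (%a , a) ∷ candRegs r t) σ →
        Here σ → rreg σ $c ≡ C t → Best (Below a) σ →
        Run (when (%l ≤ᴵ %r) (when (%s ≤ᴵ %j) try skip) skip) σ (λ _ σ′ → Best (Below (suc a)) σ′)
      run-guarded {a} {σ} a≤kk (el , es , eb , ea , er , et , ei , ej , eks) here c≡ best =
        run-if
          (λ l≤r → run-if
            (λ s≤j → run-map (run-try {Below a} (ea , eb , er , et , ei , ej , eks) here c≡ lo≤r r≤hi
                               (subst₂ _≤_ el er l≤r) (subst₂ _≤_ es ej s≤j)
                               (trans (cong (bit t +_) (m+[n∸m]≡n a≤kk)) (m+[n∸m]≡n t≤k)) best)
                        (λ _ → extend-try))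
            (λ s≰j → run-skip (extend (λ where
              (node r t L R) mT (refl , refl , refl) →
                s≰j (subst₂ _≤_ (trans (+-comm (minors R) (suc r)) (trans (cong (suc r +_) (count-right mT)) (sym es))) (sym ej) (minors-bound R))) best)))
          (λ l≰r → run-skip (extend (λ where
              (node r t L R) mT (refl , refl , refl) →
                l≰r (subst₂ _≤_ (trans (+-comm (minors L) i) (sym el)) (sym er) (minors-bound L))) best))

      run-split : ∀ {a σ} → a ≤ kk → Inv a σ → Run split σ (λ u σ′ → u ≤ worst split × Inv (suc a) σ′)
      run-split {a} {σ} a≤kk (regs@(ea , ekk , er , et , ei , rest) , here , c≡ , best) = run-map {Q = λ _ σ′ → Best (Below (suc a)) σ′}
        (run-ops (run-seq (run-guarded a≤kk
            (cong₂ _+_ ei ea , cong₂ _+_ (cong suc er) (cong₂ _∸_ ekk ea) , cong₂ _∸_ ekk ea , ea , er , et , ei , rest)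
            (here-keep e₁ here) c≡ (best-keep e₁ best))
          λ {σ₂} e₂ b → run-skip (best-keep (ops {inc %a}) b)))
        λ { e@(ops ︔ e₂ ︔ ops) b → time e ,
              (cong suc (trans (keepI e₂ %a) ea) , keepRegs e ((%kk , kk) ∷ candRegs r t) (ekk , er , et , ei , rest)) ,
              here-keep e here , trans (keepR e $c) c≡ , b }
        where
        e₁ = ops {feasibility} {σ}

      run-splits : ∀ {σ} → Regs (candRegs r t) σ → Here σ → rreg σ $c ≡ C t → Best B σ →
        Run splits σ (λ u σ′ → u ≤ 4 + suc m * (2 + worst split) × Best (λ T → B T ⊎ RootColour r t T) σ′)
      run-splits {σ} regs@(er , et , ei , ej , ek , base) here c≡ best = run-ops
        (run-map (run-for Inv (worst split) (λ where ((ea , ekk , _) , _) → ea , ekk) run-split (suc kk) refl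
            ((refl , cong₂ _∸_ ek et , regs) , here-keep e₁ here , c≡ , best-⊆ (λ where
                T mT (inj₁ b) → b
                (node _ _ _ _) mT (inj₂ (_ , _ , ()))) (best-keep e₁ best)))
          λ { e (u≤ , _ , _ , _ , b) →
            +-monoʳ-≤ 2 (≤-trans u≤ (≤-trans (≤-reflexive (+-comm _ 2)) (+-monoʳ-≤ 2 (*-monoˡ-≤ (2 + worst split) (s≤s (≤-trans (m∸n≤m k (bit t)) k≤m)))))) ,
            best-⊆ (λ where
              T mT (inj₁ b) → inj₁ b
              (node r t L R) mT (inj₂ (refl , refl)) → inj₂ (refl , refl , s≤s (count-left mT))) b })
        where
        e₁ = ops {subI %kk %k %t ∷ setI %a 0 ∷ []} {σ}
        count-left : ∀ {a b} → bit t + (a + b) ≡ k → a ≤ kk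
        count-left {a} {b} eq = subst (a ≤_) (trans (sym (m+n∸m≡n (bit t) (a + b))) (cong (_∸ bit t) eq)) (m≤m+n a b)

    rootRegs : ℕ → List (ℕ × ℕ)
    rootRegs r = (%r , r) ∷ (%hi , hi) ∷ (%i , i) ∷ (%j , j) ∷ (%k , k) ∷ baseRegs

    RootInv : ℕ → Store → Set
    RootInv r σ = Regs (rootRegs r) σ × Here σ × lo ≤ r × Best (RootIn r) σ

    run-minor-root : ∀ {r σ} → lo ≤ r → r ≤ hi → Regs ((%t , 1) ∷ rootRegs r) σ → Here σ → rreg σ $c ≡ C true →
      Best (λ T → RootIn r T ⊎ RootColour r false T) σ →
      Run (when (%t ≤ᴵ %k) splits skip) σ (λ u σ′ → u ≤ 2 + splitsTime × Best (RootIn (suc r)) σ′)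
    run-minor-root {r} {σ} lo≤r r≤hi (et , er , ehi , ei , ej , ek , base) here c≡ best = run-if
      (λ t≤k → run-map (Split.run-splits (λ T → RootIn r T ⊎ RootColour r false T) lo≤r r≤hi (subst₂ _≤_ et ek t≤k)
                          (er , et , ei , ej , ek , base) here c≡ best)
        λ { _ (u≤ , b) → s≤s (m≤n⇒m≤1+n u≤) , best-⊆ (λ { (node s t L R) mT (lo≤s , s≤s s≤r) → case₁ s t L R (m≤n⇒m<n∨m≡n s≤r) lo≤s }) b })
      (λ t≰k → run-skip (s≤s (s≤s z≤n) , best-⊆ (λ { (node s t L R) mT (lo≤s , s≤s s≤r) → case₂ s t L R mT (λ 1≤k → t≰k (subst₂ _≤_ (sym et) (sym ek) 1≤k)) (m≤n⇒m<n∨m≡n s≤r) lo≤s }) best))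
      where
      case₁ : ∀ s t (L : Tree i s) (R : Tree (suc s) j) → s < r ⊎ s ≡ r → lo ≤ s →
        (RootIn r (node s t L R) ⊎ RootColour r false (node {i} {j} s t L R)) ⊎ RootColour r true (node {i} {j} s t L R)
      case₁ s t     L R (inj₁ s<r)  lo≤s = inj₁ (inj₁ (lo≤s , s<r))
      case₁ s false L R (inj₂ refl) lo≤s = inj₁ (inj₂ (refl , refl))
      case₁ s true  L R (inj₂ refl) lo≤s = inj₂ (refl , refl)
      case₂ : ∀ s t (L : Tree i s) (R : Tree (suc s) j) → bit t + (minors L + minors R) ≡ k → ¬ 1 ≤ k → s < r ⊎ s ≡ r → lo ≤ s →
        RootIn r (node s t L R) ⊎ RootColour r false (node {i} {j} s t L R)
      case₂ s t     L R mT ¬1≤k (inj₁ s<r)  lo≤s = inj₁ (lo≤s , s<r)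
      case₂ s false L R mT ¬1≤k (inj₂ refl) lo≤s = inj₂ (refl , refl)
      case₂ s true  L R mT ¬1≤k (inj₂ refl) lo≤s = ⊥-elim (¬1≤k (subst (1 ≤_) mT (s≤s z≤n)))

    run-root : ∀ {r σ} → r ≤ hi → RootInv r σ → Run root σ (λ u σ′ → u ≤ rootTime × RootInv (suc r) σ′)
    run-root {r} {σ} r≤hi (regs@(er , ehi , ei , ej , ek , en , eN , em , emin , emaj , _) , here , lo≤r , best) =
      run-map {Q = λ u σ′ → u ≤ rootTime × Best (RootIn (suc r)) σ′} (run-ops (run-seq
        (Split.run-splits (RootIn r) {t = false} lo≤r r≤hi z≤n (er , refl , ei , ej , ek , en , eN , em , emin , emaj , tt)
          (here-keep e₁ here) (cong fromNat emaj) (best-keep e₁ best))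
        λ { {σ₂} e₂ (u₂≤ , b₂) → run-ops (rest σ₂ e₂ u₂≤ b₂) }))
      λ { e@(ops ︔ e₂ ︔ ops ︔ e₃ ︔ ops) (u≤ , b) → u≤ ,
          (cong suc (trans (keepI (e₂ ︔ ops {minor-root} ︔ e₃) %r) er) ,
           keepRegs e ((%hi , hi) ∷ (%i , i) ∷ (%j , j) ∷ (%k , k) ∷ baseRegs) (ehi , ei , ej , ek , en , eN , em , emin , emaj , tt)) ,
          here-keep e here , m≤n⇒m≤1+n lo≤r , b }
      where
      e₁ = ops {major-root} {σ}
      rest : ∀ σ₂ {u₂} → Exec splits (execOps major-root σ) u₂ σ₂ → u₂ ≤ splitsTime →
        Best (λ T → RootIn r T ⊎ RootColour r false T) σ₂ →
        Run (when (%t ≤ᴵ %k) splits skip ︔ ops (inc %r)) (execOps minor-root σ₂)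
          (λ u σ′ → 2 + (u₂ + (2 + u)) ≤ rootTime × Best (RootIn (suc r)) σ′)
      rest σ₂ {u₂} e₂ u₂≤ b₂ with keepRegs (e₁ ︔ e₂) (rootRegs r) regs
      ... | regs₂@(_ , _ , _ , _ , _ , _ , _ , _ , emin , _) = run-seq
        (run-minor-root lo≤r r≤hi (refl , regs₂) (here-keep (e₁ ︔ e₂ ︔ ops {minor-root}) here)
          (cong fromNat emin) (best-keep (ops {minor-root}) b₂))
        λ { {σ₃} {u₃} e₃ (u₃≤ , b₃) → run-skip (
              time≤ u₂≤ u₃≤ ,
              best-keep (ops {inc %r}) b₃) }
        where
        time≤ : ∀ {u₂ u₃} → u₂ ≤ splitsTime → u₃ ≤ 2 + splitsTime → 2 + (u₂ + (2 + (u₃ + 2))) ≤ rootTime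
        time≤ {u₂} {u₃} p q = begin
          2 + (u₂ + (2 + (u₃ + 2)))                       ≤⟨ +-monoʳ-≤ 2 (+-mono-≤ p (+-monoʳ-≤ 2 (+-monoˡ-≤ 2 q))) ⟩
          2 + (splitsTime + (2 + (2 + splitsTime + 2)))   ≡⟨ lemma splitsTime ⟩
          rootTime                                        ∎
          where
          open ≤-Reasoning
          open +-*-Solver
          lemma : ∀ x → 2 + (x + (2 + (2 + x + 2))) ≡ 8 + (x + x)
          lemma = solve 1 (λ x → con 2 :+ (x :+ (con 2 :+ (con 2 :+ x :+ con 2))) := con 8 :+ (x :+ x)) refl

    run-roots : ∀ {σ} → lo ≤ suc hi → Regs ((%lo , lo) ∷ (%hi , hi) ∷ (%i , i) ∷ (%j , j) ∷ (%k , k) ∷ baseRegs) σ → Here σ →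
      Run roots σ (λ u σ′ → u ≤ rootsTime lo hi × Best (RootIn (suc hi)) σ′)
    run-roots {σ} lo≤ (elo , regs) here = run-ops (run-map
      (run-for RootInv rootTime (λ where ((er , ehi , _) , _) → er , ehi) run-root (suc hi ∸ lo) (m+[n∸m]≡n lo≤)
        ((elo , regs) , here-keep e₁ here , ≤-refl , inj₁ (refl , λ { (node r t L R) mT (lo≤r , r<lo) → <⇒≱ r<lo lo≤r })))
      λ { _ (u≤ , _ , _ , _ , b) → ≤-trans (+-monoʳ-≤ 3 u≤) (≤-reflexive (trans (cong (3 +_) (+-comm _ 2)) refl)) , b })
      where
      e₁ = ops {setI %has 0 ∷ mov %r %lo} {σ}

  open Agree

  inputs-agree : ∀ {X mem rm mem′ rm′} → suc n * suc n ≤ X → Agree X mem rm mem′ rm′ → Inputs rm → Inputs rm′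
  inputs-agree N*N≤X A inputs a≤2n = trans (numbers A (≤-<-trans a≤2n (<-≤-trans 2n<N*N N*N≤X))) (inputs a≤2n)

  entry-agree : ∀ {X mem rm mem′ rm′ i j k} → Agree X mem rm mem′ rm′ → j ≤ n → idx i j k < X →
                Entry mem rm i j k → Entry mem′ rm′ i j k
  entry-agree {X} {i = i} {j} {k} A j≤n p E = record
    { tree    = tree
    ; count   = count
    ; encoded = encodes-agree {lower = 0} (λ f<3 _ → records A f<3) z≤n tree j≤n (subst (λ k → idx i j k < X) (sym count) p) encoded
    ; value≈  = ≈-trans (≡⇒≈ (numbers A p)) value≈
    ; optimal = optimal }
    where
    open Solved E

  -- 25 is the length of store.
  entryTime entriesTime : ℕ → ℕ → ℕ
  entryTime lo hi   = rootsTime lo hi + 25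
  entriesTime lo hi = 3 + suc m * (2 + entryTime lo hi)

  -- A search range must provide, for every tree, one no dearer whose root is in range. Nothing is
  -- asked about where the other optimal roots lie.
  RootedIn : (i j lo hi k : ℕ) → Carrier → Set
  RootedIn i j lo hi k bound = Σ ℕ λ r → Σ Bool λ t → Σ (Tree i r) λ L → Σ (Tree (suc r) j) λ R →
    minors (node {i} {j} r t L R) ≡ k × lo ≤ r × r ≤ hi × cost 0# (node {i} {j} r t L R) ≤R bound

  module Fill (i j lo hi kmax : ℕ) (i<j : i < j) (j≤n : j ≤ n) (i≤lo : i ≤ lo) (lo≤hi : lo ≤ hi) (hi<j : hi < j)
    (kmax≤m : kmax ≤ m) (kmax+i≤j : kmax + i ≤ j)
    (dominated : ∀ {k} → k ≤ kmax → (T : Tree i j) → minors T ≡ k →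
                 RootedIn i j lo hi k (cost 0# T))
    (mem : ℕ → ℕ) (rm : ℕ → Carrier) (inputs : Inputs rm)
    (sub : Shorter mem rm i j) where

    intervalRegs : List (ℕ × ℕ)
    intervalRegs = (%lo , lo) ∷ (%hi , hi) ∷ (%i , i) ∷ (%j , j) ∷ baseRegs

    -- When `m ≡ 0` there is one entry per interval, and this identifies `%br` with its stored root.
    -- The bounds by `lo` and `hi` yield the monotonicity of roots and the next search range.
    LastRoot : ℕ → Store → Set
    LastRoot zero    σ = ⊤
    LastRoot (suc k) σ = imem σ (cell 0 (idx i j k)) ≡ ireg σ %br × lo ≤ ireg σ %br × ireg σ %br ≤ hi

    record EntriesInv (k : ℕ) (σ : Store) : Set where
      field
        regs   : Regs ((%k , k) ∷ (%kmax , kmax) ∷ intervalRegs) σ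
        w≈     : rreg σ $w ≈ W i j
        below  : Agree (idx i j 0) mem rm (imem σ) (rmem σ)
        filled : ∀ {k′} → k′ < k → Entry (imem σ) (rmem σ) i j k′
        last   : LastRoot k σ

    run-entry : ∀ {k σ} → k ≤ kmax → EntriesInv k σ → Run entry σ (λ u σ′ → u ≤ entryTime lo hi × EntriesInv (suc k) σ′)
    run-entry {k} {σ} k≤kmax inv = go regs
      where
      open EntriesInv inv
      k≤m = ≤-trans k≤kmax kmax≤m
      k≤n = ≤-trans k≤m m≤n
      i≤n = ≤-trans (<⇒≤ i<j) j≤n
      module Int = Interval (imem σ) (rmem σ) (inputs-agree (N*N≤idx i j 0) below inputs) i j k lo hi i<j j≤n k≤m
        (λ p q s i′<j′ k′≤m f → entry-agree below (≤-trans q j≤n)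
          (idx-sub p q s (≤-trans (<⇒≤ i′<j′) (≤-trans q j≤n)) (≤-trans q j≤n) (≤-trans k′≤m m≤n)) (sub p q s i′<j′ k′≤m f))
      open Int using (Best; Champion; RootIn; run-roots)

      finish : ∀ {u σ₁} → Exec roots σ u σ₁ → u ≤ rootsTime lo hi → Champion (RootIn (suc hi)) σ₁ →
        Regs ((%n , n) ∷ (%N , suc n) ∷ (%i , i) ∷ (%j , j) ∷ (%k , k) ∷ []) σ₁ →
        Run (ops store) σ₁ (λ v σ′ → u + v ≤ entryTime lo hi × Entry (imem σ′) (rmem σ′) i j k × Agree (idx i j k) (imem σ) (rmem σ) (imem σ′) (rmem σ′) ×
          imem σ′ (cell 0 (idx i j k)) ≡ ireg σ′ %br × lo ≤ ireg σ′ %br × ireg σ′ %br ≤ hi × ireg σ′ %k ≡ suc k)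
      finish {u} {σ₁} e u≤ ch (en , eN , ei , ej , ek , _) = run-skip (
        +-monoˡ-≤ 25 u≤ ,
        subst (λ a → Facts a) (sym a≡) facts)
        where
        open Champion ch hiding (a)
        open Int.Candidate candidate
        x = ireg σ₁ %br
        y = ireg σ₁ %bt
        z = ireg σ₁ %ba
        a₁ = (suc (ireg σ₁ %n ∸ ireg σ₁ %i) * ireg σ₁ %N + ireg σ₁ %j) * ireg σ₁ %N + ireg σ₁ %k
        a = idx i j k
        a≡ : a₁ ≡ a
        a≡ = idx-cong en ei eN ej ek
        Facts : ℕ → Set
        Facts a = let mem′ = written (imem σ₁) a x y z ; rm′ = rmem σ₁ [ a ↦ rreg σ₁ $best ] in
          Entry mem′ rm′ i j k × Agree (idx i j k) (imem σ) (rmem σ) mem′ rm′ ×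
          mem′ (cell 0 (idx i j k)) ≡ x × lo ≤ x × x ≤ hi × suc (ireg σ₁ %k) ≡ suc k
        same : ∀ {f b} → f < 3 → b < a → written (imem σ₁) a x y z (cell f b) ≡ imem σ (cell f b)
        same f<3 b<a = trans (written-≢ (imem σ₁) a x y z f<3 (<⇒≢ b<a)) (cong (λ m → m _) (keepIM e))
        i≤r = tree-≤ L
        r<j = tree-≤ R
        r≤n = ≤-trans (<⇒≤ r<j) j≤n
        facts : Facts a
        facts = record
            { tree    = node r t L R
            ; count   = count
            ; encoded =
                trans (cong (λ k → written (imem σ₁) a x y z (cell 0 (idx i j k))) count) (trans (written-0 (imem σ₁) a x y z) best-r) ,
                trans (cong (λ k → written (imem σ₁) a x y z (cell 1 (idx i j k))) count) (trans (written-1 (imem σ₁) a x y z) best-t) ,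
                trans (cong (λ k → written (imem σ₁) a x y z (cell 2 (idx i j k))) count) (trans (written-2 (imem σ₁) a x y z) (trans best-a (sym minorsˡ))) ,
                encodes-agree {lower = 0} (λ f<3 _ → same f<3) z≤n L r≤n
                  (idx-sub {i} {i} {j} {r} ≤-refl (<⇒≤ r<j) (inj₂ r<j) (≤-trans i≤r r≤n) r≤n (minors-≤ L r≤n)) encodedˡ ,
                encodes-agree {lower = 0} (λ f<3 _ → same f<3) z≤n R j≤n
                  (idx-sub {i} {suc r} {j} {j} (m≤n⇒m≤1+n i≤r) ≤-refl (inj₁ (s≤s i≤r)) (≤-trans r<j j≤n) j≤n (minors-≤ R j≤n)) encodedʳ
            ; value≈  = ≈-trans (≡⇒≈ (update-≡ (rmem σ₁) a (rreg σ₁ $best) refl)) value≈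
            ; optimal = λ T mT → let r′ , t′ , L′ , R′ , mT′ , lo≤r′ , r′≤hi , c≤ = dominated k≤kmax T mT in
                ≤R-trans (≈⇒≤R (≈-sym value≈)) (≤R-trans (best (node r′ t′ L′ R′) mT′ (lo≤r′ , s≤s r′≤hi)) c≤) } ,
          agree same (λ b<a → trans (update-≢ (rmem σ₁) a (rreg σ₁ $best) (<⇒≢ b<a)) (cong (λ m → m _) (keepRM e))) ,
          written-0 (imem σ₁) a x y z , subst (lo ≤_) (sym best-r) lo≤r , subst (_≤ hi) (sym best-r) r≤hi , cong suc ek

      champion : ∀ {σ₁} → Best (RootIn (suc hi)) σ₁ → Champion (RootIn (suc hi)) σ₁
      champion (inj₂ (_ , ch)) = ch
      -- The search cannot end empty-handed: a tree with `k` marked nodes exists, and domination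
      -- supplies one with its root in range.
      champion (inj₁ (_ , none)) =
        let T , mT = tree-with {i} {j} {k} (≤-trans (+-monoˡ-≤ i k≤kmax) kmax+i≤j)
            r , t , L , R , mT′ , lo≤r , r≤hi , _ = dominated k≤kmax T mT
        in ⊥-elim (none (node r t L R) mT′ (lo≤r , s≤s r≤hi))

      go : Regs ((%k , k) ∷ (%kmax , kmax) ∷ intervalRegs) σ → Run entry σ (λ u σ′ → u ≤ entryTime lo hi × EntriesInv (suc k) σ′)
      go (ek , ekmax , elo , ehi , ei , ej , en , eN , em , base) = run-map
        {Q = λ u σ′ → u ≤ entryTime lo hi × Entry (imem σ′) (rmem σ′) i j k × Agree (idx i j k) (imem σ) (rmem σ) (imem σ′) (rmem σ′) ×
          imem σ′ (cell 0 (idx i j k)) ≡ ireg σ′ %br × lo ≤ ireg σ′ %br × ireg σ′ %br ≤ hi × ireg σ′ %k ≡ suc k}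
        (run-seq (run-roots (m≤n⇒m≤1+n lo≤hi) (elo , ehi , ei , ej , ek , en , eN , em , base)
                   (record { imem≡ = refl ; rmem≡ = refl ; w≈ = w≈ }))
          λ e (u≤ , b) → finish e u≤ (champion b)
            (keepRegs e ((%n , n) ∷ (%N , suc n) ∷ (%i , i) ∷ (%j , j) ∷ (%k , k) ∷ []) (en , eN , ei , ej , ek , tt)))
        λ { {σ′} e (u≤ , E , A , er , lo≤ , ≤hi , ek′) → u≤ , record
          { regs   = ek′ , keepRegs e ((%kmax , kmax) ∷ intervalRegs) (ekmax , elo , ehi , ei , ej , en , eN , em , base)
          ; w≈     = ≈-trans (≡⇒≈ (keepR e $w)) w≈
          ; below  = agree-trans below (agree-≤ (+-monoʳ-≤ ((suc (n ∸ i) * suc n + j) * suc n) z≤n) A)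
          ; filled = λ k′<1+k → fill {σ′} E A (m≤n⇒m<n∨m≡n (≤-pred k′<1+k))
          ; last   = er , lo≤ , ≤hi } }
        where
        fill : ∀ {σ′ k′} → Entry (imem σ′) (rmem σ′) i j k → Agree (idx i j k) (imem σ) (rmem σ) (imem σ′) (rmem σ′) →
               k′ < k ⊎ k′ ≡ k → Entry (imem σ′) (rmem σ′) i j k′
        fill E A (inj₁ k′<k) = entry-agree A j≤n (+-monoʳ-< ((suc (n ∸ i) * suc n + j) * suc n) k′<k) (filled k′<k)
        fill E A (inj₂ refl) = E

    run-entries : ∀ {σ} → Regs ((%kmax , kmax) ∷ intervalRegs) σ → rreg σ $w ≈ W i j → imem σ ≡ mem → rmem σ ≡ rm →
      Run entries σ (λ u σ′ → u ≤ entriesTime lo hi × EntriesInv (suc kmax) σ′)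
    run-entries {σ} regs w≈ refl refl = run-ops (run-map
      (run-for EntriesInv (entryTime lo hi) (λ inv → let ek , ekmax , _ = EntriesInv.regs inv in ek , ekmax) run-entry (suc kmax) {0} refl
        (record { regs = refl , regs ; w≈ = w≈ ; below = agree-refl ; filled = λ () ; last = tt }))
      λ { _ (u≤ , inv) → s≤s (≤-trans u≤ (≤-trans (+-monoˡ-≤ 2 (*-monoˡ-≤ (2 + entryTime lo hi) (s≤s kmax≤m))) (≤-reflexive (+-comm _ 2)))) , inv })

  -- Search ranges of the one-level case and the time of a row

  open Exchange n inp≥0 (fromNat-nonNegative cmaj) renaming (d to c₀)

  -- The stored root for count 0; on the diagonal it is the fictitious root `i ∸ 1`.
  K : (ℕ → ℕ) → ℕ → ℕ → ℕ
  K mem i j = mem (cell 0 (idx i j 0))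

  record Dominating (i j lo hi kmax : ℕ) : Set where
    field
      i≤lo      : i ≤ lo
      lo≤hi     : lo ≤ hi
      hi<j      : hi < j
      dominated : ∀ {k} → k ≤ kmax → (T : Tree i j) → minors T ≡ k →
                 RootedIn i j lo hi k (cost 0# T)

  all-roots : ∀ {i j kmax} → i < j → Dominating i j i (j ∸ 1) kmax
  all-roots {i} {suc j} (s≤s i≤j) = record
    { i≤lo = ≤-refl ; lo≤hi = i≤j ; hi<j = ≤-refl
    ; dominated = λ where
        k≤ leaf mT → ⊥-elim (<-irrefl refl i≤j)
        k≤ (node r t L R) mT → r , t , L , R , mT , tree-≤ L , ≤-pred (tree-≤ R) , ≤R-refl }

  record OptimalRoot (i j r : ℕ) : Set where
    field
      {left}      : Tree i r
      {right}     : Tree (suc r) j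
      left-plain  : Plain left
      right-plain : Plain right
      optimal     : Optimal c₀ (node {i} {j} r false left right)

  entry-root : ∀ {mem rm i j} → i < j → Entry mem rm i j 0 → OptimalRoot i j (K mem i j)
  entry-root {mem} {rm} {i} {j} i<j E with Solved.tree E | Solved.count E | Solved.encoded E | Solved.optimal E
  ... | leaf | _ | _ | _ = ⊥-elim (<-irrefl refl i<j)
  ... | node r false L R | count | er , _ | opt = subst (OptimalRoot i j) (trans (sym er) (cong (λ k → mem (cell 0 (idx i j k))) count)) (record
    { left = L ; right = R ; left-plain = proj₁ plain ; right-plain = proj₂ plain
    ; optimal = λ T mT → ≤R-trans (opt T (trans mT count)) (≈⇒≤R (≡⇒≈ (cost-parent 0# c₀ T i<j))) })
    where
    plain = minors⇒plain (node {i} {j} r false L R) count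

  knuth-base : ∀ {i} → Dominating i (suc i) i i 0
  knuth-base {i} = all-roots ≤-refl

  -- A root left of `lo` is replaced by `lo` itself through `root-≥`, one right of `hi` by `hi`
  -- through `root-≤`. That the replacement lies in the range is the hypothesis `lo ≤ hi`.
  knuth-step : ∀ {i j lo hi} → i < j → suc j ≤ n → lo ≤ hi → OptimalRoot i j lo → OptimalRoot (suc i) (suc j) hi →
               Dominating i (suc j) lo hi 0
  knuth-step {i} {j} {lo} {hi} i<j j<n lo≤hi A B = record
    { i≤lo = tree-≤ A.left ; lo≤hi = lo≤hi ; hi<j = tree-≤ B.right
    ; dominated = λ where
        k≤ leaf mT → ⊥-elim (<-irrefl refl (<-trans i<j ≤-refl))
        z≤n (node r t L R) mT → case r t L R mT (minors⇒plain (node r t L R) mT) (<-≤-connex r lo) (<-≤-connex hi r) }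
    where
    module A = OptimalRoot A
    module B = OptimalRoot B
    case : ∀ r t (L : Tree i r) (R : Tree (suc r) (suc j)) → minors (node {i} {suc j} r t L R) ≡ 0 → Plain (node {i} {suc j} r t L R) →
      r < lo ⊎ lo ≤ r → hi < r ⊎ r ≤ hi →
      RootedIn i (suc j) lo hi 0 (cost 0# (node {i} {suc j} r t L R))
    case r false L R mT (pL , pR) (inj₁ r<lo) _
      with root-≥ A.left A.right L R A.left-plain A.right-plain pL pR A.optimal (<⇒≤ r<lo) j<n
    ... | rooted {X} {Y} pX pY c≤ = lo , false , X , Y , plain⇒minors (node {i} {suc j} lo false X Y) (pX , pY) , ≤-refl , lo≤hi , c≤
    case r false L R mT (pL , pR) (inj₂ lo≤r) (inj₁ hi<r)
      with root-≤ B.left B.right L R B.left-plain B.right-plain pL pR B.optimal (<⇒≤ hi<r) j<n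
    ... | rooted {X} {Y} pX pY c≤ = hi , false , X , Y , plain⇒minors (node {i} {suc j} hi false X Y) (pX , pY) , lo≤hi , ≤-refl , c≤
    case r t L R mT _ (inj₂ lo≤r) (inj₂ r≤hi) = r , t , L , R , mT , lo≤r , r≤hi , ≤R-refl

  RowsDone : (ℕ → ℕ) → (ℕ → Carrier) → ℕ → Set
  RowsDone mem rm i₀ = ∀ {i j k} → i₀ ≤ i → i < j → j ≤ n → k ≤ m → k + i ≤ j → Entry mem rm i j k

  ColsDone : (ℕ → ℕ) → (ℕ → Carrier) → ℕ → ℕ → Set
  ColsDone mem rm i j₀ = ∀ {j k} → i < j → j < j₀ → k ≤ m → k + i ≤ j → Entry mem rm i j k

  rowSum : (ℕ → ℕ) → ℕ → ℕ → ℕ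
  rowSum mem i zero    = 0
  rowSum mem i (suc d) = rowSum mem i d + K mem i (i + d)

  rowSum-cong : ∀ {mem mem′ i} d → (∀ {e} → e < d → K mem′ i (i + e) ≡ K mem i (i + e)) → rowSum mem′ i d ≡ rowSum mem i d
  rowSum-cong zero    eq = refl
  rowSum-cong (suc d) eq = cong₂ _+_ (rowSum-cong d (λ e<d → eq (m≤n⇒m≤1+n e<d))) (eq ≤-refl)

  -- An invariant of the one-level case m ≡ 0 only.
  record RowRoots (mem : ℕ → ℕ) (i j₀ : ℕ) : Set where
    field
      diagonal : K mem i i ≡ i ∸ 1
      mono     : ∀ {j} → i ≤ j → suc j < j₀ → K mem i j ≤ K mem i (suc j)

  W-step : ∀ i j → (W i j +R inp (suc (2 * j))) +R inp (2 * suc j) ≈ W i (suc j)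
  W-step i j = ≈-trans (R-Solver.solve 4 (λ p q b c → ((((p ⊕ q) ⊕ b) ⊕ c)) ⊜ (((p ⊕ b) ⊕ c) ⊕ q)) ≈-refl
      (prefix (suc (2 * j))) (O.- prefix (2 * i)) (inp (suc (2 * j))) (inp (2 * suc j)))
    (O.+-cong (≈-trans (O.+-cong ≈-refl (≡⇒≈ (cong inp (*-suc 2 j))))
                       (≡⇒≈ (cong (λ a → prefix (suc a)) (sym (*-suc 2 j))))) ≈-refl)
    where
    open R-Solver

  run-weigh : ∀ {i j σ} → Regs ((%i , i) ∷ (%j , suc j) ∷ baseRegs) σ → Inputs (rmem σ) → suc j ≤ n → rreg σ $w ≈ W i j →
    Run weigh σ (λ _ σ′ → ireg σ′ %kmax ≡ m ⊓ (suc j ∸ i) × rreg σ′ $w ≈ W i (suc j))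
  run-weigh {i} {j} {σ} (ei , ej , en , eN , em , _) inputs j<n w≈ = run-ops (run-if
    (λ m≤ → run-skip (trans em (sym (m≤n⇒m⊓n≡m (subst₂ _≤_ em (cong₂ _∸_ ej ei) m≤))) , w′))
    (λ m≰ → run-skip (trans (cong₂ _∸_ ej ei) (sym (m≥n⇒m⊓n≡n (<⇒≤ (≰⇒> (λ m≤ → m≰ (subst₂ _≤_ (sym em) (sym (cong₂ _∸_ ej ei)) m≤)))))) , w′)))
    where
    q-at : rmem σ (2 * ireg σ %j) ≡ inp (2 * suc j)
    q-at = trans (cong (λ a → rmem σ (2 * a)) ej) (inputs (*-monoʳ-≤ 2 j<n))
    p-at : rmem σ (2 * ireg σ %j ∸ 1) ≡ inp (suc (2 * j))
    p-at = trans (cong (rmem σ) (trans (cong (λ a → 2 * a ∸ 1) ej) (cong (_∸ 1) (*-suc 2 j))))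
      (inputs (≤-trans (n≤1+n _) (≤-trans (≤-reflexive (sym (*-suc 2 j))) (*-monoʳ-≤ 2 j<n))))
    w′ : (rreg σ $w +R rmem σ (2 * ireg σ %j ∸ 1)) +R rmem σ (2 * ireg σ %j) ≈ W i (suc j)
    w′ = ≈-trans (O.+-cong (O.+-cong w≈ (≡⇒≈ p-at)) (≡⇒≈ q-at)) (W-step i j)

  roots-agree : ∀ {mem mem′ i j₀} → i < j₀ → (∀ {j} → i ≤ j → j < j₀ → K mem′ i j ≡ K mem i j) → RowRoots mem i j₀ → RowRoots mem′ i j₀
  roots-agree i<j₀ eq roots = record
    { diagonal = trans (eq ≤-refl i<j₀) diagonal
    ; mono     = λ i≤j j+1<j₀ → subst₂ _≤_ (sym (eq i≤j (<⇒≤ j+1<j₀))) (sym (eq (m≤n⇒m≤1+n i≤j) j+1<j₀)) (mono i≤j j+1<j₀) }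
    where
    open RowRoots roots

  D : ℕ
  D = suc m * suc m * Z

  interval-time : ∀ {lo hi t₁ t₂ t₃} → lo ≤ hi → t₁ ≤ worst weigh → t₂ ≤ worst range → t₃ ≤ entriesTime lo hi →
    2 + (t₁ + (t₂ + (t₃ + 4))) ≤ D * (1 + (suc hi ∸ lo))
  interval-time {lo} {hi} {t₁} {t₂} {t₃} lo≤hi p q r = begin
    2 + (t₁ + (t₂ + (t₃ + 4)))            ≤⟨ +-monoʳ-≤ 2 (+-mono-≤ p (+-mono-≤ q (+-monoˡ-≤ 4 r))) ⟩
    2 + (worst weigh + (worst range + (entriesTime lo hi + 4)))
      ≡⟨ lemma (worst weigh) (worst range) (entriesTime lo hi) ⟩
    overhead + entriesTime lo hi + 2      ≤⟨ interval-time-≤ overhead (worst split) m (suc hi ∸ lo) ⟩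
    D * (1 + (suc hi ∸ lo))               ∎
    where
    open ≤-Reasoning
    open +-*-Solver
    lemma : ∀ a b c → 2 + (a + (b + (c + 4))) ≡ (a + (b + 4)) + c + 2
    lemma = solve 3 (λ a b c → con 2 :+ (a :+ (b :+ (c :+ con 4))) := (a :+ (b :+ con 4)) :+ c :+ con 2) refl

  module Row (i : ℕ) (i≤n : i ≤ n) where

    record Context (mem : ℕ → ℕ) (rm : ℕ → Carrier) : Set where
      field
        inputs : Inputs rm
        rows   : RowsDone mem rm (suc i)
        below-roots : m ≡ 0 → suc i ≤ n → RowRoots mem (suc i) (suc n)

    -- `lo≤` says that the next range is nonempty. It is carried as an invariant of the stored
    -- roots, because with ties, optimal roots chosen independently need not be monotone.
    record LeftBound (mem : ℕ → ℕ) (d lo : ℕ) : Set where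
      field
        known  : (d ≡ 0 × lo ≡ i) ⊎ (1 ≤ d × lo ≡ K mem i (i + d))
        lo≤    : suc (i + d) ≤ n → lo ≤ K mem (suc i) (suc (i + d))

    left-≤ : ∀ {mem d lo} → RowRoots mem i (suc (i + d)) → LeftBound mem d lo → K mem i (i + d) ≤ lo
    left-≤ {mem} {d} R B with LeftBound.known B
    ... | inj₁ (refl , refl) = ≤-trans (≤-reflexive (trans (cong (K mem i) (+-identityʳ i)) (RowRoots.diagonal R))) (m∸n≤m i 1)
    ... | inj₂ (_ , refl)    = ≤-refl

    knuth-range : ∀ {mem rm d lo} → Context mem rm → m ≡ 0 → suc (i + d) ≤ n →
      ColsDone mem rm i (suc (i + d)) → LeftBound mem d lo →
      Dominating i (suc (i + d)) lo (K mem (suc i) (suc (i + d))) 0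
    knuth-range {mem} {rm} {d} {lo} ctx m≡0 j≤n cols B with LeftBound.known B
    -- The upper end comes from the diagonal of the row below, where the fictitious root is
    -- `suc i ∸ 1`; only the root `i` remains.
    ... | inj₁ (refl , refl) = subst₂ (λ j hi → Dominating i (suc j) i hi 0) (sym (+-identityʳ i))
            (trans (sym (RowRoots.diagonal (below-roots m≡0 (subst (λ j → suc j ≤ n) (+-identityʳ i) j≤n)))) (cong (λ j → K mem (suc i) (suc j)) (sym (+-identityʳ i))))
            knuth-base
      where
      open Context ctx
    ... | inj₂ (1≤d , refl) = knuth-step i<i+d j≤n (LeftBound.lo≤ B j≤n)
            (entry-root {rm = rm} i<i+d (cols i<i+d ≤-refl z≤n (m≤m+n i d)))
            (entry-root {rm = rm} (s≤s i<i+d) (rows ≤-refl (s≤s i<i+d) j≤n z≤n (s≤s (m≤m+n i d))))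
      where
      open Context ctx
      i<i+d : i < i + d
      i<i+d = ≤-trans (≤-reflexive (+-comm 1 i)) (+-monoʳ-≤ i 1≤d)

    run-range : ∀ {d lo kmax σ} → Regs ((%lo , lo) ∷ (%i , i) ∷ (%j , suc (i + d)) ∷ (%kmax , kmax) ∷ baseRegs) σ →
      kmax ≤ m → suc (i + d) ≤ n → Context (imem σ) (rmem σ) → ColsDone (imem σ) (rmem σ) i (suc (i + d)) →
      (m ≡ 0 → LeftBound (imem σ) d lo) →
      Run range σ (λ _ σ′ → Σ ℕ λ lo′ → ireg σ′ %lo ≡ lo′ × Dominating i (suc (i + d)) lo′ (ireg σ′ %hi) kmax ×
                            (m ≡ 0 → lo′ ≡ lo × ireg σ′ %hi ≡ K (imem σ) (suc i) (suc (i + d))))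
    run-range {d} {lo} {kmax} {σ} (elo , ei , ej , ekmax , en , eN , em , _) kmax≤m j≤n ctx cols left = run-ops (run-if
      (λ m≤0 → let m≡0 = n≤0⇒n≡0 (subst (_≤ 0) em m≤0) in
        run-skip (lo , elo , subst₂ (λ hi kmax → Dominating i (suc (i + d)) lo hi kmax) (sym hi≡)
                      (sym (n≤0⇒n≡0 (≤-trans kmax≤m (≤-reflexive m≡0))))
                      (knuth-range ctx m≡0 j≤n cols (left m≡0)) ,
                  λ _ → refl , hi≡))
      (λ m≰0 → run-skip (i , ei , subst (λ hi → Dominating i (suc (i + d)) i hi kmax) (cong (_∸ 1) (sym ej)) (all-roots (s≤s (m≤m+n i d))) ,
                  λ m≡0 → ⊥-elim (m≰0 (≤-reflexive (trans em m≡0))))))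
      where
      hi≡ : imem σ (cell 0 ((suc (ireg σ %n ∸ suc (ireg σ %i)) * ireg σ %N + ireg σ %j) * ireg σ %N + 0)) ≡ K (imem σ) (suc i) (suc (i + d))
      hi≡ = cong (λ a → imem σ (cell 0 a)) (idx-cong en (cong suc ei) eN ej refl)

    context-agree : ∀ {mem rm mem′ rm′ j} → Agree (idx i j 0) mem rm mem′ rm′ → Context mem rm → Context mem′ rm′
    context-agree {j = j} A ctx = record
      { inputs = inputs-agree (N*N≤idx i j 0) A inputs
      ; rows   = λ i<i′ i′<j′ j′≤n k≤m k≤ → entry-agree A j′≤n
                   (idx-row i<i′ (≤-trans (<⇒≤ i′<j′) j′≤n) j′≤n (≤-trans k≤m m≤n)) (rows i<i′ i′<j′ j′≤n k≤m k≤)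
      ; below-roots = λ m≡0 i<n → roots-agree (s≤s i<n) (λ i<j j<1+n → Agree.records A (s≤s z≤n) (idx-row ≤-refl i<n (≤-pred j<1+n) z≤n)) (below-roots m≡0 i<n) }
      where
      open Context ctx

    -- An interval costs at most `D * (1 + e)`, where `e` counts the roots tried. `simple` uses
    -- `e ≤ n`. `amortised` uses `e + lo ≡ 1 + hi`: `hi` is a term of the `rowSum` of the row below,
    -- and `lo` is at least a term of the one of this row, so the sum telescopes up to 2 per
    -- interval. `kept` ties the row below to its state at the start of the row.
    record RowInv (mem₀ : ℕ → ℕ) (j T : ℕ) (σ : Store) : Set where
      field
        d lo      : ℕ
        j≡        : j ≡ suc (i + d)
        regs      : Regs ((%j , j) ∷ (%lo , lo) ∷ (%i , i) ∷ baseRegs) σ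
        w≈        : rreg σ $w ≈ W i (i + d)
        context   : Context (imem σ) (rmem σ)
        cols      : ColsDone (imem σ) (rmem σ) i j
        left      : m ≡ 0 → RowRoots (imem σ) i j × LeftBound (imem σ) d lo
        kept      : ∀ {j} → suc i ≤ j → j ≤ n → K (imem σ) (suc i) j ≡ K mem₀ (suc i) j
        simple    : T ≤ d * (D * suc n)
        amortised : m ≡ 0 → T + D * rowSum (imem σ) i d ≤ D * (rowSum (imem σ) (suc i) d + 2 * d)

    run-interval : ∀ {mem₀ j T σ} → j ≤ n → RowInv mem₀ j T σ → Run interval σ (λ u σ′ → RowInv mem₀ (suc j) (T + (2 + u)) σ′)
    run-interval {mem₀} {T = T} {σ} j≤n record { d = d ; lo = lo ; j≡ = refl ; regs = ej , elo , ei , base ; w≈ = w≈ ; context = ctx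
                                      ; cols = cols ; left = left ; kept = kept ; simple = simple ; amortised = amortised } =
      run-seq (run-weigh (ei , ej , base) (Context.inputs ctx) j≤n w≈)
      λ {σ₁} {t₁} e₁ (ekmax₁ , w₁) → run-seq
        (run-range (trans (keepI e₁ %lo) elo , trans (keepI e₁ %i) ei , trans (keepI e₁ %j) ej , ekmax₁ , keepRegs e₁ baseRegs base) (m⊓n≤m m _) j≤n
           (subst₂ Context (sym (keepIM e₁)) (sym (keepRM e₁)) ctx)
           (subst₂ (λ mem rm → ColsDone mem rm i j) (sym (keepIM e₁)) (sym (keepRM e₁)) cols)
           (λ m≡0 → subst (λ mem → LeftBound mem d lo) (sym (keepIM e₁)) (proj₂ (left m≡0))))
      λ {σ₂} {t₂} e₂ (lo′ , elo₂ , dom , range≡) →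
        rest (keepIM (e₁ ︔ e₂)) (keepRM (e₁ ︔ e₂)) (keepRegs (e₁ ︔ e₂) ((%j , j) ∷ (%i , i) ∷ baseRegs) (ej , ei , base))
             (trans (keepI e₂ %kmax) ekmax₁) (≈-trans (≡⇒≈ (keepR e₂ $w)) w₁) elo₂ dom
             (λ m≡0 → proj₁ (range≡ m≡0) , trans (proj₂ (range≡ m≡0)) (cong (λ mem → K mem (suc i) j) (keepIM e₁)))
             (time e₁) (time e₂)
      where
      j = suc (i + d)
      i<j : i < j
      i<j = s≤s (m≤m+n i d)
      kmax = m ⊓ (j ∸ i)

      sub : Shorter (imem σ) (rmem σ) i j
      sub i≤i′ j′≤j s i′<j′ k′≤m f with m≤n⇒m<n∨m≡n i≤i′
      ... | inj₁ i<i′ = Context.rows ctx i<i′ i′<j′ (≤-trans j′≤j j≤n) k′≤m f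
      ... | inj₂ refl with s
      ...   | inj₁ i<i  = ⊥-elim (<-irrefl refl i<i)
      ...   | inj₂ j′<j = cols i′<j′ j′<j k′≤m f

      rest : ∀ {σ₂ t₁ t₂ lo′} → imem σ₂ ≡ imem σ → rmem σ₂ ≡ rmem σ → Regs ((%j , j) ∷ (%i , i) ∷ baseRegs) σ₂ →
        ireg σ₂ %kmax ≡ kmax → rreg σ₂ $w ≈ W i j → ireg σ₂ %lo ≡ lo′ → Dominating i j lo′ (ireg σ₂ %hi) kmax →
        (m ≡ 0 → lo′ ≡ lo × ireg σ₂ %hi ≡ K (imem σ) (suc i) j) → t₁ ≤ worst weigh → t₂ ≤ worst range →
        Run (entries ︔ ops (mov %lo %br ++ inc %j)) σ₂ (λ u σ′ → RowInv mem₀ (suc j) (T + (2 + (t₁ + (t₂ + u)))) σ′)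
      rest {σ₂} {t₁} {t₂} {lo′} im≡ rm≡ (ej , ei , base) ekmax w₂ elo dom range≡ t₁≤ t₂≤ = run-seq
        (F.run-entries (ekmax , elo , refl , ei , ej , base) w₂ im≡ rm≡)
        λ {σ₃} {t₃} e₃ (t₃≤ , inv) → run-skip (finish σ₃ t₃ e₃ t₃≤ inv)
        where
        open Dominating dom
        hi = ireg σ₂ %hi
        module F = Fill i j lo′ hi kmax i<j j≤n i≤lo lo≤hi hi<j (m⊓n≤m m _)
          (≤-trans (+-monoˡ-≤ i (m⊓n≤n m (j ∸ i))) (≤-reflexive (m∸n+n≡m (<⇒≤ i<j)))) dominated
          (imem σ) (rmem σ) (Context.inputs ctx) sub
        finish : ∀ σ₃ t₃ → Exec entries σ₂ t₃ σ₃ → t₃ ≤ entriesTime lo′ hi → F.EntriesInv (suc kmax) σ₃ →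
          RowInv mem₀ (suc j) (T + (2 + (t₁ + (t₂ + (t₃ + 4))))) (execOps (mov %lo %br ++ inc %j) σ₃)
        finish σ₃ t₃ e₃ t₃≤ inv = record
          { d = suc d ; lo = ireg σ₃ %br
          ; j≡ = cong suc (sym (+-suc i d))
          ; regs = cong suc (trans (keepI e₃ %j) ej) , refl , trans (keepI e₃ %i) ei , keepRegs e₃ baseRegs base
          ; w≈ = ≈-trans E.w≈ (≡⇒≈ (cong (W i) (sym (+-suc i d))))
          ; context = context-agree E.below ctx
          ; cols = λ i<j′ j′<1+j → cols′ i<j′ (m≤n⇒m<n∨m≡n (≤-pred j′<1+j))
          ; left = λ m≡0 → left′ m≡0
          ; kept = λ i<j′ j′≤n → trans (below-row i<j′ j′≤n) (kept i<j′ j′≤n)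
          ; simple = begin
              T + (2 + (t₁ + (t₂ + (t₃ + 4))))      ≤⟨ +-mono-≤ simple step ⟩
              d * (D * suc n) + D * (1 + e)         ≤⟨ +-monoʳ-≤ (d * (D * suc n)) (*-monoʳ-≤ D (s≤s e≤n)) ⟩
              d * (D * suc n) + D * suc n           ≡⟨ +-comm (d * (D * suc n)) _ ⟩
              suc d * (D * suc n)                   ∎
          ; amortised = λ m≡0 → amortise m≡0 }
          where
          open ≤-Reasoning
          module E = F.EntriesInv inv
          e = suc hi ∸ lo′
          e≤n : e ≤ n
          e≤n = ≤-trans (m∸n≤m (suc hi) lo′) (≤-trans hi<j j≤n)
          step : 2 + (t₁ + (t₂ + (t₃ + 4))) ≤ D * (1 + e)
          step = interval-time {lo′} {hi} {t₁} {t₂} {t₃} lo≤hi t₁≤ t₂≤ t₃≤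
          below-row : ∀ {j′} → suc i ≤ j′ → j′ ≤ n → K (imem σ₃) (suc i) j′ ≡ K (imem σ) (suc i) j′
          below-row i<j′ j′≤n = Agree.records E.below (s≤s z≤n) (idx-row ≤-refl (≤-trans i<j′ j′≤n) j′≤n z≤n)
          same-row : ∀ {j′} → j′ < j → K (imem σ₃) i j′ ≡ K (imem σ) i j′
          same-row j′<j = Agree.records E.below (s≤s z≤n) (idx-col {i} {k = 0} j′<j z≤n)
          cols′ : ∀ {j′ k} → i < j′ → j′ < j ⊎ j′ ≡ j → k ≤ m → k + i ≤ j′ → Entry (imem σ₃) (rmem σ₃) i j′ k
          cols′ i<j′ (inj₁ j′<j) k≤m k≤ = entry-agree E.below (≤-trans (<⇒≤ j′<j) j≤n) (idx-col {i} {k = 0} j′<j (≤-trans k≤m m≤n)) (cols i<j′ j′<j k≤m k≤)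
          cols′ {k = k} i<j′ (inj₂ refl) k≤m k≤ = E.filled (s≤s (⊓-glb k≤m (m+n≤o⇒m≤o∸n k k≤)))
          last : m ≡ 0 → K (imem σ₃) i j ≡ ireg σ₃ %br × lo′ ≤ ireg σ₃ %br × ireg σ₃ %br ≤ hi
          last m≡0 = subst (λ k → F.LastRoot (suc k) σ₃) (cong (_⊓ (j ∸ i)) m≡0) E.last
          left′ : m ≡ 0 → RowRoots (imem σ₃) i (suc j) × LeftBound (imem σ₃) (suc d) (ireg σ₃ %br)
          left′ m≡0 with last m≡0 | range≡ m≡0 | left m≡0
          ... | er , lo≤br , br≤hi | refl , hi≡ | roots , bound = record
            { diagonal = trans (same-row i<j) (RowRoots.diagonal roots)
            ; mono = λ i≤j′ j′+1<1+j → mono′ i≤j′ (m≤n⇒m<n∨m≡n (≤-pred j′+1<1+j)) } , record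
            { known = inj₂ (s≤s z≤n , trans (sym er) (cong (K (imem σ₃) i) (sym (+-suc i d))))
            ; lo≤ = λ j+1≤n → lo≤′ (subst (λ x → suc x ≤ n) (+-suc i d) j+1≤n) }
            where
            -- The search starts no earlier than the previous root, so the roots of this row
            -- increase. It ends at a root of the row below, which increases too, so the next range
            -- is nonempty.
            mono′ : ∀ {j′} → i ≤ j′ → suc j′ < j ⊎ suc j′ ≡ j → K (imem σ₃) i j′ ≤ K (imem σ₃) i (suc j′)
            mono′ i≤j′ (inj₁ lt)   = subst₂ _≤_ (sym (same-row (<⇒≤ lt))) (sym (same-row lt)) (RowRoots.mono roots i≤j′ lt)
            mono′ i≤j′ (inj₂ refl) = subst₂ _≤_ (sym (same-row ≤-refl)) (sym er) (≤-trans (left-≤ roots bound) lo≤br)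
            lo≤′ : suc j ≤ n → ireg σ₃ %br ≤ K (imem σ₃) (suc i) (suc (i + suc d))
            lo≤′ j<n = ≤-trans br≤hi (≤-trans (≤-reflexive hi≡) (≤-trans
              (RowRoots.mono (Context.below-roots ctx m≡0 (≤-trans i<j j≤n)) i<j (s≤s j<n))
              (≤-reflexive (trans (sym (below-row (m≤n⇒m≤1+n i<j) j<n)) (cong (λ x → K (imem σ₃) (suc i) (suc x)) (sym (+-suc i d)))))))
          amortise : m ≡ 0 → T + (2 + (t₁ + (t₂ + (t₃ + 4)))) + D * (rowSum (imem σ₃) i d + K (imem σ₃) i (i + d))
            ≤ D * (rowSum (imem σ₃) (suc i) d + K (imem σ₃) (suc i) (suc i + d) + 2 * suc d)
          amortise m≡0 with range≡ m≡0 | left m≡0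
          ... | refl , hi≡ | roots , bound = begin
            T + (2 + (t₁ + (t₂ + (t₃ + 4)))) + D * (rowSum (imem σ₃) i d + K (imem σ₃) i (i + d))
              ≤⟨ +-mono-≤ (+-monoʳ-≤ T step) (*-monoʳ-≤ D (+-mono-≤ (≤-reflexive (rowSum-cong d (λ e<d → same-row (s≤s (+-monoʳ-≤ i (<⇒≤ e<d))))))
                    (≤-trans (≤-reflexive (same-row ≤-refl)) (left-≤ roots bound)))) ⟩
            T + D * (1 + e) + D * (rowSum (imem σ) i d + lo)
              ≡⟨ lemma₁ T D e (rowSum (imem σ) i d) lo ⟩
            (T + D * rowSum (imem σ) i d) + D * (1 + (e + lo))
              ≤⟨ +-monoˡ-≤ (D * (1 + (e + lo))) (amortised m≡0) ⟩
            D * (rowSum (imem σ) (suc i) d + 2 * d) + D * (1 + (e + lo))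
              -- As the range is nonempty, the truncated difference in `e` is exact and `e + lo` is
              -- one more than the root of the row below.
              ≡⟨ cong (λ x → D * (rowSum (imem σ) (suc i) d + 2 * d) + D * (1 + x)) (trans (m∸n+n≡m (m≤n⇒m≤1+n lo≤hi)) (cong suc hi≡)) ⟩
            D * (rowSum (imem σ) (suc i) d + 2 * d) + D * (2 + K (imem σ) (suc i) j)
              ≡⟨ lemma₂ D (rowSum (imem σ) (suc i) d) d (K (imem σ) (suc i) j) ⟩
            D * (rowSum (imem σ) (suc i) d + K (imem σ) (suc i) j + 2 * suc d)
              ≡⟨ cong (λ x → D * (x + 2 * suc d)) (cong₂ _+_
                   (rowSum-cong d (λ e<d → below-row (m≤m+n (suc i) _) (≤-trans (s≤s (+-monoʳ-≤ i (<⇒≤ e<d))) j≤n)))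
                   (below-row i<j j≤n)) ⟨
            D * (rowSum (imem σ₃) (suc i) d + K (imem σ₃) (suc i) (suc i + d) + 2 * suc d) ∎
            where
            open +-*-Solver
            lemma₁ : ∀ T D e s l → T + D * (1 + e) + D * (s + l) ≡ (T + D * s) + D * (1 + (e + l))
            lemma₁ = solve 5 (λ T D e s l → T :+ D :* (con 1 :+ e) :+ D :* (s :+ l) := (T :+ D :* s) :+ D :* (con 1 :+ (e :+ l))) refl
            lemma₂ : ∀ D s d k → D * (s + 2 * d) + D * (2 + k) ≡ D * (s + k + 2 * (1 + d))
            lemma₂ = solve 4 (λ D s d k → D :* (s :+ con 2 :* d) :+ D :* (con 2 :+ k) := D :* (s :+ k :+ con 2 :* (con 1 :+ d))) refl

  W-diagonal : ∀ i → inp (2 * i) ≈ W i i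
  W-diagonal i = ≈-sym (≈-trans (R-Solver.solve 3 (λ p q b → ((p ⊕ b) ⊕ q) ⊜ (b ⊕ (p ⊕ q))) ≈-refl
      (prefix (2 * i)) (O.- prefix (2 * i)) (inp (2 * i)))
    (≈-trans (O.+-cong ≈-refl (O.-‿inverseʳ _)) (O.+-identityʳ _)))
    where
    open R-Solver

  -- Rows are finished for `i` above `n ∸ x`. Each costs 29 instructions besides its intervals: 23
  -- for `start`, 2 to leave its loop, 2 for the increment and 2 for the outer loop. In `amortised`,
  -- `3 * n` is `2 * n` for the intervals plus `n` bounding the last root of the row, which joins
  -- the potential when the row is complete.
  record TableInv (x T : ℕ) (σ : Store) : Set where
    field
      regs      : Regs ((%x , x) ∷ baseRegs) σ
      inputs    : Inputs (rmem σ)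
      rows      : ∀ {i j k} → n < i + x → i < j → j ≤ n → k ≤ m → k + i ≤ j → Entry (imem σ) (rmem σ) i j k
      last-roots : m ≡ 0 → ∀ {i} → i + x ≡ suc n → i ≤ n → RowRoots (imem σ) i (suc n)
      simple    : T ≤ x * (n * (D * suc n) + 29)
      amortised : m ≡ 0 → ∀ {i} → i + x ≡ suc n → T + D * rowSum (imem σ) i x ≤ x * (D * (3 * n) + 29)

  module OneRow (x : ℕ) (x≤n : x ≤ n) {T : ℕ} {σ : Store} (inv : TableInv x T σ) where
    open TableInv inv

    i : ℕ
    i = n ∸ x

    i≤n : i ≤ n
    i≤n = m∸n≤m n x

    i+x≡n : i + x ≡ n
    i+x≡n = m∸n+n≡m x≤n

    open Row i i≤n

    a : ℕ
    a = idx i i 0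

    σ₁ : Store
    σ₁ = execOps start σ

    i≡ : ireg σ %n ∸ ireg σ %x ≡ i
    i≡ = let ex , en , _ = regs in cong₂ _∸_ en ex

    imem≡ : imem σ₁ ≡ imem σ [ cell 0 a ↦ i ∸ 1 ]
    imem≡ = let ex , en , eN , _ = regs in
      cong₂ (λ a i → imem σ [ cell 0 a ↦ i ∸ 1 ]) (idx-cong en i≡ eN i≡ refl) i≡

    agree₁ : Agree a (imem σ) (rmem σ) (imem σ₁) (rmem σ₁)
    agree₁ = agree (λ {f} {b} f<3 b<a → trans (cong (λ mem → mem (cell f b)) imem≡)
      (update-≢ (imem σ) (cell 0 a) (i ∸ 1) (<⇒≢ (cell-< {f} {0} f<3 b<a)))) (λ _ → refl)

    context : Context (imem σ) (rmem σ)
    context = record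
      { inputs = inputs
      ; rows = λ i<i′ → rows (≤-trans (≤-reflexive (cong suc (sym i+x≡n))) (+-monoˡ-≤ x i<i′))
      ; below-roots = λ m≡0 → last-roots m≡0 (cong suc i+x≡n) }

    diagonal₁ : K (imem σ₁) i i ≡ i ∸ 1
    diagonal₁ = trans (cong (λ mem → mem (cell 0 a)) imem≡) (update-≡ (imem σ) (cell 0 a) (i ∸ 1) refl)

    row-start : RowInv (imem σ₁) (suc i) 0 σ₁
    row-start = record
      { d = 0 ; lo = i ; j≡ = cong suc (sym (+-identityʳ i))
      ; regs = cong suc i≡ , i≡ , i≡ , proj₂ regs
      ; w≈ = ≈-trans (≡⇒≈ (trans (cong (λ i → rmem σ (2 * i)) i≡) (inputs (*-monoʳ-≤ 2 i≤n))))
               (≈-trans (W-diagonal i) (≡⇒≈ (cong (W i) (sym (+-identityʳ i)))))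
      ; context = context₁
      ; cols = λ i<j j<1+i → ⊥-elim (<⇒≱ i<j (≤-pred j<1+i))
      ; left = λ m≡0 → record
          { diagonal = diagonal₁ ; mono = λ i≤j j+1<1+i → ⊥-elim (<⇒≱ (≤-pred j+1<1+i) i≤j) } , record
          { known = inj₁ (refl , refl)
          ; lo≤ = λ lt → subst (λ j → suc j ≤ n → i ≤ K (imem σ₁) (suc i) (suc j)) (sym (+-identityʳ i))
              (λ i<n → ≤-reflexive (sym (RowRoots.diagonal (Context.below-roots context₁ m≡0 i<n)))) lt }
      ; kept = λ _ _ → refl
      ; simple = z≤n
      ; amortised = λ _ → ≤-reflexive (trans (*-zeroʳ D) (sym (*-zeroʳ D))) }
      where context₁ = context-agree agree₁ context

    -- 23 is the length of start.
    row-end : ∀ {v σ′} → RowInv (imem σ₁) (suc n) v σ′ → ireg σ′ %x ≡ x →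
      TableInv (suc x) (T + (2 + (23 + ((v + 2) + 2)))) (execOps (inc %x) σ′)
    row-end {v} {σ′} rinv ex with trans (sym (suc-injective (RowInv.j≡ rinv))) (sym i+x≡n)
    ... | i+d≡i+x with +-cancelˡ-≡ i (RowInv.d rinv) x i+d≡i+x
    ... | refl = record
      { regs = cong suc ex , proj₂ (proj₂ (proj₂ R.regs))
      ; inputs = Context.inputs R.context
      ; rows = λ {i′} n<i′+1+x → rows′ (m≤n⇒m<n∨m≡n (≤-pred (+-cancelʳ-< x i (suc i′) (≤-trans (≤-reflexive (cong suc i+x≡n)) (≤-trans n<i′+1+x (≤-reflexive (+-suc i′ x)))))))
      ; last-roots = λ m≡0 {i′} eq _ → subst (λ i → RowRoots (imem σ′) i (suc n)) (sym (i′≡i eq)) (proj₁ (R.left m≡0))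
      ; simple = begin
          T + (2 + (23 + (v + 2 + 2)))                                    ≤⟨ +-mono-≤ simple (+-monoʳ-≤ 25 (+-monoˡ-≤ 2 (+-monoˡ-≤ 2 (≤-trans R.simple (*-monoˡ-≤ (D * suc n) x≤n))))) ⟩
          x * (n * (D * suc n) + 29) + (2 + (23 + (n * (D * suc n) + 2 + 2)))  ≡⟨ lemma₁ (x * (n * (D * suc n) + 29)) (n * (D * suc n)) ⟩
          suc x * (n * (D * suc n) + 29)                                  ∎
      ; amortised = λ m≡0 {i′} eq → subst (λ i → T + (2 + (23 + (v + 2 + 2))) + D * rowSum (imem σ′) i (suc x) ≤ suc x * (D * (3 * n) + 29)) (sym (i′≡i eq)) (amortise m≡0) }
      where
      open ≤-Reasoning
      module R = RowInv rinv
      i′≡i : ∀ {i′} → i′ + suc x ≡ suc n → i′ ≡ i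
      i′≡i {i′} eq = +-cancelʳ-≡ x i′ i (suc-injective (trans (sym (+-suc i′ x)) (trans eq (cong suc (sym i+x≡n)))))
      rows′ : ∀ {i′ j k} → i < i′ ⊎ i ≡ i′ → i′ < j → j ≤ n → k ≤ m → k + i′ ≤ j → Entry (imem σ′) (rmem σ′) i′ j k
      rows′ (inj₁ i<i′) i′<j j≤n = Context.rows R.context i<i′ i′<j j≤n
      rows′ (inj₂ refl) i<j j≤n  = R.cols i<j (s≤s j≤n)
      last-≤ : m ≡ 0 → K (imem σ′) i (i + x) ≤ n
      last-≤ m≡0 with m≤n⇒m<n∨m≡n (≤-trans (m≤m+n i x) (≤-reflexive i+x≡n))
      ... | inj₁ i<n = subst (λ j → K (imem σ′) i j ≤ n) (sym i+x≡n)
              (≤-trans (n≤1+n _) (tree-≤ (OptimalRoot.right (entry-root {rm = rmem σ′} i<n (R.cols i<n ≤-refl z≤n (<⇒≤ i<n))))))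
      ... | inj₂ i≡n = subst (λ j → K (imem σ′) i j ≤ n) (sym (trans i+x≡n (sym i≡n)))
              (≤-trans (≤-reflexive (RowRoots.diagonal (proj₁ (R.left m≡0)))) (≤-trans (m∸n≤m i 1) i≤n))
      same-below : rowSum (imem σ′) (suc i) x ≡ rowSum (imem σ) (suc i) x
      same-below = rowSum-cong x λ {e} e<x →
        let j≤n = ≤-trans (+-monoʳ-< i e<x) (≤-reflexive i+x≡n) ; i<j = m≤m+n (suc i) e in
        trans (R.kept i<j j≤n) (Agree.records agree₁ (s≤s z≤n) (idx-row ≤-refl (≤-trans i<j j≤n) j≤n z≤n))
      amortise : m ≡ 0 → T + (2 + (23 + (v + 2 + 2))) + D * (rowSum (imem σ′) i x + K (imem σ′) i (i + x)) ≤ suc x * (D * (3 * n) + 29)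
      amortise m≡0 = begin
        T + (2 + (23 + (v + 2 + 2))) + D * (S + K (imem σ′) i (i + x))   ≤⟨ +-monoʳ-≤ (T + (2 + (23 + (v + 2 + 2)))) (*-monoʳ-≤ D (+-monoʳ-≤ S (last-≤ m≡0))) ⟩
        T + (2 + (23 + (v + 2 + 2))) + D * (S + n)                       ≡⟨ lemma₂ T v D S n ⟩
        T + (v + D * S) + (29 + D * n)                                   ≤⟨ +-monoˡ-≤ (29 + D * n) (+-monoʳ-≤ T (R.amortised m≡0)) ⟩
        T + D * (rowSum (imem σ′) (suc i) x + 2 * x) + (29 + D * n)      ≡⟨ cong (λ s → T + D * (s + 2 * x) + (29 + D * n)) same-below ⟩
        T + D * (S′ + 2 * x) + (29 + D * n)                              ≤⟨ +-monoˡ-≤ (29 + D * n) (+-monoʳ-≤ T (*-monoʳ-≤ D (+-monoʳ-≤ S′ (*-monoʳ-≤ 2 x≤n)))) ⟩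
        T + D * (S′ + 2 * n) + (29 + D * n)                              ≡⟨ lemma₃ T D S′ n ⟩
        (T + D * S′) + (D * (3 * n) + 29)                                ≤⟨ +-monoˡ-≤ (D * (3 * n) + 29) (amortised m≡0 (cong suc i+x≡n)) ⟩
        x * (D * (3 * n) + 29) + (D * (3 * n) + 29)                      ≡⟨ +-comm (x * (D * (3 * n) + 29)) _ ⟩
        suc x * (D * (3 * n) + 29)                                       ∎
        where
        S = rowSum (imem σ′) i x
        S′ = rowSum (imem σ) (suc i) x
        open +-*-Solver
        lemma₂ : ∀ T v D S n → T + (2 + (23 + (v + 2 + 2))) + D * (S + n) ≡ T + (v + D * S) + (29 + D * n)
        lemma₂ = solve 5 (λ T v D S n → T :+ (con 2 :+ (con 23 :+ (v :+ con 2 :+ con 2))) :+ D :* (S :+ n) := T :+ (v :+ D :* S) :+ (con 29 :+ D :* n)) refl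
        lemma₃ : ∀ T D S n → T + D * (S + 2 * n) + (29 + D * n) ≡ (T + D * S) + (D * (3 * n) + 29)
        lemma₃ = solve 4 (λ T D S n → T :+ D :* (S :+ con 2 :* n) :+ (con 29 :+ D :* n) := (T :+ D :* S) :+ (D :* (con 3 :* n) :+ con 29)) refl
      lemma₁ : ∀ y z → y + (2 + (23 + (z + 2 + 2))) ≡ (z + 29) + y
      lemma₁ = solve 2 (λ y z → y :+ (con 2 :+ (con 23 :+ (z :+ con 2 :+ con 2))) := (z :+ con 29) :+ y) refl
        where
        open +-*-Solver

    run-row : Run row σ (λ u σ′ → TableInv (suc x) (T + (2 + u)) σ′)
    run-row = run-ops (run-seq
      (run-count (RowInv (imem σ₁)) (λ rinv → let ej , _ , _ , en , _ = RowInv.regs rinv in ej , en) run-interval (n ∸ i)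
        (cong suc (m+[n∸m]≡n i≤n)) row-start)
      λ { e (v , refl , rinv) → run-skip (row-end rinv (trans (keepI e %x) (proj₁ regs))) })

  run-table : ∀ {σ} → Regs baseRegs σ → Inputs (rmem σ) → Run table σ (λ u σ′ → Σ ℕ λ v → u ≡ 3 + v × TableInv (suc n) v σ′)
  run-table {σ} regs inputs = run-ops (run-map
    (run-count TableInv (λ inv → let ex , en , _ = TableInv.regs inv in ex , en) (λ x≤n inv → OneRow.run-row _ x≤n inv) (suc n) refl
      (record
        { regs = refl , regs ; inputs = inputs
        ; rows = λ {i} n<i+0 i<j j≤n → ⊥-elim (<⇒≱ (<-trans (subst (n <_) (+-identityʳ i) n<i+0) i<j) j≤n)
        ; last-roots = λ _ {i} eq i≤n → ⊥-elim (<⇒≱ (≤-reflexive (trans (sym eq) (+-identityʳ i))) i≤n)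
        ; simple = z≤n
        ; amortised = λ _ _ → ≤-reflexive (*-zeroʳ D) }))
    λ { _ (v , u≡ , inv) → v , cong suc (trans u≡ (+-comm v 2)) , inv })

-- The output

rootPtr : ∀ {i j} → Tree i j → ℕ
rootPtr leaf           = 0
rootPtr (node r t L R) = suc r

-- The two child pointers and the colour of a key x; junk unless i ≤ x < j.
info : ∀ {i j} → Tree i j → ℕ → ℕ × ℕ × Bool
info leaf           x = 0 , 0 , false
info (node r t L R) x with <-cmp x r
... | tri< _ _ _ = info L x
... | tri≈ _ _ _ = rootPtr L , rootPtr R , t
... | tri> _ _ _ = info R x

info-left : ∀ {i j r t x} (L : Tree i r) (R : Tree (suc r) j) → x < r → info (node {i} {j} r t L R) x ≡ info L x
info-left {r = r} {x = x} L R x<r with <-cmp x r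
... | tri< _ _ _     = refl
... | tri≈ ¬x<r _ _  = ⊥-elim (¬x<r x<r)
... | tri> ¬x<r _ _  = ⊥-elim (¬x<r x<r)

info-here : ∀ {i j r t x} (L : Tree i r) (R : Tree (suc r) j) → x ≡ r → info (node {i} {j} r t L R) x ≡ (rootPtr L , rootPtr R , t)
info-here {r = r} {x = x} L R x≡r with <-cmp x r
... | tri< _ x≢r _ = ⊥-elim (x≢r x≡r)
... | tri≈ _ _ _   = refl
... | tri> _ x≢r _ = ⊥-elim (x≢r x≡r)

info-right : ∀ {i j r t x} (L : Tree i r) (R : Tree (suc r) j) → r < x → info (node {i} {j} r t L R) x ≡ info R x
info-right {r = r} {x = x} L R r<x with <-cmp x r
... | tri< _ _ ¬r<x = ⊥-elim (¬r<x r<x)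
... | tri≈ _ _ ¬r<x = ⊥-elim (¬r<x r<x)
... | tri> _ _ _    = refl

nodes : ∀ {i j} → Tree i j → ℕ
nodes leaf           = 0
nodes (node r t L R) = suc (nodes L + nodes R)

nodes-≡ : ∀ {i j} (T : Tree i j) → nodes T + i ≡ j
nodes-≡ leaf = refl
nodes-≡ {i} {j} (node r t L R) = begin
  suc (nodes L + nodes R + i)    ≡⟨ cong (λ x → suc (x + i)) (+-comm (nodes L) (nodes R)) ⟩
  suc (nodes R + nodes L + i)    ≡⟨ cong suc (+-assoc (nodes R) (nodes L) i) ⟩
  suc (nodes R + (nodes L + i))  ≡⟨ cong (λ x → suc (nodes R + x)) (nodes-≡ L) ⟩
  suc (nodes R + r)              ≡⟨ +-suc (nodes R) r ⟨
  nodes R + suc r                ≡⟨ nodes-≡ R ⟩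
  j                              ∎
  where
  open ≡-Reasoning

count : (ℕ → Bool) → ℕ → ℕ
count f zero    = 0
count f (suc x) = bit (f x) + count f x

module Descent (𝓡 : OrderedRing) (n : ℕ) where

  open Semantics 𝓡
  open Store
  open Tables n

  sizeRegs : List (ℕ × ℕ)
  sizeRegs = (%n , n) ∷ (%N , suc n) ∷ []

  run-pointer : ∀ {i j k σ} → Regs ((%I , i) ∷ (%J , j) ∷ (%K , k) ∷ sizeRegs) σ →
    (T : Tree i j) → minors T ≡ k → Encodes (imem σ) T → Run pointer σ (λ _ σ′ → ireg σ′ %p ≡ rootPtr T)
  run-pointer (eI , eJ , eK , en , eN , _) leaf mT enc =
    run-if (λ _ → run-skip refl) (λ J≰I → ⊥-elim (J≰I (≤-reflexive (trans eJ (sym eI)))))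
  run-pointer {σ = σ} (eI , eJ , eK , en , eN , _) (node r t L R) mT (er , _) =
    run-if (λ J≤I → ⊥-elim (<⇒≱ (≤-trans (s≤s (tree-≤ L)) (tree-≤ R)) (subst₂ _≤_ eJ eI J≤I)))
           (λ _ → run-skip (cong suc (trans (cong (λ a → imem σ (cell 0 a)) (idx-cong en eI eN eJ (trans eK (sym mT)))) er)))

  encodes-put : ∀ {mem f x v i j} → f < 3 → x < n → (T : Tree i j) → j ≤ n → Encodes mem T → Encodes (mem [ cell f x ↦ v ]) T
  encodes-put {mem} {f} {x} {v} f<3 x<n T j≤n = encodes-agree {lower = suc n * suc n}
    (λ {g} {a} g<3 N*N≤a _ → update-≢ mem (cell f x) v (cell-≢ {g} {f} g<3 f<3 (λ a≡x → <⇒≢ (<-≤-trans x<N*N N*N≤a) (sym a≡x))))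
    ≤-refl T j≤n ≤-refl
    where
    x<N*N : x < suc n * suc n
    x<N*N = ≤-trans x<n (≤-trans (n≤1+n n) (m≤m*n (suc n) (suc n)))

  module Key (x : ℕ) (x<n : x < n) (fmin fmaj : ℕ) where

    keyRegs : List (ℕ × ℕ)
    keyRegs = (%x , x) ∷ (%fmin , fmin) ∷ (%fmaj , fmaj) ∷ sizeRegs

    record Emitted (mem : ℕ → ℕ) (res : ℕ × ℕ × Bool) (σ : Store) : Set where
      field
        written≡ : imem σ ≡ written mem x (proj₁ res) (proj₁ (proj₂ res)) (if proj₂ (proj₂ res) then fmin else fmaj)
        fmin≡    : ireg σ %fmin ≡ bit (proj₂ (proj₂ res)) + fmin
        fmaj≡    : ireg σ %fmaj ≡ bit (not (proj₂ (proj₂ res))) + fmaj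

    run-place : ∀ {mem p q t σ} → Regs ((%A , x) ∷ (%t , bit t) ∷ keyRegs) σ →
      imem σ ≡ (mem [ cell 0 x ↦ p ]) [ cell 1 x ↦ q ] → Run place σ (λ _ σ′ → Emitted mem (p , q , t) σ′)
    run-place {t = false} (eA , et , ex , emin , emaj , _) im = run-ops (run-if
      (λ 1≤t → ⊥-elim (1+n≰n (subst (1 ≤_) et 1≤t)))
      (λ _ → run-skip (record
        { written≡ = trans (cong₂ (λ m a → m [ cell 2 a ↦ _ ]) im eA) (cong (λ v → _ [ cell 2 x ↦ v ]) emaj)
        ; fmin≡ = emin ; fmaj≡ = cong suc emaj })))
    run-place {t = true} (eA , et , ex , emin , emaj , _) im = run-ops (run-if
      (λ _ → run-skip (record
        { written≡ = trans (cong₂ (λ m a → m [ cell 2 a ↦ _ ]) im eA) (cong (λ v → _ [ cell 2 x ↦ v ]) emin)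
        ; fmin≡ = cong suc emin ; fmaj≡ = emaj }))
      (λ 1≰t → ⊥-elim (1≰t (≤-reflexive (sym et)))))

    run-emit : ∀ {i j t σ} (L : Tree i x) (R : Tree (suc x) j) → j ≤ n → Encodes (imem σ) L → Encodes (imem σ) R →
      Regs ((%i , i) ∷ (%j , j) ∷ (%r , x) ∷ (%a , minors L) ∷ (%b , minors R) ∷ (%t , bit t) ∷ keyRegs) σ →
      Run emit σ (λ _ σ′ → ireg σ′ %go ≡ suc x × Emitted (imem σ) (rootPtr L , rootPtr R , t) σ′)
    run-emit {i} {j} {t} {σ} L R j≤n encL encR (ei , ej , er , ea , eb , et , ex , emin , emaj , size) = run-ops (run-seq
      (run-pointer (ei , er , ea , size) L refl encL)
      λ {σ₁} e₁ p≡ → run-ops (second σ₁ (keepIM e₁) p≡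
        (keepRegs e₁ ((%j , j) ∷ (%r , x) ∷ (%b , minors R) ∷ (%t , bit t) ∷ keyRegs) (ej , er , eb , et , ex , emin , emaj , size))))
      where
      third : ∀ σ₂ {v} → imem σ₂ ≡ imem σ [ cell 0 x ↦ v ] → v ≡ rootPtr L → ireg σ₂ %p ≡ rootPtr R → Regs ((%t , bit t) ∷ keyRegs) σ₂ →
        Run (ops (mov %A %x ++ put 1 %p) ︔ place ︔ ops (next %go %x)) σ₂
          (λ _ σ′ → ireg σ′ %go ≡ suc x × Emitted (imem σ) (rootPtr L , rootPtr R , t) σ′)
      third σ₂ im refl q≡ (et , ex , regs) = run-ops (run-seq
        (run-place (ex , et , ex , regs) (trans (cong₂ (λ m a → m [ cell 1 a ↦ _ ]) im ex) (cong (λ v → _ [ cell 1 x ↦ v ]) q≡)))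
        λ {σ₃} e₃ em → run-skip (cong suc (trans (keepI e₃ %x) ex) , record { written≡ = Emitted.written≡ em ; fmin≡ = Emitted.fmin≡ em ; fmaj≡ = Emitted.fmaj≡ em }))

      second : ∀ σ₁ → imem σ₁ ≡ imem σ → ireg σ₁ %p ≡ rootPtr L → Regs ((%j , j) ∷ (%r , x) ∷ (%b , minors R) ∷ (%t , bit t) ∷ keyRegs) σ₁ →
        Run (pointer ︔ ops (mov %A %x ++ put 1 %p) ︔ place ︔ ops (next %go %x)) (execOps right-child σ₁)
          (λ _ σ′ → ireg σ′ %go ≡ suc x × Emitted (imem σ) (rootPtr L , rootPtr R , t) σ′)
      second σ₁ im p≡ (ej , er , eb , et , ex , emin , emaj , size) = run-seq
        (run-pointer (cong suc er , ej , eb , size) R refl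
          (subst (λ m → Encodes m R) (sym im₁) (encodes-put {f = 0} (s≤s z≤n) x<n R j≤n encR)))
        λ {σ₂} e₂ q≡ → third σ₂ (trans (keepIM e₂) im₁) p≡ q≡
          (keepRegs e₂ ((%t , bit t) ∷ keyRegs) (et , ex , emin , emaj , size))
        where
        im₁ : imem (execOps right-child σ₁) ≡ imem σ [ cell 0 x ↦ ireg σ₁ %p ]
        im₁ = cong₂ (λ m a → m [ cell 0 a ↦ ireg σ₁ %p ]) im ex

    descRegs : ℕ → ℕ → ℕ → List (ℕ × ℕ)
    descRegs i j k = (%i , i) ∷ (%j , j) ∷ (%k , k) ∷ keyRegs

    Descended : ℕ → ℕ × ℕ × Bool → (ℕ → ℕ) → ℕ → Store → Set
    Descended bound res mem u σ = u ≤ bound * (2 + worst descend) + 2 × Emitted mem res σ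

    iterate : ∀ {σ res} b b′ → b′ ≤ b → ireg σ %go ≡ 0 →
      ∀ {σ′ t} → Exec descend σ t σ′ → Run seek σ′ (Descended b′ res (imem σ)) →
      Run seek σ (Descended (suc b) res (imem σ))
    iterate b b′ b′≤b go≡ e (σ″ , u , f , u≤ , em) = σ″ , _ , again (≤-trans (≤-reflexive go≡) z≤n) e f , (begin
      2 + _ + u                                                ≤⟨ +-mono-≤ (+-monoʳ-≤ 2 (time e)) u≤ ⟩
      2 + worst descend + (b′ * (2 + worst descend) + 2)       ≡⟨ +-assoc (2 + worst descend) (b′ * (2 + worst descend)) 2 ⟨
      suc b′ * (2 + worst descend) + 2                         ≤⟨ +-monoˡ-≤ 2 (*-monoˡ-≤ (2 + worst descend) (s≤s b′≤b)) ⟩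
      suc b * (2 + worst descend) + 2                          ∎) , em
      where
      open ≤-Reasoning

    minors-right : ∀ {k} t a b → bit t + (a + b) ≡ k → k ∸ bit t ∸ a ≡ b
    minors-right t a b refl = trans (cong (_∸ a) (m+n∸m≡n (bit t) (a + b))) (m+n∸m≡n a b)

    -- Each iteration of `seek` stops or passes to a subtree, so induction on the encoded tree
    -- yields termination, with `nodes` bounding the iterations.
    run-descend : ∀ {i j σ} (T : Tree i j) → j ≤ n → i ≤ x → x < j → Encodes (imem σ) T → ireg σ %go ≡ 0 →
      Regs (descRegs i j (minors T)) σ → Run seek σ (Descended (nodes T) (info T x) (imem σ))

    run-node : ∀ {i j r t σ} (L : Tree i r) (R : Tree (suc r) j) → j ≤ n → i ≤ x → x < j →
      Encodes (imem σ) L → Encodes (imem σ) R → ireg σ %go ≡ 0 →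
      ∀ σ₁ {u₁} → Exec (ops load) σ u₁ σ₁ → imem σ₁ ≡ imem σ → ireg σ₁ %go ≡ 0 →
      Regs ((%r , r) ∷ (%a , minors L) ∷ (%b , minors R) ∷ (%t , bit t) ∷ (%i , i) ∷ (%j , j) ∷ keyRegs) σ₁ →
      Run seek σ (Descended (suc (nodes L + nodes R)) (info (node {i} {j} r t L R) x) (imem σ))
    run-node {i} {j} {r} {t} {σ} L R j≤n i≤x x<j encL encR go≡ σ₁ e₁ im₁ go₁ (er , ea , eb , et , ei , ej , ex , emin , emaj , size) = choose (<-cmp x r)
      where
      mem = imem σ
      Goal : Set
      Goal = Run seek σ (Descended (suc (nodes L + nodes R)) (info (node {i} {j} r t L R) x) mem)

      go-left : ∀ σ₂ {u} → Exec descend σ u σ₂ → imem σ₂ ≡ mem → ireg σ₂ %go ≡ 0 → Regs (descRegs i r (minors L)) σ₂ → x < r → Goal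
      go-left σ₂ e refl go₂ regs x<r = iterate (nodes L + nodes R) (nodes L) (m≤m+n _ _) go≡ e
        (subst (λ res → Run seek σ₂ (Descended (nodes L) res mem)) (sym (info-left L R x<r))
          (run-descend {σ = σ₂} L (≤-trans (<⇒≤ (tree-≤ R)) j≤n) i≤x x<r encL go₂ regs))

      go-right : ∀ σ₂ {u} → Exec descend σ u σ₂ → imem σ₂ ≡ mem → ireg σ₂ %go ≡ 0 → Regs (descRegs (suc r) j (minors R)) σ₂ → r < x → Goal
      go-right σ₂ e refl go₂ regs r<x = iterate (nodes L + nodes R) (nodes R) (m≤n+m _ _) go≡ e
        (subst (λ res → Run seek σ₂ (Descended (nodes R) res mem)) (sym (info-right L R r<x))
          (run-descend {σ = σ₂} R j≤n r<x x<j encR go₂ regs))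

      stop : ∀ σ₂ {u} → Exec descend σ u σ₂ → x ≡ r → ireg σ₂ %x ≡ x → ireg σ₂ %go ≡ suc x → Emitted mem (rootPtr L , rootPtr R , t) σ₂ → Goal
      stop σ₂ e x≡r ex₂ go₂ em = iterate (nodes L + nodes R) 0 z≤n go≡ e
        (σ₂ , 2 , done (λ go≤x → 1+n≰n (subst₂ _≤_ go₂ ex₂ go≤x)) , ≤-refl , subst (λ res → Emitted mem res σ₂) (sym (info-here L R x≡r)) em)

      after-emit : x ≡ r → Run emit σ₁ (λ _ σ′ → ireg σ′ %go ≡ suc x × Emitted mem (rootPtr L , rootPtr R , t) σ′) → Goal
      after-emit x≡r (σ₂ , u , e , go₂ , em) = stop σ₂
        (e₁ ︔ holds (≤-reflexive (trans er (trans (sym x≡r) (sym ex)))) (holds (≤-reflexive (trans ex (trans x≡r (sym er)))) e))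
        x≡r (trans (keepI e %x) ex) go₂ em

      choose : _ → Goal
      choose (tri< x<r _ _) = go-left (execOps (mov %j %r ++ mov %k %a) σ₁)
        (e₁ ︔ fails (λ h → <⇒≱ x<r (subst₂ _≤_ er ex h)) ops) im₁ go₁ (ei , er , ea , ex , emin , emaj , size) x<r
      choose (tri> _ _ r<x) = go-right (execOps (next %i %r ++ mov %k %b) σ₁)
        (e₁ ︔ holds (subst₂ _≤_ (sym er) (sym ex) (<⇒≤ r<x)) (fails (λ h → <⇒≱ r<x (subst₂ _≤_ ex er h)) ops)) im₁ go₁
        (cong suc er , ej , eb , ex , emin , emaj , size) r<x
      choose (tri≈ _ refl _) = after-emit refl (subst (λ m → Run emit σ₁ (λ _ σ′ → ireg σ′ %go ≡ suc x × Emitted m (rootPtr L , rootPtr R , t) σ′)) im₁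
        (run-emit {σ = σ₁} L R j≤n (subst (λ m → Encodes m L) (sym im₁) encL) (subst (λ m → Encodes m R) (sym im₁) encR)
          (ei , ej , er , ea , eb , et , ex , emin , emaj , size)))

    run-descend leaf j≤n i≤x x<i = ⊥-elim (<⇒≱ x<i i≤x)
    run-descend {i} {j} {σ} (node r t L R) j≤n i≤x x<j (er , et , ea , encL , encR) go≡ (ei , ej , ek , ex , emin , emaj , en , eN , _) =
      run-node {σ = σ} L R j≤n i≤x x<j encL encR go≡ (execOps load σ) ops refl go≡
        (er₁ , ea₁ , trans (cong₂ _∸_ (cong₂ _∸_ ek et₁) ea₁) (minors-right t (minors L) (minors R) refl) , et₁ , ei , ej , ex , emin , emaj , en , eN , tt)
      where
      a₁ = (suc (ireg σ %n ∸ ireg σ %i) * ireg σ %N + ireg σ %j) * ireg σ %N + ireg σ %k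
      a≡ : a₁ ≡ idx i j (bit t + (minors L + minors R))
      a≡ = idx-cong en ei eN ej ek
      er₁ : imem σ (cell 0 a₁) ≡ r
      er₁ = trans (cong (λ a → imem σ (cell 0 a)) a≡) er
      et₁ : imem σ (cell 1 a₁) ≡ bit t
      et₁ = trans (cong (λ a → imem σ (cell 1 a)) a≡) et
      ea₁ : imem σ (cell 2 a₁) ≡ minors L
      ea₁ = trans (cong (λ a → imem σ (cell 2 a)) a≡) ea

module Output (𝓡 : OrderedRing) (n m : ℕ) (1≤n : 1 ≤ n) (tree : Tree 0 n) (minors≡ : minors tree ≡ m) (fmin₀ fmaj₀ : ℕ) where

  open Semantics 𝓡
  open Store
  open Tables n
  open Descent 𝓡 n

  colour : ℕ → Bool
  colour x = proj₂ (proj₂ (info tree x))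

  -- The counter of the level of `x` once all smaller keys are placed: each level is filled in key
  -- order.
  address : ℕ → ℕ
  address x = if colour x then count colour x + fmin₀ else count (not ∘ colour) x + fmaj₀

  record Written (x : ℕ) (mem : ℕ → ℕ) : Set where
    field
      left    : mem (cell 0 x) ≡ proj₁ (info tree x)
      right   : mem (cell 1 x) ≡ proj₁ (proj₂ (info tree x))
      placed  : mem (cell 2 x) ≡ address x

  loopRegs : ℕ → List (ℕ × ℕ)
  loopRegs x = (%l , n ∸ 1) ∷ (%m , m) ∷ (%x , x) ∷ (%fmin , count colour x + fmin₀) ∷ (%fmaj , count (not ∘ colour) x + fmaj₀) ∷ sizeRegs

  record KeyInv (x : ℕ) (σ : Store) : Set where
    field
      regs    : Regs (loopRegs x) σ
      encoded : Encodes (imem σ) tree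
      root≡   : imem σ 0 ≡ rootPtr tree
      cells   : ∀ {y} → y < x → Written y (imem σ)

  keyTime : ℕ
  keyTime = n * (2 + worst descend) + 10

  run-key : ∀ {x σ} → x ≤ n ∸ 1 → KeyInv x σ → Run key σ (λ u σ′ → u ≤ keyTime × KeyInv (suc x) σ′)
  run-key {x} {σ} x≤n-1 inv = go regs
    where
    open KeyInv inv
    x<n : x < n
    x<n = ≤-trans (s≤s x≤n-1) (≤-reflexive (m+[n∸m]≡n 1≤n))
    open Key x x<n (count colour x + fmin₀) (count (not ∘ colour) x + fmaj₀)

    finish : ∀ {σ′} → ireg σ′ %l ≡ n ∸ 1 → ireg σ′ %m ≡ m → ireg σ′ %x ≡ x → Regs sizeRegs σ′ →
      Emitted (imem σ) (info tree x) σ′ → KeyInv (suc x) (execOps (inc %x) σ′)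
    finish {σ′} el em ex size emitted = record
      { regs = el , em , cong suc ex , trans E.fmin≡ (sym (+-assoc (bit (colour x)) _ _)) , trans E.fmaj≡ (sym (+-assoc (bit (not (colour x))) _ _)) , size
      ; encoded = encodes-agree {lower = suc n * suc n} (λ f<3 N*N≤a _ → same f<3 (λ a≡x → <⇒≢ (<-≤-trans x<N*N N*N≤a) (sym a≡x))) ≤-refl tree ≤-refl ≤-refl encoded
      ; root≡ = trans (cong (λ mem → mem 0) E.written≡) root≡
      ; cells = λ y<1+x → cells′ (m≤n⇒m<n∨m≡n (≤-pred y<1+x)) }
      where
      module E = Emitted emitted
      p = proj₁ (info tree x)
      q = proj₁ (proj₂ (info tree x))
      same : ∀ {f a} → f < 3 → a ≢ x → imem σ′ (cell f a) ≡ imem σ (cell f a)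
      same {f} {a} f<3 a≢x = trans (cong (λ mem → mem (cell f a)) E.written≡) (written-≢ (imem σ) x p q (address x) f<3 a≢x)
      x<N*N : x < suc n * suc n
      x<N*N = ≤-trans x<n (≤-trans (n≤1+n n) (m≤m*n (suc n) (suc n)))
      cells′ : ∀ {y} → y < x ⊎ y ≡ x → Written y (imem σ′)
      cells′ {y} (inj₁ y<x) = record
        { left = trans (same (s≤s z≤n) (<⇒≢ y<x)) C.left
        ; right = trans (same 1<3 (<⇒≢ y<x)) C.right
        ; placed = trans (same 2<3 (<⇒≢ y<x)) C.placed }
        where
        module C = Written (cells y<x)
      cells′ (inj₂ refl) = record
        { left = trans (cong (λ mem → mem (cell 0 x)) E.written≡) (written-0 (imem σ) x p q (address x))
        ; right = trans (cong (λ mem → mem (cell 1 x)) E.written≡) (written-1 (imem σ) x p q (address x))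
        ; placed = trans (cong (λ mem → mem (cell 2 x)) E.written≡) (written-2 (imem σ) x p q (address x)) }

    go : Regs (loopRegs x) σ →
      Run key σ (λ u σ′ → u ≤ keyTime × KeyInv (suc x) σ′)
    go (el , em , ex , emin , emaj , en , eN , _) = run-ops (run-seq
      (run-descend tree ≤-refl z≤n x<n encoded refl (refl , en , trans em (sym minors≡) , ex , emin , emaj , en , eN , tt))
      λ {σ₁} {u} e (u≤ , emitted) → run-skip (
        (begin
          6 + (u + 2)                                                 ≤⟨ +-monoʳ-≤ 6 (+-monoˡ-≤ 2 u≤) ⟩
          6 + (nodes tree * (2 + worst descend) + 2 + 2)              ≡⟨ cong (λ k → 6 + (k * (2 + worst descend) + 2 + 2)) (trans (sym (+-identityʳ _)) (nodes-≡ tree)) ⟩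
          6 + (n * (2 + worst descend) + 2 + 2)                       ≡⟨ cong (6 +_) (+-assoc (n * (2 + worst descend)) 2 2) ⟩
          6 + (n * (2 + worst descend) + 4)                           ≡⟨ +-comm 6 _ ⟩
          n * (2 + worst descend) + 4 + 6                             ≡⟨ +-assoc (n * (2 + worst descend)) 4 6 ⟩
          keyTime                                                     ∎) ,
        finish (trans (keepI e %l) el) (trans (keepI e %m) em) (trans (keepI e %x) ex) (keepRegs e sizeRegs (en , eN , tt)) emitted))
      where
      open ≤-Reasoning

  startRegs : List (ℕ × ℕ)
  startRegs = (%m , m) ∷ (%fmin , fmin₀) ∷ (%fmaj , fmaj₀) ∷ sizeRegs

  outputTime : ℕ
  outputTime = worst pointer + 12 + n * (2 + keyTime)

  run-output : ∀ {σ} → Regs startRegs σ → Encodes (imem σ) tree →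
    Run output σ (λ u σ′ → u ≤ outputTime × imem σ′ 0 ≡ rootPtr tree × (∀ {x} → x < n → Written x (imem σ′)))
  run-output {σ} (em , emin , emaj , en , eN , _) enc = run-ops (run-seq
    (run-pointer {σ = execOps whole σ} (refl , en , em , en , eN , tt) tree minors≡ enc)
    λ {σ₁} {t₁} e₁ p≡ → run-ops (after e₁ p≡ (keepIM e₁)
      (keepRegs e₁ startRegs (em , emin , emaj , en , eN , tt))))
    where
    after : ∀ {σ₁ t₁} → Exec pointer (execOps whole σ) t₁ σ₁ →
      ireg σ₁ %p ≡ rootPtr tree → imem σ₁ ≡ imem σ →
      Regs startRegs σ₁ →
      Run (while (%x ≤ᴵ %l) key) (execOps setup σ₁)
        (λ u σ′ → 5 + (t₁ + (5 + u)) ≤ outputTime × imem σ′ 0 ≡ rootPtr tree × (∀ {x} → x < n → Written x (imem σ′)))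
    after {σ₁} {t₁} e₁ p≡ im (em , emin , emaj , en , eN , _) = run-map
      (run-for KeyInv keyTime (λ inv → let el , _ , ex , _ = KeyInv.regs inv in ex , el) run-key n {0} (sym (m+[n∸m]≡n 1≤n))
        (record
          { regs = cong (_∸ 1) en , em , refl , emin , emaj , en , eN , tt
          ; encoded = encodes-agree {lower = 0} (λ {f} {a} _ _ _ → cong (λ mem → mem (cell f a)) im) z≤n tree ≤-refl ≤-refl enc
          ; root≡ = p≡ ; cells = λ () }))
      λ {σ′} {u} _ (u≤ , inv) →
        (begin
          5 + (t₁ + (5 + u))                                     ≤⟨ +-monoʳ-≤ 5 (+-mono-≤ (time e₁) (+-monoʳ-≤ 5 u≤)) ⟩
          5 + (worst pointer + (5 + (n * (2 + keyTime) + 2)))    ≡⟨ lemma (worst pointer) (n * (2 + keyTime)) ⟩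
          outputTime                                             ∎) ,
        KeyInv.root≡ inv , (λ x<n → KeyInv.cells inv (≤-trans x<n (≤-reflexive (sym (m+[n∸m]≡n 1≤n)))))
      where
      open ≤-Reasoning
      open +-*-Solver
      lemma : ∀ a b → 5 + (a + (5 + (b + 2))) ≡ a + 12 + b
      lemma = solve 2 (λ a b → con 5 :+ (a :+ (con 5 :+ (b :+ con 2))) := a :+ con 12 :+ b) refl

-- Counting and addresses

count-cong : ∀ {f g} n → (∀ {x} → x < n → f x ≡ g x) → count f n ≡ count g n
count-cong zero    eq = refl
count-cong (suc n) eq = cong₂ (λ b c → bit b + c) (eq ≤-refl) (count-cong n (λ x<n → eq (m≤n⇒m≤1+n x<n)))

count-mono : ∀ f {x y} → x ≤ y → count f x ≤ count f y
count-mono f {y = zero}  z≤n = z≤n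
count-mono f {y = suc y} x≤1+y with m≤n⇒m<n∨m≡n x≤1+y
... | inj₁ x<1+y = ≤-trans (count-mono f (≤-pred x<1+y)) (m≤n+m (count f y) (bit (f y)))
... | inj₂ refl  = ≤-refl

count-< : ∀ f {x y} → f x ≡ true → x < y → count f x < count f y
count-< f {x} fx x<y = ≤-trans (≤-reflexive (cong (λ b → bit b + count f x) (sym fx))) (count-mono f x<y)

count-not : ∀ f n → count f n + count (not ∘ f) n ≡ n
count-not f zero    = refl
count-not f (suc n) with f n
... | true  = cong suc (count-not f n)
... | false = trans (+-suc (count f n) _) (cong suc (count-not f n))

count-∨ : ∀ {f g h} n → (∀ {x} → x < n → bit (f x) ≤ bit (g x) + bit (h x)) → count f n ≤ count g n + count h n
count-∨ zero le = z≤n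
count-∨ {f} {g} {h} (suc n) le = begin
  bit (f n) + count f n                                ≤⟨ +-mono-≤ (le ≤-refl) (count-∨ n (λ x<n → le (m≤n⇒m≤1+n x<n))) ⟩
  bit (g n) + bit (h n) + (count g n + count h n)      ≡⟨ solve 4 (λ a b c d → a :+ b :+ (c :+ d) := a :+ c :+ (b :+ d)) refl (bit (g n)) (bit (h n)) (count g n) (count h n) ⟩
  bit (g n) + count g n + (bit (h n) + count h n)      ∎
  where
  open ≤-Reasoning
  open +-*-Solver

count-none : ∀ f n → (∀ {x} → x < n → f x ≡ false) → count f n ≡ 0
count-none f zero    none = refl
count-none f (suc n) none rewrite none {n} ≤-refl = count-none f n (λ x<n → none (m≤n⇒m≤1+n x<n))

count-all : ∀ f n → (∀ {x} → x < n → f x ≡ true) → count f n ≡ n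
count-all f zero    all = refl
count-all f (suc n) all rewrite all {n} ≤-refl = cong suc (count-all f n (λ x<n → all (m≤n⇒m≤1+n x<n)))

module _ (f : ℕ → ℕ) (n : ℕ) (f-injective : ∀ {x y} → x < n → y < n → f x ≡ f y → x ≡ y) where

  count-fibre : ∀ b k → k ≤ n → count (λ x → does (f x ≟ b)) k ≤ 1
  count-fibre b zero    k≤n = z≤n
  count-fibre b (suc k) k<n with f k ≟ b in eq
  ... | no  _    = ≤-trans (≤-reflexive (cong (λ c → bit c + count (λ x → does (f x ≟ b)) k) (cong does eq))) (count-fibre b k (<⇒≤ k<n))
  ... | yes fk≡b = ≤-reflexive (cong₂ (λ c d → bit c + d) (cong does eq) (count-none _ k λ {x} x<k →
          dec-false (f x ≟ b) (λ fx≡b → <⇒≢ x<k (f-injective (<-trans x<k k<n) k<n (trans fx≡b (sym fk≡b))))))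

  below : ℕ → ℕ
  below b = count (λ x → does (f x <? b)) n

  below-suc : ∀ b → below (suc b) ≤ below b + 1
  below-suc b = ≤-trans (count-∨ n (λ {x} _ → le x)) (+-monoʳ-≤ (below b) (count-fibre b n ≤-refl))
    where
    le : ∀ x → bit (does (f x <? suc b)) ≤ bit (does (f x <? b)) + bit (does (f x ≟ b))
    le x with <-cmp (f x) b
    ... | tri< lt _ _ rewrite dec-true (f x <? b) lt = ≤-trans (bit≤1 _) (m≤m+n 1 _)
    ... | tri≈ _ eq _ rewrite dec-true (f x ≟ b) eq = ≤-trans (bit≤1 _) (m≤n+m 1 _)
    ... | tri> _ _ gt rewrite dec-false (f x <? suc b) (λ lt → <⇒≱ gt (≤-pred lt)) = z≤n

  below-≤ : ∀ b → below b ≤ b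
  below-≤ zero    = ≤-reflexive (count-none _ n (λ {x} _ → dec-false (f x <? 0) λ ()))
  below-≤ (suc b) = ≤-trans (below-suc b) (≤-trans (+-monoˡ-≤ 1 (below-≤ b)) (≤-reflexive (+-comm b 1)))

  below-+ : ∀ b d → below (d + b) ≤ below b + d
  below-+ b zero    = m≤m+n _ 0
  below-+ b (suc d) = ≤-trans (below-suc (d + b)) (≤-trans (+-monoˡ-≤ 1 (below-+ b d))
    (≤-reflexive (trans (+-assoc (below b) d 1) (cong (below b +_) (+-comm d 1)))))

  -- A pigeonhole argument: `below` starts at 0 and grows by at most 1 per step, yet reaches `n` at
  -- `n`, so it grows by exactly 1 at every step.
  below-≡ : (∀ {x} → x < n → f x < n) → ∀ {b} → b ≤ n → below b ≡ b
  below-≡ f<n {b} b≤n = ≤-antisym (below-≤ b) (+-cancelʳ-≤ (n ∸ b) b (below b) (begin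
    b + (n ∸ b)         ≡⟨ m+[n∸m]≡n b≤n ⟩
    n                   ≡⟨ count-all _ n (λ {x} x<n → dec-true (f x <? n) (f<n x<n)) ⟨
    below n             ≡⟨ cong below (m∸n+n≡m b≤n) ⟨
    below (n ∸ b + b)   ≤⟨ below-+ b (n ∸ b) ⟩
    below b + (n ∸ b)   ∎))
    where
    open ≤-Reasoning

module Placement (n m₁ : ℕ) (cheap : ℕ → Bool) (count-cheap : count cheap n ≡ m₁) where

  position : ℕ → ℕ
  position x = if cheap x then count cheap x else count (not ∘ cheap) x + m₁

  position-cheap : ∀ {x} → cheap x ≡ true → position x ≡ count cheap x
  position-cheap {x} eq = cong (λ c → if c then count cheap x else count (not ∘ cheap) x + m₁) eq

  position-dear : ∀ {x} → cheap x ≡ false → position x ≡ count (not ∘ cheap) x + m₁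
  position-dear {x} eq = cong (λ c → if c then count cheap x else count (not ∘ cheap) x + m₁) eq

  position-cheap-< : ∀ {x} → x < n → cheap x ≡ true → position x < m₁
  position-cheap-< {x} x<n eq = subst₂ _<_ (sym (position-cheap eq)) count-cheap (count-< cheap eq x<n)

  position-dear-≥ : ∀ {x} → cheap x ≡ false → m₁ ≤ position x
  position-dear-≥ {x} eq = ≤-trans (m≤n+m m₁ _) (≤-reflexive (sym (position-dear eq)))

  position-<? : ∀ {x} → x < n → does (position x <? m₁) ≡ cheap x
  position-<? {x} x<n with cheap x in eq
  ... | true  = dec-true (_ <? m₁) (subst (_< m₁) (position-cheap eq) (position-cheap-< x<n eq))
  ... | false = dec-false (_ <? m₁) (λ lt → <⇒≱ lt (subst (m₁ ≤_) (position-dear eq) (position-dear-≥ eq)))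

  position-< : ∀ {x} → x < n → position x < n
  position-< {x} x<n = go (cheap x) refl
    where
    m₁+ : count (not ∘ cheap) n + m₁ ≡ n
    m₁+ = trans (+-comm _ m₁) (trans (cong (_+ count (not ∘ cheap) n) (sym count-cheap)) (count-not cheap n))
    go : ∀ c → cheap x ≡ c → position x < n
    go true  eq = <-≤-trans (position-cheap-< x<n eq) (≤-trans (m≤n+m m₁ _) (≤-reflexive m₁+))
    go false eq = <-≤-trans (subst (_< count (not ∘ cheap) n + m₁) (sym (position-dear eq))
                    (+-monoˡ-< m₁ (count-< (not ∘ cheap) (cong not eq) x<n))) (≤-reflexive m₁+)

  position-≢ : ∀ {x y} → x < y → y < n → position x ≢ position y
  position-≢ {x} {y} x<y y<n = go (cheap x) (cheap y) refl refl
    where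
    go : ∀ c d → cheap x ≡ c → cheap y ≡ d → position x ≢ position y
    go true  true  p q eq = <⇒≢ (count-< cheap p x<y) (trans (sym (position-cheap p)) (trans eq (position-cheap q)))
    go false false p q eq = <⇒≢ (count-< (not ∘ cheap) (cong not p) x<y) (+-cancelʳ-≡ m₁ _ _ (trans (sym (position-dear p)) (trans eq (position-dear q))))
    go true  false p q eq = <⇒≱ (position-cheap-< (<-trans x<y y<n) p) (subst (m₁ ≤_) (sym eq) (position-dear-≥ q))
    go false true  p q eq = <⇒≱ (position-cheap-< y<n q) (subst (m₁ ≤_) eq (position-dear-≥ p))

  position-injective : ∀ {x y} → x < n → y < n → position x ≡ position y → x ≡ y
  position-injective {x} {y} x<n y<n eq with <-cmp x y
  ... | tri< x<y _ _ = ⊥-elim (position-≢ x<y y<n eq)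
  ... | tri≈ _ x≡y _ = x≡y
  ... | tri> _ _ y<x = ⊥-elim (position-≢ y<x x<n (sym eq))

-- Correspondence between coloured trees and solutions

data Match {n : ℕ} (τ : ℕ → Bool) : ∀ {a b} {i j : Fin (suc n)} → Tree a b → BST i j → Set where
  leaf : ∀ {a j} → toℕ j ≡ a → Match τ (leaf {a}) (leaf {j = j})
  node : ∀ {a b r t i j} {k : Fin n} {L : Tree a r} {R : Tree (suc r) b} {l : BST i (inject₁ k)} {r′ : BST (fsuc k) j} →
         toℕ k ≡ r → t ≡ τ r → Match τ L l → Match τ R r′ → Match τ (node r t L R) (node k l r′)

match-to : ∀ {n τ a b} (T : Tree a b) {i j : Fin (suc n)} → b ≤ n → toℕ i ≡ a → toℕ j ≡ b →
  (∀ {x} → a ≤ x → x < b → proj₂ (proj₂ (info T x)) ≡ τ x) → Σ (BST i j) (Match τ T)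
match-to leaf b≤n ei ej eq with toℕ-injective (trans ei (sym ej))
... | refl = leaf , leaf ei
match-to {n} {τ} {a} {b} (node r t L R) {i} {j} b≤n ei ej eq =
  let l , ml = match-to L {i} {inject₁ k} (<⇒≤ r<n) ei (trans (toℕ-inject₁ k) ek)
                 (λ a≤x x<r → trans (cong (proj₂ ∘ proj₂) (sym (info-left L R x<r))) (eq a≤x (<-trans x<r (tree-≤ R))))
      r′ , mr = match-to R {fsuc k} {j} b≤n (cong suc ek) ej
                 (λ r<x x<b → trans (cong (proj₂ ∘ proj₂) (sym (info-right L R r<x))) (eq (≤-trans (tree-≤ L) (<⇒≤ r<x)) x<b))
  in node k l r′ , node ek (trans (cong (proj₂ ∘ proj₂) (sym (info-here L R refl))) (eq (tree-≤ L) (tree-≤ R))) ml mr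
  where
  r<n : r < n
  r<n = ≤-trans (tree-≤ R) b≤n
  k = fromℕ< r<n
  ek : toℕ k ≡ r
  ek = toℕ-fromℕ< r<n

match-from : ∀ {n} τ {a b} {i j : Fin (suc n)} (t : BST i j) → toℕ i ≡ a → toℕ j ≡ b → Σ (Tree a b) λ T → Match τ T t
match-from τ leaf refl refl = leaf , leaf refl
match-from τ (node k l r) ei ej =
  let L , ml = match-from τ l ei (toℕ-inject₁ k)
      R , mr = match-from τ r refl ej
  in node (toℕ k) (τ (toℕ k)) L R , node refl refl ml mr

-- This turns the number of marked nodes into a number of keys, and so relates the count of an entry
-- to the size of a memory level.
match-minors : ∀ {n τ a b} {i j : Fin (suc n)} {T : Tree a b} {t : BST i j} → Match τ T t → minors T + count τ a ≡ count τ b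
match-minors (leaf _) = refl
match-minors {τ = τ} {a} {b} (node {r = r} {L = L} {R} refl refl ml mr) = begin
  bit (τ r) + (minors L + minors R) + count τ a     ≡⟨ solve 4 (λ t l r c → t :+ (l :+ r) :+ c := r :+ (t :+ (l :+ c))) refl (bit (τ r)) (minors L) (minors R) (count τ a) ⟩
  minors R + (bit (τ r) + (minors L + count τ a))   ≡⟨ cong (λ c → minors R + (bit (τ r) + c)) (match-minors ml) ⟩
  minors R + count τ (suc r)                        ≡⟨ match-minors mr ⟩
  count τ b                                         ∎
  where
  open ≡-Reasoning
  open +-*-Solver

module Outputting (𝓡 : OrderedRing) where
  open RAM 𝓡 using (PointsTo)

  match-points : ∀ {n τ a b} {i j : Fin (suc n)} {T : Tree a b} {t : BST i j} (mem : ℕ → ℕ) → Match τ T t →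
    (∀ {x} → a ≤ x → x < b → mem (1 + 3 * x) ≡ proj₁ (info T x) × mem (2 + 3 * x) ≡ proj₁ (proj₂ (info T x))) →
    ∀ {v} → v ≡ rootPtr T → PointsTo mem v t
  match-points mem (leaf _) cells v≡ = v≡
  match-points mem (node {r = r} {L = L} {R} refl _ ml mr) cells v≡ = v≡ ,
    match-points mem ml (λ a≤x x<r → let p , q = cells a≤x (<-trans x<r (tree-≤ R)) ; eq = info-left L R x<r in
                           trans p (cong proj₁ eq) , trans q (cong (proj₁ ∘ proj₂) eq))
                 (trans (proj₁ (cells (tree-≤ L) (tree-≤ R))) (cong proj₁ (info-here L R refl))) ,
    match-points mem mr (λ r<x x<b → let p , q = cells (≤-trans (tree-≤ L) (<⇒≤ r<x)) x<b ; eq = info-right L R r<x in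
                           trans p (cong proj₁ eq) , trans q (cong (proj₁ ∘ proj₂) eq))
                 (trans (proj₂ (cells (tree-≤ L) (tree-≤ R))) (cong (proj₁ ∘ proj₂) (info-here L R refl)))

module MatchCost (𝓡 : OrderedRing) (I : Instance 𝓡) (inp : ℕ → OrderedRing.Carrier 𝓡) (cmin cmaj : ℕ)
  (q-in : ∀ j → inp (2 * toℕ j) ≡ Instance.q I j) (p-in : ∀ k → inp (suc (2 * toℕ k)) ≡ Instance.p I k) where

  open Order 𝓡
  open Instance I using (n; μ; w; internalCost; externalCost)

  C : Bool → Carrier
  C t = fromNat (if t then cmin else cmaj)

  open Costs 𝓡 inp C

  -- In inorder the leaves and keys of a tree are consecutive input cells, so each subtree and key
  -- extends the prefix sum reached before it.
  prefix-match : ∀ {τ a b} {i j : Fin (suc n)} {T : Tree a b} {t : BST i j} → Match τ T t →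
                 prefix (2 * a) +R w t ≈ prefix (suc (2 * b))
  prefix-match (leaf {j = j} refl) = O.+-cong ≈-refl (≡⇒≈ (sym (q-in j)))
  prefix-match {a = a} {b} (node {r = r} {k = k} {l = l} {r′} refl _ ml mr) = begin-equality
    prefix (2 * a) +R (w l +R p k +R w r′)        ≈⟨ solve 4 (λ x l p r → x ⊕ ((l ⊕ p) ⊕ r) ⊜ ((x ⊕ l) ⊕ p) ⊕ r) ≈-refl _ _ _ _ ⟩
    prefix (2 * a) +R w l +R p k +R w r′          ≈⟨ O.+-cong (O.+-cong (prefix-match ml) (≡⇒≈ (sym (p-in k)))) ≈-refl ⟩
    prefix (suc (suc (2 * r))) +R w r′            ≡⟨ cong (λ x → prefix x +R w r′) (*-suc 2 r) ⟨
    prefix (2 * suc r) +R w r′                    ≈⟨ prefix-match mr ⟩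
    prefix (suc (2 * b))                          ∎
    where
    open R-Reasoning
    open R-Solver
    open Instance I using (p)

  weight-match : ∀ {τ a b} {i j : Fin (suc n)} {T : Tree a b} {t : BST i j} → Match τ T t → w t ≈ W a b
  weight-match {a = a} {b} {t = t} mt = begin-equality
    w t                                           ≈⟨ O.+-identityʳ _ ⟨
    w t +R 0#                                     ≈⟨ O.+-cong ≈-refl (O.-‿inverseʳ (prefix (2 * a))) ⟨
    w t +R (prefix (2 * a) -R prefix (2 * a))     ≈⟨ solve 3 (λ w p q → w ⊕ (p ⊕ q) ⊜ (p ⊕ w) ⊕ q) ≈-refl _ _ _ ⟩
    (prefix (2 * a) +R w t) -R prefix (2 * a)     ≈⟨ O.+-cong (prefix-match mt) ≈-refl ⟩
    W a b                                         ∎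
    where
    open R-Reasoning
    open R-Solver

  cost-match : ∀ {τ φ} → (∀ k → μ (φ k) ≡ (if τ (toℕ k) then cmin else cmaj)) →
    ∀ c {a b} {i j : Fin (suc n)} {T : Tree a b} {t : BST i j} → Match τ T t →
    internalCost φ t +R externalCost c φ t ≈ cost (fromNat c) T
  cost-match eq c (leaf {j = j} refl) = ≈-trans (O.+-identityˡ _) (O.*-cong (≡⇒≈ (sym (q-in j))) ≈-refl)
  cost-match {τ} {φ} eq c {a} {b} mt@(node {r = r} {k = k} {L = L} {R} {l} {r′} refl refl ml mr) = begin-equality
    (internalCost φ l +R w (node k l r′) *R fromNat (μ (φ k)) +R internalCost φ r′) +R (externalCost (μ (φ k)) φ l +R externalCost (μ (φ k)) φ r′)
      ≈⟨ solve 5 (λ i x i′ e e′ → ((i ⊕ x) ⊕ i′) ⊕ (e ⊕ e′) ⊜ (x ⊕ (i ⊕ e)) ⊕ (i′ ⊕ e′)) ≈-refl _ _ _ _ _ ⟩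
    w (node k l r′) *R fromNat (μ (φ k)) +R (internalCost φ l +R externalCost (μ (φ k)) φ l) +R (internalCost φ r′ +R externalCost (μ (φ k)) φ r′)
      ≈⟨ O.+-cong (O.+-cong (O.*-cong (weight-match mt) ≈-refl) (cost-match eq (μ (φ k)) ml)) (cost-match eq (μ (φ k)) mr) ⟩
    W a b *R fromNat (μ (φ k)) +R cost (fromNat (μ (φ k))) L +R cost (fromNat (μ (φ k))) R
      ≡⟨ cong (λ c → W a b *R fromNat c +R cost (fromNat c) L +R cost (fromNat c) R) (eq k) ⟩
    cost (fromNat c) (node {a} {b} r (τ (toℕ k)) L R) ∎
    where
    open R-Reasoning
    open R-Solver

half : ∀ a → Σ ℕ λ j → a ≡ 2 * j ⊎ a ≡ suc (2 * j)
half zero    = 0 , inj₁ refl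
half (suc a) with half a
... | j , inj₁ refl = j , inj₂ refl
... | j , inj₂ refl = suc j , inj₁ (sym (*-suc 2 j))

-- The smaller level may be the cheap or the expensive one: cheap t says whether
-- the colour t stands for the cheap level.
record Levels (m₁ m₂ c₁ c₂ m cmin cmaj fmin fmaj : ℕ) : Set where
  field
    cheap      : Bool → Bool
    involutive : ∀ t → cheap (cheap t) ≡ t
    level-cost : ∀ t → (if t then cmin else cmaj) ≡ (if cheap t then c₁ else c₂)
    to-cheap   : ∀ {f} → count f (m₁ + m₂) ≡ m → count (cheap ∘ f) (m₁ + m₂) ≡ m₁
    from-cheap : ∀ {f} → count f (m₁ + m₂) ≡ m₁ → count (cheap ∘ f) (m₁ + m₂) ≡ m
    addresses  : ∀ f x → (if f x then count f x + fmin else count (not ∘ f) x + fmaj) ≡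
                         suc (if cheap (f x) then count (cheap ∘ f) x else count (not ∘ (cheap ∘ f)) x + m₁)

levels₁ : ∀ {m₁ m₂ c₁ c₂ m} → m ≡ m₁ → Levels m₁ m₂ c₁ c₂ m c₁ c₂ 1 (suc m₁)
levels₁ {m₁} refl = record
  { cheap = λ t → t ; involutive = λ _ → refl ; level-cost = λ _ → refl
  ; to-cheap = λ eq → eq ; from-cheap = λ eq → eq ; addresses = λ f x → lemma f x (f x) }
  where
  lemma : ∀ f x t → (if t then count f x + 1 else count (not ∘ f) x + suc m₁) ≡ suc (if t then count f x else count (not ∘ f) x + m₁)
  lemma f x true  = +-comm (count f x) 1
  lemma f x false = +-suc _ m₁

levels₂ : ∀ {m₁ m₂ c₁ c₂ m} → m ≡ m₂ → Levels m₁ m₂ c₁ c₂ m c₂ c₁ (suc m₁) 1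
levels₂ {m₁} {m₂} {c₁} {c₂} refl = record
  { cheap = not ; involutive = not-involutive
  ; level-cost = λ { true → refl ; false → refl }
  ; to-cheap = λ {f} eq → +-cancelˡ-≡ m₂ _ _ (trans (cong (_+ count (not ∘ f) (m₁ + m₂)) (sym eq)) (trans (count-not f (m₁ + m₂)) (+-comm m₁ m₂)))
  ; from-cheap = λ {f} eq → +-cancelˡ-≡ m₁ _ _ (trans (cong (_+ count (not ∘ f) (m₁ + m₂)) (sym eq)) (count-not f (m₁ + m₂)))
  ; addresses = λ f x → lemma f x (f x) }
  where
  lemma : ∀ f x t → (if t then count f x + suc m₁ else count (not ∘ f) x + 1) ≡
                    suc (if not t then count (not ∘ f) x else count (not ∘ (not ∘ f)) x + m₁)
  lemma f x true  = trans (+-suc _ m₁) (cong (λ c → suc (c + m₁)) (count-cong x (λ {y} _ → sym (not-involutive (f y)))))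
  lemma f x false = +-comm (count (not ∘ f) x) 1

-- The total running time

-- `g + p + d + 87` is the value of the left side at `n ≡ 1`, and that side grows at most
-- quadratically. With `n` written as `suc k`, the difference is the polynomial that is added.
small-terms-≤ : ∀ g p d {n} → 1 ≤ n → g + 3 + suc n * 29 + (p + 12 + n * (2 + (n * (2 + d) + 10))) ≤ (g + p + d + 87) * (n * n)
small-terms-≤ g p d {suc k} (s≤s z≤n) = ≤-trans (m≤m+n _ ((g + p) * (2 * k + k * k) + (129 * k + 85 * (k * k))))
  (≤-reflexive (solve 4 (λ g p d k →
    g :+ con 3 :+ (con 2 :+ k) :* con 29 :+ (p :+ con 12 :+ (con 1 :+ k) :* (con 2 :+ ((con 1 :+ k) :* (con 2 :+ d) :+ con 10)))
    :+ ((g :+ p) :* (con 2 :* k :+ k :* k) :+ (con 129 :* k :+ con 85 :* (k :* k)))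
    := (g :+ p :+ d :+ con 87) :* ((con 1 :+ k) :* (con 1 :+ k))) refl g p d k))
  where
  open +-*-Solver

suc≤2* : ∀ {n} → 1 ≤ n → suc n ≤ 2 * n
suc≤2* {n} 1≤n = ≤-trans (+-monoˡ-≤ n 1≤n) (≤-reflexive (cong (n +_) (sym (+-identityʳ n))))

total-one-level : ∀ g p d z {n} → 1 ≤ n →
  g + 3 + suc n * (z * (3 * n) + 29) + (p + 12 + n * (2 + (n * (2 + d) + 10))) ≤ (g + p + d + 87 + 16 * z) * (n * n)
total-one-level g p d z {n} 1≤n = begin
  g + 3 + suc n * (z * (3 * n) + 29) + r                  ≡⟨ solve 5 (λ g k z x r → g :+ con 3 :+ k :* (z :+ con 29) :+ r := k :* z :+ (g :+ con 3 :+ k :* con 29 :+ r)) refl g (suc n) (z * (3 * n)) n r ⟩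
  suc n * (z * (3 * n)) + (g + 3 + suc n * 29 + r)        ≤⟨ +-mono-≤ (*-monoˡ-≤ (z * (3 * n)) (suc≤2* 1≤n)) (small-terms-≤ g p d 1≤n) ⟩
  -- The term in `z` is only `6 * z * (n * n)`; the slack raises 6 to the 16 of `total-two-level`,
  -- so that one factor serves both cases.
  2 * n * (z * (3 * n)) + h * (n * n)                     ≤⟨ m≤m+n _ (10 * z * (n * n)) ⟩
  2 * n * (z * (3 * n)) + h * (n * n) + 10 * z * (n * n)  ≡⟨ solve 3 (λ n z h → con 2 :* n :* (z :* (con 3 :* n)) :+ h :* (n :* n) :+ con 10 :* z :* (n :* n) := (h :+ con 16 :* z) :* (n :* n)) refl n z h ⟩
  (h + 16 * z) * (n * n)                                  ∎
  where
  open ≤-Reasoning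
  open +-*-Solver
  r = p + 12 + n * (2 + (n * (2 + d) + 10))
  h = g + p + d + 87

-- The 16 arises from four estimates `suc x ≤ 2 * x`, two for `n` and two for `m`.
total-two-level : ∀ g p d z {m n} → 1 ≤ m → 1 ≤ n →
  g + 3 + suc n * (n * (suc m * suc m * z * suc n) + 29) + (p + 12 + n * (2 + (n * (2 + d) + 10))) ≤
  (g + p + d + 87 + 16 * z) * (m * m * (n * n * n))
total-two-level g p d z {m} {n} 1≤m 1≤n = begin
  g + 3 + suc n * (n * (suc m * suc m * z * suc n) + 29) + r
    ≡⟨ solve 5 (λ g k z x r → g :+ con 3 :+ k :* (z :+ con 29) :+ r := k :* z :+ (g :+ con 3 :+ k :* con 29 :+ r)) refl g (suc n) (n * (suc m * suc m * z * suc n)) n r ⟩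
  suc n * (n * (suc m * suc m * z * suc n)) + (g + 3 + suc n * 29 + r)
    ≤⟨ +-mono-≤ (*-mono-≤ (suc≤2* 1≤n) (*-monoʳ-≤ n (*-mono-≤ (*-monoˡ-≤ z (*-mono-≤ (suc≤2* 1≤m) (suc≤2* 1≤m))) (suc≤2* 1≤n)))) (small-terms-≤ g p d 1≤n) ⟩
  2 * n * (n * (2 * m * (2 * m) * z * (2 * n))) + h * (n * n)
    ≤⟨ +-monoʳ-≤ (2 * n * (n * (2 * m * (2 * m) * z * (2 * n)))) (*-monoʳ-≤ h (≤-trans (m≤n*m (n * n) (m * m * n) {{m*m*n≢0}}) (≤-reflexive (solve 2 (λ m n → m :* m :* n :* (n :* n) := m :* m :* (n :* n :* n)) refl m n)))) ⟩
  2 * n * (n * (2 * m * (2 * m) * z * (2 * n))) + h * (m * m * (n * n * n))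
    ≡⟨ solve 4 (λ n m z h → con 2 :* n :* (n :* (con 2 :* m :* (con 2 :* m) :* z :* (con 2 :* n))) :+ h :* (m :* m :* (n :* n :* n)) := (h :+ con 16 :* z) :* (m :* m :* (n :* n :* n))) refl n m z h ⟩
  (h + 16 * z) * (m * m * (n * n * n)) ∎
  where
  open ≤-Reasoning
  open +-*-Solver
  r = p + 12 + n * (2 + (n * (2 + d) + 10))
  h = g + p + d + 87
  m*m*n≢0 : NonZero (m * m * n)
  m*m*n≢0 = >-nonZero (*-mono-≤ (*-mono-≤ 1≤m 1≤m) 1≤n)

-- As m ≤ n ∸ m, also n ≤ 2 (n ∸ m).
m²n³-≤ : ∀ {m n} → m + m ≤ n → m * m * (n * n * n) ≤ 2 * (m * n ^ 2 * (n ∸ m) ^ 2)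
m²n³-≤ {m} {n} 2m≤n = begin
  m * m * (n * n * n)              ≡⟨ solve 2 (λ m n → m :* m :* (n :* n :* n) := m :* (n :* n) :* (m :* n)) refl m n ⟩
  m * (n * n) * (m * n)            ≤⟨ *-monoʳ-≤ (m * (n * n)) (*-mono-≤ m≤e n≤2e) ⟩
  m * (n * n) * (e * (2 * e))      ≡⟨ solve 3 (λ m n e → m :* (n :* n) :* (e :* (con 2 :* e)) := con 2 :* (m :* (n :* (n :* con 1)) :* (e :* (e :* con 1)))) refl m n e ⟩
  2 * (m * n ^ 2 * e ^ 2)          ∎
  where
  open ≤-Reasoning
  open +-*-Solver
  e = n ∸ m
  m≤e : m ≤ e
  m≤e = m+n≤o⇒m≤o∸n m 2m≤n
  n≤2e : n ≤ 2 * e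
  n≤2e = ≤-trans (≤-reflexive (sym (m+[n∸m]≡n (≤-trans (m≤m+n m m) 2m≤n)))) (≤-trans (+-monoˡ-≤ e m≤e) (≤-reflexive (cong (e +_) (sym (+-identityʳ e)))))

-- At `m ≡ 0` only the term `n * (n ∸ m)` survives, which calls for the telescoped bound. For
-- positive `m` the product term alone is enough, and the last factor 2 comes from `m²n³-≤`.
running-time : ∀ g p d z {m n t} → 1 ≤ n → m + m ≤ n →
  t ≤ g + 3 + suc n * (n * (suc m * suc m * z * suc n) + 29) + (p + 12 + n * (2 + (n * (2 + d) + 10))) →
  (m ≡ 0 → t ≤ g + 3 + suc n * (suc m * suc m * z * (3 * n) + 29) + (p + 12 + n * (2 + (n * (2 + d) + 10)))) →
  t ≤ (g + p + d + 87 + 16 * z) * 2 * (n * (n ∸ m) + m * n ^ 2 * (n ∸ m) ^ 2) ×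
  (1 ≤ m → t ≤ (g + p + d + 87 + 16 * z) * 2 * (m * n ^ 2 * (n ∸ m) ^ 2))
running-time g p d z {zero} {n} {t} 1≤n 2m≤n _ t≤ =
  ≤-trans (≤-trans (t≤ refl) (subst (λ y → g + 3 + suc n * (y * (3 * n) + 29) + (p + 12 + n * (2 + (n * (2 + d) + 10))) ≤ f * (n * n))
            (sym (*-identityˡ z)) (total-one-level g p d z 1≤n)))
    (≤-trans (*-monoˡ-≤ (n * n) (m≤m*n f 2)) (*-monoʳ-≤ (f * 2) (m≤m+n (n * n) 0))) ,
  λ ()
  where f = g + p + d + 87 + 16 * z
running-time g p d z {m@(suc _)} {n} {t} 1≤n 2m≤n t≤ _ = ≤-trans bound (*-monoʳ-≤ (f * 2) (m≤n+m _ (n * (n ∸ m)))) , λ _ → bound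
  where
  f = g + p + d + 87 + 16 * z
  bound : t ≤ f * 2 * (m * n ^ 2 * (n ∸ m) ^ 2)
  bound = ≤-trans t≤ (≤-trans (total-two-level g p d z {m} (s≤s z≤n) 1≤n)
    (≤-trans (*-monoʳ-≤ f (m²n³-≤ {m} 2m≤n)) (≤-reflexive (sym (*-assoc f 2 _)))))

factor : ℕ
factor = (worst initialise + worst pointer + worst descend + 87 + 16 * Z) * 2

-- Optimality and running time of the whole program

module Main (𝓡 : OrderedRing) (I : Instance 𝓡) (s : RAM.State 𝓡) (loaded : RAM.Loaded 𝓡 I s) where

  open Order 𝓡
  open Semantics 𝓡
  open Store
  open Instance I hiding (cost)
  open RAM 𝓡 using (Loaded; Outputs; ConstructsOptimum)
  open Loaded loaded

  σ₀ : Store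
  σ₀ = record { ireg = RAM.State.ireg s ; imem = RAM.State.imem s ; rreg = RAM.State.rreg s ; rmem = RAM.State.rmem s }

  -- The initial number memory as a whole, garbage included; what is known about it concerns the
  -- addresses up to `2 * n`.
  inp : ℕ → Carrier
  inp = RAM.State.rmem s

  inp≥0 : ∀ {a} → a ≤ 2 * n → 0# ≤R inp a
  inp≥0 {a} a≤2n with half a
  ... | j , inj₁ refl = subst (0# ≤R_) (trans (sym (q-in (fromℕ< j<1+n))) (cong (λ j → inp (2 * j)) (toℕ-fromℕ< j<1+n))) (q≥0 _)
    where j<1+n = s≤s (*-cancelˡ-≤ {j} {n} 2 a≤2n)
  ... | j , inj₂ refl = subst (0# ≤R_) (trans (sym (p-in (fromℕ< j<n))) (cong (λ j → inp (suc (2 * j))) (toℕ-fromℕ< j<n))) (p≥0 _)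
    where j<n = *-cancelˡ-< 2 j n a≤2n

  m₁≤n : m₁ ≤ n
  m₁≤n = ≤-trans (m≤m+n m₁ m₂) (≤-reflexive m₁+m₂≡n)

  m≤n : m ≤ n
  m≤n = ≤-trans (m⊓n≤m m₁ m₂) m₁≤n

  record Initialised (σ : Store) : Set where
    field
      {cmin cmaj fmin fmaj} : ℕ
      levels : Levels m₁ m₂ c₁ c₂ m cmin cmaj fmin fmaj
      regs   : Regs ((%n , n) ∷ (%N , suc n) ∷ (%m , m) ∷ (%cmin , cmin) ∷ (%cmaj , cmaj) ∷ []) σ
      places : Regs ((%fmin , fmin) ∷ (%fmaj , fmaj) ∷ []) σ

  run-initialise : Run initialise σ₀ (λ _ σ → Initialised σ)
  run-initialise = run-ops (run-if
    (λ le → let m≡ = m≤n⇒m⊓n≡m (subst₂ _≤_ m₁-in m₂-in le) in run-skip (record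
      { levels = levels₁ m≡
      ; regs = n≡ , cong suc n≡ , trans m₁-in (sym m≡) , c₁-in , c₂-in , tt
      ; places = refl , cong suc m₁-in , tt }))
    (λ ≰ → let m≡ = m≥n⇒m⊓n≡n (<⇒≤ (≰⇒> (λ le → ≰ (subst₂ _≤_ (sym m₁-in) (sym m₂-in) le)))) in run-skip (record
      { levels = levels₂ m≡
      ; regs = n≡ , cong suc n≡ , trans m₂-in (sym m≡) , c₂-in , c₁-in , tt
      ; places = cong suc m₁-in , refl , tt })))
    where
    n≡ : RAM.State.ireg s 0 + RAM.State.ireg s 1 ≡ n
    n≡ = trans (cong₂ _+_ m₁-in m₂-in) m₁+m₂≡n

  D : ℕ
  D = suc m * suc m * Z

  outputTime : ℕ
  outputTime = worst pointer + 12 + n * (2 + (n * (2 + worst descend) + 10))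

  module Solve {cmin cmaj fmin fmaj : ℕ} (L : Levels m₁ m₂ c₁ c₂ m cmin cmaj fmin fmaj) where
    open Levels L
    open Algorithm 𝓡 n m m≤n cmin cmaj inp inp≥0 using (baseRegs; Solved; TableInv; run-table)
    open MatchCost 𝓡 I inp cmin cmaj q-in p-in
    open Costs 𝓡 inp C

    cost-solution : ∀ S {τ} {T : Tree 0 n} → (∀ k → μ (Solution.φ S k) ≡ (if τ (toℕ k) then cmin else cmaj)) →
      Match τ T (Solution.tree S) → Instance.cost I S ≈ cost 0# T
    cost-solution S eq = cost-match eq 0

    module Competitor (S : Solution) where
      open Solution S

      address : ℕ → ℕ
      address x with x <? n
      ... | yes x<n = toℕ (φ (fromℕ< x<n))
      ... | no _    = n

      address-toℕ : ∀ k → address (toℕ k) ≡ toℕ (φ k)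
      address-toℕ k with toℕ k <? n
      ... | yes k<n = cong (toℕ ∘ φ) (fromℕ<-toℕ k k<n)
      ... | no k≮n  = ⊥-elim (k≮n (toℕ<n k))

      address-fromℕ< : ∀ {x} (x<n : x < n) → address x ≡ toℕ (φ (fromℕ< x<n))
      address-fromℕ< x<n = trans (cong address (sym (toℕ-fromℕ< x<n))) (address-toℕ (fromℕ< x<n))

      address-injective : ∀ {x y} → x < n → y < n → address x ≡ address y → x ≡ y
      address-injective {x} {y} x<n y<n eq = trans (sym (toℕ-fromℕ< x<n)) (trans
        (cong toℕ (Injection.injective assignment (toℕ-injective (trans (sym (address-fromℕ< x<n)) (trans eq (address-fromℕ< y<n))))))
        (toℕ-fromℕ< y<n))

      isCheap : ℕ → Bool
      isCheap x = does (address x <? m₁)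

      -- An injection of the keys into `n` addresses uses each address once. Hence every competitor
      -- has exactly the count for which the computed tree is optimal.
      count-cheap : count isCheap n ≡ m₁
      count-cheap = below-≡ address n address-injective
        (λ x<n → subst (_< n) (sym (address-fromℕ< x<n)) (toℕ<n _)) m₁≤n

      τ : ℕ → Bool
      τ = cheap ∘ isCheap

      μ-colour : ∀ k → μ (φ k) ≡ (if τ (toℕ k) then cmin else cmaj)
      μ-colour k = trans (cong (λ a → if does (a <? m₁) then c₁ else c₂) (sym (address-toℕ k)))
        (sym (trans (level-cost (τ (toℕ k))) (cong (λ t → if t then c₁ else c₂) (involutive (isCheap (toℕ k))))))

      matched : Σ (Tree 0 n) λ T → Match τ T tree
      matched = match-from τ tree refl (toℕ-fromℕ n)

      minors-matched : minors (proj₁ matched) ≡ m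
      minors-matched = trans (sym (+-identityʳ _)) (trans (match-minors (proj₂ matched))
        (subst (λ n → count τ n ≡ m) m₁+m₂≡n (from-cheap (subst (λ n → count isCheap n ≡ m₁) (sym m₁+m₂≡n) count-cheap))))

    module Found {mem v} (S : Solved mem 0 n m 0# v) where
      open Solved S renaming (tree to tree₀; count to minors₀)
      open Output 𝓡 n m 1≤n tree₀ minors₀ fmin fmaj using (colour; address; Written)

      isCheap : ℕ → Bool
      isCheap = cheap ∘ colour

      matched : Σ (FullBST n) (Match colour tree₀)
      matched = match-to tree₀ ≤-refl refl (toℕ-fromℕ n) (λ _ _ → refl)

      count-cheap : count isCheap n ≡ m₁
      count-cheap = subst (λ n → count isCheap n ≡ m₁) m₁+m₂≡n (to-cheap (subst (λ n → count colour n ≡ m) (sym m₁+m₂≡n)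
        (trans (sym (match-minors (proj₂ matched))) (trans (+-identityʳ _) minors₀))))

      open Placement n m₁ isCheap count-cheap

      φ₀ : Fin n → Fin n
      φ₀ k = fromℕ< (position-< (toℕ<n k))

      toℕ-φ₀ : ∀ k → toℕ (φ₀ k) ≡ position (toℕ k)
      toℕ-φ₀ k = toℕ-fromℕ< (position-< (toℕ<n k))

      solution : Solution
      solution = record
        { tree = proj₁ matched
        ; assignment = mk↣ {to = φ₀} λ {k} {l} eq → toℕ-injective (position-injective (toℕ<n k) (toℕ<n l)
            (trans (sym (toℕ-φ₀ k)) (trans (cong toℕ eq) (toℕ-φ₀ l)))) }

      μ-colour : ∀ k → μ (φ₀ k) ≡ (if colour (toℕ k) then cmin else cmaj)
      μ-colour k = trans (cong (λ a → if does (a <? m₁) then c₁ else c₂) (toℕ-φ₀ k))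
        (trans (cong (λ t → if t then c₁ else c₂) (position-<? (toℕ<n k))) (sym (level-cost (colour (toℕ k)))))

      optimum : Optimum solution
      optimum S′ = ≤R-trans (≈⇒≤R (cost-solution solution μ-colour (proj₂ matched)))
        (≤R-trans (optimal (proj₁ C′.matched) C′.minors-matched)
          (≈⇒≤R (≈-sym (cost-solution S′ C′.μ-colour (proj₂ C′.matched)))))
        where
        module C′ = Competitor S′

      outputs : ∀ {σ o} → imem σ 0 ≡ rootPtr tree₀ → (∀ {x} → x < n → Written x (imem σ)) → Outputs I (σ at o) solution
      outputs {σ} root≡ written = record
        { tree-out = Outputting.match-points 𝓡 (imem σ) (proj₂ matched)
            (λ _ x<n → Written.left (written x<n) , Written.right (written x<n)) root≡
        ; φ-out = λ k → trans (Written.placed (written (toℕ<n k))) (trans (addresses colour (toℕ k)) (cong suc (sym (toℕ-φ₀ k)))) }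

    Result : ℕ → ℕ → Store → Set
    Result t₀ t σ = Σ Solution λ S → (∀ o → Outputs I (σ at o) S) × Optimum S ×
      t ≤ t₀ + suc n * (n * (D * suc n) + 29) + outputTime × (m ≡ 0 → t ≤ t₀ + suc n * (D * (3 * n) + 29) + outputTime)

    run-rest : ∀ {σ t₀} → Regs baseRegs σ → Regs ((%fmin , fmin) ∷ (%fmaj , fmaj) ∷ []) σ → rmem σ ≡ inp →
      Run (table ︔ output) σ (λ t σ′ → Result (t₀ + 3) (t₀ + t) σ′)
    run-rest {σ} {t₀} (en , eN , em , base) (emin , emaj , _) refl = run-seq
      (run-table (en , eN , em , base) (λ _ → refl))
      λ { {σ₁} {t₁} e (v , refl , inv) → after {v = v} inv
          (keepRegs e ((%m , m) ∷ (%fmin , fmin) ∷ (%fmaj , fmaj) ∷ (%n , n) ∷ (%N , suc n) ∷ []) (em , emin , emaj , en , eN , tt)) }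
      where
      after : ∀ {σ₁ v} → TableInv (suc n) v σ₁ →
        Regs ((%m , m) ∷ (%fmin , fmin) ∷ (%fmaj , fmaj) ∷ (%n , n) ∷ (%N , suc n) ∷ []) σ₁ →
        Run output σ₁ (λ u σ′ → Result (t₀ + 3) (t₀ + (3 + v + u)) σ′)
      after {σ₁} {v} inv regs₁ = run-map (run-output regs₁ encoded)
        λ { {σ′} {u} _ (u≤ , root≡ , written) → F.solution , (λ o → F.outputs {σ′} {o} root≡ written) , F.optimum ,
            -- Once row 0 is complete, the remaining potential is simply dropped.
            bound u≤ T.simple , λ m≡0 → bound u≤ (≤-trans (m≤m+n v _) (T.amortised m≡0 {0} refl)) }
        where
        module T = TableInv inv
        E : Solved (imem σ₁) 0 n m 0# _
        E = T.rows {0} {n} {m} ≤-refl 1≤n ≤-refl ≤-refl (≤-trans (≤-reflexive (+-identityʳ m)) m≤n)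
        open Solved E renaming (tree to tree₀; count to minors₀)
        open Output 𝓡 n m 1≤n tree₀ minors₀ fmin fmaj using (run-output)
        module F = Found E
        bound : ∀ {u B} → u ≤ outputTime → v ≤ B → t₀ + (3 + v + u) ≤ t₀ + 3 + B + outputTime
        bound {u} {B} u≤ v≤ = begin
          t₀ + (3 + v + u)            ≤⟨ +-monoʳ-≤ t₀ (+-mono-≤ (+-monoʳ-≤ 3 v≤) u≤) ⟩
          t₀ + (3 + B + outputTime)   ≡⟨ +-assoc t₀ (3 + B) outputTime ⟨
          t₀ + (3 + B) + outputTime   ≡⟨ cong (_+ outputTime) (+-assoc t₀ 3 B) ⟨
          t₀ + 3 + B + outputTime     ∎
          where
          open ≤-Reasoning

  Specification : ℕ → Store → Set
  Specification t σ = Σ Solution λ S → (∀ o → Outputs I (σ at o) S) × Optimum S ×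
    t ≤ worst initialise + 3 + suc n * (n * (D * suc n) + 29) + outputTime ×
    (m ≡ 0 → t ≤ worst initialise + 3 + suc n * (D * (3 * n) + 29) + outputTime)

  run-twoLevel : Run twoLevel σ₀ Specification
  run-twoLevel = run-seq run-initialise λ {σ₁} {t₁} e ini → run-map
    (Solve.run-rest (Initialised.levels ini) {t₀ = t₁} (Initialised.regs ini) (Initialised.places ini) (keepRM e))
    λ _ (S , out , opt , t≤ , t≤₀) → S , out , opt ,
      ≤-trans t≤ (+-monoˡ-≤ outputTime (+-monoˡ-≤ (suc n * (n * (D * suc n) + 29)) (+-monoˡ-≤ 3 (time e)))) ,
      λ m≡0 → ≤-trans (t≤₀ m≡0) (+-monoˡ-≤ outputTime (+-monoˡ-≤ (suc n * (D * (3 * n) + 29)) (+-monoˡ-≤ 3 (time e))))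

  constructs : ∀ {t σ S} → Exec twoLevel σ₀ t σ → (∀ o → Outputs I (σ at o) S) → Optimum S →
    ConstructsOptimum (compile 0 twoLevel) I s t
  constructs {t} {σ} {S} e out opt = _ , S , subst (λ s → RAM._⊢_⇓[_]_ 𝓡 (compile 0 twoLevel) s t (σ at size twoLevel)) s≡ (halts e) , out _ , opt
    where
    s≡ : σ₀ at 0 ≡ s
    s≡ = cong (σ₀ at_) (sym pc≡0)

  conclusion : Σ ℕ λ t → ConstructsOptimum (compile 0 twoLevel) I s t ×
    t ≤ factor * (n * (n ∸ m) + m * n ^ 2 * (n ∸ m) ^ 2) × (1 ≤ m → t ≤ factor * (m * n ^ 2 * (n ∸ m) ^ 2))
  conclusion =
    let σ , t , e , S , out , opt , t≤ , t≤₀ = run-twoLevel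
    in t , constructs e out opt ,
       running-time (worst initialise) (worst pointer) (worst descend) Z {m} 1≤n
         (≤-trans (+-mono-≤ (m⊓n≤m m₁ m₂) (m⊓n≤n m₁ m₂)) (≤-reflexive m₁+m₂≡n)) t≤ t≤₀

mainTheorem4 : Σ Program λ P → Σ ℕ λ C →
    (R : OrderedRing) (I : Instance R) →
    let n = Instance.n I in
    let m = Instance.m I in
    (s : RAM.State R) → RAM.Loaded R I s →
    Σ ℕ λ t →
    RAM.ConstructsOptimum R P I s t
    × t ≤ C * (n * (n ∸ m) + m * n ^ 2 * (n ∸ m) ^ 2)
    × (1 ≤ m → t ≤ C * (m * n ^ 2 * (n ∸ m) ^ 2))
mainTheorem4 = compile 0 twoLevel , factor , Main.conclusion
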